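{- Let $k$ be a nonnegative integer. Every connected $k$-regular (finite, simple) graph with at most $3k+3$ vertices has a Hamiltonian path. Furthermore, for every even $k\ge 6$ there exists a connected $k$-regular graph on $3k+4$ vertices with no Hamiltonian path, and for every odd $k\ge 5$ there exists a connected $k$-regular graph on $3k+5$ vertices with no Hamiltonian path.
   Context: A Hamiltonian path in a graph is a path containing all of its vertices. Graphs are finite and simple. -}

module Defs where

open import Data.Nat using (ℕ; suc; _+_; _*_; _≤_; _<_)
import Data.Nat.Properties
open import Data.Fin using (Fin; toℕ; fromℕ<; inject₁) renaming (suc to fsuc)
open import Data.Bool using (Bool; true; false; T)
open import Data.List using (List; filter; length)
open import Data.List using () renaming (tabulate to ltab)
open import Data.Product using (Σ; _×_; _,_; ∃)
open import Relation.Nullary using (¬_)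
open import Relation.Binary.PropositionalEquality using (_≡_)
open import Function.Definitions using (Injective)
open import Data.Bool.Properties using (T?)

record Graph (n : ℕ) : Set where
  field
    adj   : Fin n → Fin n → Bool
    sym   : ∀ u v → adj u v ≡ adj v u
    irref : ∀ v → adj v v ≡ false
open Graph public

Adj : ∀ {n} → Graph n → Fin n → Fin n → Set
Adj G u v = T (adj G u v)

degree : ∀ {n} → Graph n → Fin n → ℕ
degree {n} G v = length (filter (λ u → T? (adj G v u)) (ltab {n = n} (λ u → u)))

Regular : ∀ {n} → ℕ → Graph n → Set
Regular k G = ∀ v → degree G v ≡ k

data Walk {n} (G : Graph n) : Fin n → Fin n → Set where
  here : ∀ {u} → Walk G u u
  step : ∀ {u v w} → Adj G u v → Walk G v w → Walk G u w

Connected : ∀ {n} → Graph n → Set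
Connected {n} G = (1 ≤ n) × (∀ u v → Walk G u v)

-- Hamiltonian path: a sequence p 0, …, p (n-1) of distinct vertices
-- (hence containing every vertex exactly once) with consecutive ones adjacent.
HamiltonianPath : ∀ {n} → Graph n → Set
HamiltonianPath {n} G =
  Σ (Fin n → Fin n) λ p →
    Injective _≡_ _≡_ p ×
    (∀ (i : ℕ) (h : suc i < n) →
       Adj G (p (fromℕ< (Data.Nat.Properties.<-trans (Data.Nat.Properties.n<1+n i) h)))
             (p (fromℕ< h)))

{-# OPTIONS --safe #-}
module Submission where

-- Adding a universal vertex w₀ turns paths of G into cycles; let C be a longest cycle with the fewest isolated vertices outside.
-- Suppose C misses a vertex.  Given a set X ∋ w₀ of pairwise non-consecutive vertices of C any two of which can be joined through
-- p vertices outside, the ends l, r of the gaps between consecutive X-vertices satisfy strong non-adjacency conditions, and counting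
-- the edges between X and these ends gives one inequality.  If no outside vertex is isolated, X is the common neighbourhood of the
-- ends of a longest outside path, and the inequality fails.  If v is isolated, X is Woodall's hopping closure of N(v); the inequality
-- then leaves only X = N(v), and rotating C around w₀ excludes this case too.  The examples are three dense blocks sharing a cut vertex.

open import Defs hiding (sym; here)
open import Data.Nat using (ℕ; zero; suc; _+_; _*_; _∸_; _≤_; _<_; z≤n; s≤s; _<?_; _≤?_)
open import Data.Nat.Properties using (≤-refl; ≤-trans; ≤-reflexive; ≤-pred; ≤-antisym; n≮n; ≮⇒≥; ≰⇒>; <⇒≤; <-trans; <-cmp; n<1+n; n≤1+n; m≤n⇒m≤1+n; m≤n⇒m<n∨m≡n; suc-injective; +-suc; +-assoc; +-comm; +-identityʳ; +-mono-≤; +-monoˡ-≤; +-monoʳ-≤; +-cancelˡ-≤; m≤m+n; m≤n+m; *-zeroʳ; *-comm; *-distribˡ-+; *-monoʳ-≤; *-cancelʳ-≤; m∸n+n≡m; m+n∸n≡m; ∸-monoˡ-≤; ∸-monoʳ-≤; ∸-monoʳ-<)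
open import Data.Nat.Divisibility using (_∣_; divides)
open import Data.Nat.Induction using (<-rec)
open import Data.Nat.Tactic.RingSolver using (solve-∀)
open import Data.Fin using (Fin; zero; suc; toℕ; fromℕ<; cast; splitAt; _≟_; _↑ˡ_; _↑ʳ_)
open import Data.Fin.Properties using (all?; any?; toℕ-cast; toℕ-fromℕ<; toℕ-injective; toℕ<n; fromℕ<-toℕ; injective⇒≤; splitAt-↑ˡ; splitAt-↑ʳ; splitAt⁻¹-↑ˡ; splitAt⁻¹-↑ʳ)
open import Data.Bool using (Bool; true; false; T; not; _∧_; if_then_else_)
open import Data.Bool.Properties using (T?)
open import Data.List using (List; []; _∷_; _++_; reverse; filter; allFin; tabulate; length; lookup; map; concatMap)
open import Data.List.Properties using (++-assoc; ++-identityʳ; unfold-reverse; concatMap-++; ∷-injectiveˡ; ∷-injectiveʳ; ∷ʳ-injective)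
open import Data.List.Relation.Unary.Any using (here; there)
open import Data.List.Membership.Propositional using (_∈_; _∉_)
open import Data.List.Membership.Propositional.Properties using (∈-∃++; ∈-++⁺ˡ; ∈-++⁺ʳ; ∈-++⁻; ∈-allFin; ∈-filter⁻; ∈-lookup)
open import Data.Product using (Σ; _×_; _,_; ∃; ∃₂; proj₁; proj₂)
open import Data.Sum using (_⊎_; inj₁; inj₂)
open import Data.Empty using (⊥; ⊥-elim)
open import Function using (_∘_)
open import Function.Definitions using (Injective)
open import Relation.Nullary using (¬_; Dec; yes; no; does)
open import Relation.Nullary.Decidable using (¬?; _×-dec_; _⊎-dec_; _→-dec_)
open import Relation.Unary using (Decidable)
open import Relation.Binary.Definitions using (tri<; tri≈; tri>)
open import Relation.Binary.PropositionalEquality using (_≡_; _≢_; refl; sym; trans; cong; cong₂; subst; subst₂)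

-- Apart from its edge to `w₀` every end of a gap has degree k, and a vertex of X other than `w₀`
-- has at most k neighbours among the ends and the outside path. The ends outnumber those vertices
-- of X, so many edges at ends must run into gaps or leave the cycle. The non-adjacency conditions
-- cap the former by the excess of the gaps over p vertices each, and 3k+4 vertices leave little
-- excess. A one-vertex gap would spoil the count unless all neighbours of its vertex lie in X:
-- hence the hopping closure. Minimality of the isolated vertices keeps these neighbours on C. With
-- an isolated vertex the inequality can still hold: t gaps with two ends leave a slack of t+1-k, at
-- most 2. Rotation keeps the vertex set of C, so the tight structure holds for every rotated cycle,
-- and big gaps on both sides of `w₀` would each use up 2. In the examples a component on k+1
-- vertices contains an even, positive number of neighbours of the cut vertex. Three of them with at
-- least two each account for even k from 6; for odd k one component gets k+2 vertices and a single
-- such neighbour.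

infixr 5 _∙_
_∙_ : ∀ {A : Set} {x y z : A} → x ≡ y → y ≡ z → x ≡ z
_∙_ = trans

-- Linear arithmetic by certificate: a ≤ b follows from A ≤ B once a + B + c = b + A is a semiring identity.
linear : ∀ {A B} a b c → A ≤ B → a + B + c ≡ b + A → a ≤ b
linear {A} {B} a b c A≤B eq = +-cancelˡ-≤ B a b (≤-trans (m≤m+n (B + a) c)
    (≤-trans (≤-reflexive (cong (_+ c) (+-comm B a) ∙ eq)) (≤-trans (+-monoʳ-≤ b A≤B) (≤-reflexive (+-comm b B)))))

impossible : ∀ {A B} c → A ≤ B → A ≡ B + suc c → ⊥
impossible {A} {B} c A≤B eq = n≮n B (linear (suc B) B c A≤B (lem B c ∙ cong (B +_) (sym eq)))
  where
  lem : ∀ B c → suc B + B + c ≡ B + (B + suc c)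
  lem = solve-∀

b2n : Bool → ℕ
b2n true  = 1
b2n false = 0

b2n≤1 : ∀ b → b2n b ≤ 1
b2n≤1 true  = ≤-refl
b2n≤1 false = z≤n

T⇒b2n : ∀ {b} → T b → b2n b ≡ 1
T⇒b2n {true} _ = refl

¬T⇒b2n : ∀ {b} → ¬ T b → b2n b ≡ 0
¬T⇒b2n {true}  h = ⊥-elim (h _)
¬T⇒b2n {false} _ = refl

b2n⇒T : ∀ {b} → 1 ≤ b2n b → T b
b2n⇒T {true} _ = _

ind : {P : Set} → Dec P → ℕ
ind d = b2n (does d)

ind-yes : {P : Set} (d : Dec P) → P → ind d ≡ 1
ind-yes (yes _) _ = refl
ind-yes (no ¬p) p = ⊥-elim (¬p p)

ind-no : {P : Set} (d : Dec P) → ¬ P → ind d ≡ 0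
ind-no (yes p) ¬p = ⊥-elim (¬p p)
ind-no (no _)  _  = refl

ind-mono : {P Q : Set} (d : Dec P) (e : Dec Q) → (P → Q) → ind d ≤ ind e
ind-mono (no _)  _ _ = z≤n
ind-mono (yes p) e f = ≤-reflexive (sym (ind-yes e (f p)))

-- Sums over lists

module _ {A : Set} where

  S : (A → ℕ) → List A → ℕ
  S f []       = 0
  S f (x ∷ xs) = f x + S f xs

  # : List A → ℕ
  # = S (λ _ → 1)

  S-++ : ∀ f (xs ys : List A) → S f (xs ++ ys) ≡ S f xs + S f ys
  S-++ f []       ys = refl
  S-++ f (x ∷ xs) ys = cong (f x +_) (S-++ f xs ys) ∙ sym (+-assoc (f x) _ _)

  S-rev : ∀ f (xs : List A) → S f (reverse xs) ≡ S f xs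
  S-rev f []       = refl
  S-rev f (x ∷ xs) =
    cong (S f) (unfold-reverse x xs) ∙
      S-++ f (reverse xs) (x ∷ []) ∙
        cong₂ _+_ (S-rev f xs) (+-identityʳ (f x)) ∙ +-comm (S f xs) (f x)

  S-mono : ∀ {f g : A → ℕ} (xs : List A) → (∀ x → x ∈ xs → f x ≤ g x) → S f xs ≤ S g xs
  S-mono []       h = z≤n
  S-mono (x ∷ xs) h = +-mono-≤ (h x (here refl)) (S-mono xs (λ y y∈ → h y (there y∈)))

  S-mono-< : ∀ {f g : A → ℕ} (xs : List A) → (∀ x → f x ≤ g x) → ∀ {x} → x ∈ xs → f x < g x → S f xs < S g xs
  S-mono-< (x ∷ xs) h (here refl) lt = +-mono-≤ lt (S-mono xs (λ y _ → h y))
  S-mono-< {f} {g} (x ∷ xs) h (there x∈) lt =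
    linear (suc (f x + S f xs)) (g x + S g xs) 0 (+-mono-≤ (h x) (S-mono-< xs h x∈ lt)) (lem (f x) (S f xs) (g x + S g xs))
    where
    lem : ∀ a b c → suc (a + b) + c + 0 ≡ c + (a + suc b)
    lem = solve-∀

  S-cong : ∀ {f g : A → ℕ} (xs : List A) → (∀ x → x ∈ xs → f x ≡ g x) → S f xs ≡ S g xs
  S-cong []       h = refl
  S-cong (x ∷ xs) h = cong₂ _+_ (h x (here refl)) (S-cong xs (λ y y∈ → h y (there y∈)))

  S-0 : ∀ {f : A → ℕ} (xs : List A) → (∀ x → x ∈ xs → f x ≡ 0) → S f xs ≡ 0
  S-0 []       h = refl
  S-0 (x ∷ xs) h = cong₂ _+_ (h x (here refl)) (S-0 xs (λ y y∈ → h y (there y∈)))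

  S-+ : ∀ (f g : A → ℕ) (xs : List A) → S (λ x → f x + g x) xs ≡ S f xs + S g xs
  S-+ f g []       = refl
  S-+ f g (x ∷ xs) = cong ((f x + g x) +_) (S-+ f g xs) ∙ lem (f x) (g x) (S f xs) (S g xs)
    where
    lem : ∀ a b c d → a + b + (c + d) ≡ a + c + (b + d)
    lem = solve-∀

  S-* : ∀ c (f : A → ℕ) (xs : List A) → S (λ x → c * f x) xs ≡ c * S f xs
  S-* c f []       = sym (*-zeroʳ c)
  S-* c f (x ∷ xs) = cong (c * f x +_) (S-* c f xs) ∙ sym (*-distribˡ-+ c (f x) (S f xs))

  S-const : ∀ c (xs : List A) → S (λ _ → c) xs ≡ c * # xs
  S-const c []       = sym (*-zeroʳ c)
  S-const c (x ∷ xs) = cong (c +_) (S-const c xs) ∙ lem c (# xs)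
    where
    lem : ∀ c n → c + c * n ≡ c * suc n
    lem = solve-∀

  S-≤# : ∀ {f : A → ℕ} (xs : List A) → (∀ x → f x ≤ 1) → S f xs ≤ # xs
  S-≤# xs h = S-mono xs (λ x _ → h x)

  S-∈ : ∀ (f : A → ℕ) {x} {xs : List A} → x ∈ xs → f x ≤ S f xs
  S-∈ f (here refl) = m≤m+n _ _
  S-∈ f {x} {y ∷ xs} (there x∈) = ≤-trans (S-∈ f x∈) (m≤n+m (S f xs) (f y))

  S-pos : ∀ (f : A → ℕ) (xs : List A) → 1 ≤ S f xs → ∃ λ x → x ∈ xs × 1 ≤ f x
  S-pos f (x ∷ xs) h with f x in eq
  ... | suc m = x , here refl , subst (1 ≤_) (sym eq) (s≤s z≤n)
  ... | zero with S-pos f xs h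
  ...   | y , y∈ , p = y , there y∈ , p

  S-filter : ∀ (f : A → ℕ) {P : A → Set} (P? : Decidable P) (xs : List A) → S f (filter P? xs) ≡ S (λ x → f x * ind (P? x)) xs
  S-filter f P? [] = refl
  S-filter f P? (x ∷ xs) with P? x
  ... | yes _ = cong₂ _+_ (lem (f x)) (S-filter f P? xs)
    where
    lem : ∀ a → a ≡ a * 1
    lem = solve-∀
  ... | no _  = S-filter f P? xs ∙ cong (_+ S (λ x → f x * ind (P? x)) xs) (sym (*-zeroʳ (f x)))

  length≡# : ∀ (xs : List A) → length xs ≡ # xs
  length≡# []       = refl
  length≡# (x ∷ xs) = cong suc (length≡# xs)

S-swap : ∀ {A B : Set} (g : A → B → ℕ) (xs : List A) (ys : List B) → S (λ x → S (g x) ys) xs ≡ S (λ y → S (λ x → g x y) xs) ys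
S-swap g []       ys = sym (S-0 ys (λ _ _ → refl))
S-swap g (x ∷ xs) ys = cong (S (g x) ys +_) (S-swap g xs ys) ∙ sym (S-+ (g x) (λ y → S (λ x → g x y) xs) ys)

S-map : ∀ {A B : Set} (f : B → ℕ) (g : A → B) (xs : List A) → S f (map g xs) ≡ S (f ∘ g) xs
S-map f g []       = refl
S-map f g (x ∷ xs) = cong (f (g x) +_) (S-map f g xs)

S-concatMap : ∀ {A B : Set} (f : B → ℕ) (g : A → List B) (xs : List A) → S f (concatMap g xs) ≡ S (λ x → S f (g x)) xs
S-concatMap f g []       = refl
S-concatMap f g (x ∷ xs) = S-++ f (g x) (concatMap g xs) ∙ cong (S f (g x) +_) (S-concatMap f g xs)

infix 4 _≈_
-- Equality up to rearrangement, encoded as agreement of all weighted sums: ring identities then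
-- prove it, and length, membership and `Uniq` transfer along it.
record _≈_ {A : Set} (xs ys : List A) : Set where
  constructor same-sums
  field sums : ∀ f → S f xs ≡ S f ys
open _≈_ public

-- Lists of vertices without repetition

module _ {N : ℕ} where

  private
    V : Set
    V = Fin N

  δ : V → V → ℕ
  δ u v = ind (u ≟ v)

  cnt : V → List V → ℕ
  cnt v = S (δ v)

  -- Stated through counts, so that it passes along `_≈_` and follows from comparisons of sums.
  record Uniq (xs : List V) : Set where
    constructor uniq
    field once : ∀ v → cnt v xs ≤ 1
  open Uniq public

  δ-refl : ∀ v → δ v v ≡ 1
  δ-refl v = ind-yes (v ≟ v) refl

  ∈⇒cnt : ∀ {v} {xs : List V} → v ∈ xs → 1 ≤ cnt v xs
  ∈⇒cnt {v} v∈ = ≤-trans (≤-reflexive (sym (δ-refl v))) (S-∈ (δ v) v∈)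

  cnt⇒∈ : ∀ {v} (xs : List V) → 1 ≤ cnt v xs → v ∈ xs
  cnt⇒∈ {v} xs h with S-pos (δ v) xs h
  ... | u , u∈ , p with v ≟ u
  ...   | yes refl = u∈
  cnt⇒∈ {v} xs h | u , u∈ , () | no _

  ∉⇒cnt : ∀ {v} (xs : List V) → v ∉ xs → cnt v xs ≡ 0
  ∉⇒cnt {v} xs v∉ with cnt v xs in eq
  ... | zero  = refl
  ... | suc m = ⊥-elim (v∉ (cnt⇒∈ xs (subst (1 ≤_) (sym eq) (s≤s z≤n))))

  infix 4 _∈?_
  _∈?_ : ∀ v (xs : List V) → Dec (v ∈ xs)
  v ∈? []       = no λ ()
  v ∈? (x ∷ xs) with v ≟ x
  ... | yes refl = yes (here refl)
  ... | no v≢x with v ∈? xs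
  ...   | yes v∈ = yes (there v∈)
  ...   | no v∉  = no λ { (here e) → v≢x e ; (there m) → v∉ m }

  ≈-∈ : ∀ {xs ys : List V} → xs ≈ ys → ∀ {v} → v ∈ xs → v ∈ ys
  ≈-∈ {ys = ys} e {v} v∈ = cnt⇒∈ ys (subst (1 ≤_) (sums e (δ v)) (∈⇒cnt v∈))

  ≈-Uniq : ∀ {xs ys : List V} → xs ≈ ys → Uniq xs → Uniq ys
  ≈-Uniq e u = uniq λ v → subst (_≤ 1) (sums e (δ v)) (once u v)

  Uniq-++ˡ : ∀ xs {ys : List V} → Uniq (xs ++ ys) → Uniq xs
  Uniq-++ˡ xs {ys} u = uniq λ v → ≤-trans (m≤m+n (cnt v xs) (cnt v ys)) (subst (_≤ 1) (S-++ (δ v) xs ys) (once u v))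

  Uniq-++ʳ : ∀ xs {ys : List V} → Uniq (xs ++ ys) → Uniq ys
  Uniq-++ʳ xs {ys} u = uniq λ v → ≤-trans (m≤n+m (cnt v ys) (cnt v xs)) (subst (_≤ 1) (S-++ (δ v) xs ys) (once u v))

  Uniq-disj : ∀ xs {ys : List V} → Uniq (xs ++ ys) → ∀ {v} → v ∈ xs → v ∉ ys
  Uniq-disj xs {ys} u {v} v∈ v∈′ = n≮n 1 (≤-trans (+-mono-≤ (∈⇒cnt v∈) (∈⇒cnt v∈′)) (subst (_≤ 1) (S-++ (δ v) xs ys) (once u v)))

  Uniq-join : ∀ xs {ys : List V} → Uniq xs → Uniq ys → (∀ {v} → v ∈ xs → v ∉ ys) → Uniq (xs ++ ys)
  Uniq-join xs {ys} ux uy d = uniq bound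
    where
    bound : ∀ v → cnt v (xs ++ ys) ≤ 1
    bound v with v ∈? xs
    ... | yes v∈ = subst (_≤ 1) (sym (S-++ (δ v) xs ys ∙ cong (cnt v xs +_) (∉⇒cnt ys (d v∈)) ∙ +-identityʳ _)) (once ux v)
    ... | no v∉  = subst (_≤ 1) (sym (S-++ (δ v) xs ys ∙ cong (_+ cnt v ys) (∉⇒cnt xs v∉))) (once uy v)

  Uniq-∷ : ∀ {v} {xs : List V} → v ∉ xs → Uniq xs → Uniq (v ∷ xs)
  Uniq-∷ {v} {xs} v∉ u = Uniq-join (v ∷ []) single u λ { (here refl) → v∉ }
    where
    single : Uniq (v ∷ [])
    single = uniq λ w → subst (_≤ 1) (sym (+-identityʳ (δ w v))) (b2n≤1 (does (w ≟ v)))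

  Uniq-[] : Uniq []
  Uniq-[] = uniq λ v → z≤n

  Uniq-head : ∀ {v} {xs : List V} → Uniq (v ∷ xs) → v ∉ xs
  Uniq-head {v} u = Uniq-disj (v ∷ []) u (here refl)

  allV : List V
  allV = allFin N

private
  S-tabulate : ∀ {A : Set} (g : A → ℕ) {m} (h : Fin m → A) → S g (tabulate h) ≡ S (g ∘ h) (allFin m)
  S-tabulate g {zero}  h = refl
  S-tabulate g {suc m} h = cong (g (h zero) +_) (S-tabulate g (h ∘ suc) ∙ sym (S-tabulate (g ∘ h) suc))

S-allFin-suc : ∀ {m} (g : Fin (suc m) → ℕ) → S g (allFin (suc m)) ≡ g zero + S (g ∘ suc) (allFin m)
S-allFin-suc g = cong (g zero +_) (S-tabulate g suc)

#-allFin : ∀ N → # (allFin N) ≡ N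
#-allFin zero    = refl
#-allFin (suc N) = S-allFin-suc {N} (λ _ → 1) ∙ cong suc (#-allFin N)

cnt-allFin : ∀ {N} (v : Fin N) → cnt v (allFin N) ≡ 1
cnt-allFin {suc N} zero    = S-allFin-suc {N} (δ zero) ∙ cong suc (S-0 (allFin N) (λ _ _ → refl))
cnt-allFin {suc N} (suc v) = S-allFin-suc (δ (suc v)) ∙ S-cong (allFin N) (λ u _ → same u) ∙ cnt-allFin v
  where
  same : ∀ u → δ (suc v) (suc u) ≡ δ v u
  same u with v ≟ u
  ... | yes _ = refl
  ... | no _  = refl

module _ {N : ℕ} where

  private
    V : Set
    V = Fin N

    S-δ : ∀ (f : V → ℕ) z (xs : List V) → S (λ u → f u * δ u z) xs ≡ f z * cnt z xs
    S-δ f z []       = sym (*-zeroʳ (f z))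
    S-δ f z (x ∷ xs) = cong₂ _+_ same (S-δ f z xs) ∙ sym (*-distribˡ-+ (f z) (δ z x) (cnt z xs))
      where
      same : f x * δ x z ≡ f z * δ z x
      same with x ≟ z | z ≟ x
      ... | yes refl | yes _  = refl
      ... | yes refl | no ¬e  = ⊥-elim (¬e refl)
      ... | no ¬e    | yes e  = ⊥-elim (¬e (sym e))
      ... | no _     | no _   = *-zeroʳ (f x) ∙ sym (*-zeroʳ (f z))

    S-via-cnt : ∀ (f : V → ℕ) zs → S (λ u → f u * cnt u zs) allV ≡ S f zs
    S-via-cnt f []       = S-0 (allFin N) (λ u _ → *-zeroʳ (f u))
    S-via-cnt f (z ∷ zs) =
      S-cong (allFin N) (λ u _ → *-distribˡ-+ (f u) (δ u z) (cnt u zs)) ∙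
        S-+ (λ u → f u * δ u z) (λ u → f u * cnt u zs) (allFin N) ∙
          cong₂ _+_ (S-δ f z (allFin N) ∙ cong (f z *_) (cnt-allFin z) ∙ lem (f z)) (S-via-cnt f zs)
      where
      lem : ∀ a → a * 1 ≡ a
      lem = solve-∀

  others : List V → List V
  others zs = filter (λ u → ¬? (u ∈? zs)) allV

  ∈-others⁻ : ∀ {zs u} → u ∈ others zs → u ∉ zs
  ∈-others⁻ {zs} u∈ = proj₂ (∈-filter⁻ (λ u → ¬? (u ∈? zs)) {xs = allV} u∈)

  -- Weighting all vertices by `cnt u zs` gives the sum over `zs`; without repetition the weights
  -- are 0 or 1, and `others` supplies the zeros.
  S-others : ∀ (f : V → ℕ) {zs} → Uniq zs → S f zs + S f (others zs) ≡ S f allV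
  S-others f {zs} uz =
    cong₂ _+_ (sym (S-via-cnt f zs)) (S-filter f (λ u → ¬? (u ∈? zs)) allV) ∙
      sym (S-+ (λ u → f u * cnt u zs) (λ u → f u * ind (¬? (u ∈? zs))) allV) ∙
        S-cong allV (λ u _ → pointwise u)
    where
    pointwise : ∀ u → f u * cnt u zs + f u * ind (¬? (u ∈? zs)) ≡ f u
    pointwise u with u ∈? zs
    ... | yes u∈ rewrite ≤-antisym (once uz u) (∈⇒cnt u∈) = lem (f u)
      where
      lem : ∀ a → a * 1 + a * 0 ≡ a
      lem = solve-∀
    ... | no u∉ rewrite ∉⇒cnt zs u∉ = lem (f u)
      where
      lem : ∀ a → a * 0 + a * 1 ≡ a
      lem = solve-∀

  S-Uniq-≤ : ∀ (f : V → ℕ) {zs} → Uniq zs → S f zs ≤ S f allV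
  S-Uniq-≤ f {zs} uz = ≤-trans (m≤m+n _ _) (≤-reflexive (S-others f uz))

  #-Uniq-≤ : ∀ {zs : List V} → Uniq zs → # zs ≤ N
  #-Uniq-≤ uz = ≤-trans (S-Uniq-≤ (λ _ → 1) uz) (≤-reflexive (#-allFin N))

-- Walks and cycles

data Seg {V : Set} (R : V → V → Set) : V → V → List V → Set where
  [_] : ∀ a → Seg R a a (a ∷ [])
  _∷_ : ∀ {a b c xs} → R a b → Seg R b c xs → Seg R a c (a ∷ xs)

module _ {V : Set} {R : V → V → Set} where

  join : ∀ {a b c d xs ys} → Seg R a b xs → R b c → Seg R c d ys → Seg R a d (xs ++ ys)
  join [ a ]   r t = r ∷ t
  join (q ∷ s) r t = q ∷ join s r t

  rev : (∀ {u v} → R u v → R v u) → ∀ {a b xs} → Seg R a b xs → Seg R b a (reverse xs)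
  rev sy [ a ] = [ a ]
  rev sy (_∷_ {a} {b} {c} {xs} r s) = subst (Seg R c a) (sym (unfold-reverse a xs)) (join (rev sy s) (sy r) [ a ])

  mapSeg : ∀ {Q : V → V → Set} → (∀ {u v} → R u v → Q u v) → ∀ {a b xs} → Seg R a b xs → Seg Q a b xs
  mapSeg f [ a ]   = [ a ]
  mapSeg f (r ∷ s) = f r ∷ mapSeg f s

  head-eq : ∀ {a b x xs} → Seg R a b (x ∷ xs) → a ≡ x
  head-eq [ _ ]   = refl
  head-eq (_ ∷ _) = refl

  last-eq : ∀ {a b y} xs → Seg R a b (xs ++ y ∷ []) → b ≡ y
  last-eq []       [ _ ]    = refl
  last-eq []       (_ ∷ ())
  last-eq (x ∷ []) (r ∷ s)  = last-eq [] s
  last-eq (x ∷ x′ ∷ xs) (r ∷ s) = last-eq (x′ ∷ xs) s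

  suffix : ∀ {a c} xs {y ys} → Seg R a c (xs ++ y ∷ ys) → Seg R y c (y ∷ ys)
  suffix []            [ _ ]   = [ _ ]
  suffix []            (r ∷ s) = r ∷ s
  suffix (x ∷ [])      (r ∷ s) = suffix [] s
  suffix (x ∷ x′ ∷ xs) (r ∷ s) = suffix (x′ ∷ xs) s

  prefix : ∀ {a c} xs {y ys} → Seg R a c (xs ++ y ∷ ys) → Seg R a y (xs ++ y ∷ [])
  prefix []            [ _ ]   = [ _ ]
  prefix []            (r ∷ s) = [ _ ]
  prefix (x ∷ [])      (r ∷ s) = r ∷ prefix [] s
  prefix (x ∷ x′ ∷ xs) (r ∷ s) = r ∷ prefix (x′ ∷ xs) s

  edge : ∀ {a c} xs {x y ys} → Seg R a c (xs ++ x ∷ y ∷ ys) → R x y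
  edge []            (r ∷ [ _ ])   = r
  edge []            (r ∷ (_ ∷ _)) = r
  edge (x ∷ [])      (r ∷ s) = edge [] s
  edge (x ∷ x′ ∷ xs) (r ∷ s) = edge (x′ ∷ xs) s

  cut : ∀ {a c} x xs y ys → Seg R a c ((x ∷ xs) ++ y ∷ ys) → ∃ λ b → Seg R a b (x ∷ xs) × R b y × Seg R y c (y ∷ ys)
  cut x []        y ys (r ∷ s) with refl ← head-eq s = _ , [ _ ] , r , s
  cut x (x′ ∷ xs) y ys (r ∷ s) with cut x′ xs y ys s
  ... | b , s₁ , q , s₂ = b , r ∷ s₁ , q , s₂

  Seg-ends : ∀ {a b xs} → Seg R a b xs → a ∈ xs × b ∈ xs
  Seg-ends [ a ]   = here refl , here refl
  Seg-ends (r ∷ s) = here refl , there (proj₂ (Seg-ends s))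

module _ {V : Set} (R : V → V → Set) where

  -- A cycle is a closed walk, written without its final return to the start.
  Cyc : List V → Set
  Cyc []       = ⊥
  Cyc (x ∷ xs) = Seg R x x ((x ∷ xs) ++ x ∷ [])

module _ {V : Set} {R : V → V → Set} where

  glue : ∀ {a c} xs {x ys} → Seg R a x (xs ++ x ∷ []) → Seg R x c (x ∷ ys) → Seg R a c (xs ++ x ∷ ys)
  glue []            s t with refl ← head-eq s = t
  glue (x ∷ [])      (r ∷ s) t = r ∷ glue [] s t
  glue (x ∷ x′ ∷ xs) (r ∷ s) t = r ∷ glue (x′ ∷ xs) s t

  close : ∀ {a b xs} → Seg R a b xs → R b a → Cyc R xs
  close [ a ]   r = r ∷ [ a ]
  close (q ∷ s) r = q ∷ join s r [ _ ]

  unclose : ∀ {x xs} → Cyc R (x ∷ xs) → ∃ λ b → Seg R x b (x ∷ xs) × R b x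
  unclose {x} {xs} c with cut x xs x [] c
  ... | b , s , r , _ = b , s , r

  rotate : ∀ xs {y ys} → Cyc R (xs ++ y ∷ ys) → Cyc R (y ∷ ys ++ xs)
  rotate [] {y} {ys} c = subst (λ zs → Cyc R (y ∷ zs)) (sym (++-identityʳ ys)) c
  rotate (x ∷ xs) {y} {ys} c with cut x xs y (ys ++ x ∷ []) (subst (Seg R x x) (++-assoc (x ∷ xs) (y ∷ ys) (x ∷ [])) c)
  ... | b , s , r , t = subst (Seg R y y) (sym (++-assoc (y ∷ ys) (x ∷ xs) (y ∷ []))) (glue (y ∷ ys) t (join s r [ y ]))

data Nx {V : Set} : List V → V → V → Set where
  here  : ∀ {u v xs} → Nx (u ∷ v ∷ xs) u v
  there : ∀ {x u v xs} → Nx xs u v → Nx (x ∷ xs) u v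

module _ {V : Set} where

  Nx-split : ∀ {xs} {u v : V} → Nx xs u v → ∃₂ λ ys zs → xs ≡ ys ++ u ∷ v ∷ zs
  Nx-split here = [] , _ , refl
  Nx-split (there {x} n) with Nx-split n
  ... | ys , zs , refl = x ∷ ys , zs , refl

  Nx-here : ∀ ys {u v : V} {zs} → Nx (ys ++ u ∷ v ∷ zs) u v
  Nx-here []       = here
  Nx-here (y ∷ ys) = there (Nx-here ys)

  Nx-snoc : ∀ xs {y u v : V} → Nx (xs ++ y ∷ []) u v → Nx xs u v ⊎ (v ≡ y × ∃ λ ys → xs ≡ ys ++ u ∷ [])
  Nx-snoc []            (there ())
  Nx-snoc (x ∷ [])      here      = inj₂ (refl , [] , refl)
  Nx-snoc (x ∷ [])      (there (there ()))
  Nx-snoc (x ∷ x′ ∷ xs) here      = inj₁ here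
  Nx-snoc (x ∷ x′ ∷ xs) (there n) with Nx-snoc (x′ ∷ xs) n
  ... | inj₁ m             = inj₁ (there m)
  ... | inj₂ (e , ys , eq) = inj₂ (e , x ∷ ys , cong (x ∷_) eq)

  Nx-∈ˡ : ∀ {xs} {u v : V} → Nx xs u v → u ∈ xs
  Nx-∈ˡ here      = here refl
  Nx-∈ˡ (there n) = there (Nx-∈ˡ n)

  Nx-∈ʳ : ∀ {xs} {u v : V} → Nx xs u v → v ∈ xs
  Nx-∈ʳ here      = there (here refl)
  Nx-∈ʳ (there n) = there (Nx-∈ʳ n)

  Nx-succ : ∀ ys {d f zs} {c : V} → d ∉ ys → d ∉ f ∷ zs → Nx (ys ++ d ∷ f ∷ zs) d c → c ≡ f
  Nx-succ []       _  _  here      = refl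
  Nx-succ []       _  n₂ (there n) = ⊥-elim (n₂ (Nx-∈ˡ n))
  Nx-succ (y ∷ [])      n₁ n₂ here      = ⊥-elim (n₁ (here refl))
  Nx-succ (y ∷ [])      n₁ n₂ (there n) = Nx-succ [] (n₁ ∘ there) n₂ n
  Nx-succ (y ∷ y′ ∷ ys) n₁ n₂ here      = ⊥-elim (n₁ (here refl))
  Nx-succ (y ∷ y′ ∷ ys) n₁ n₂ (there n) = Nx-succ (y′ ∷ ys) (n₁ ∘ there) n₂ n

  Nx-pred : ∀ ys {e d zs} {c : V} → d ∉ ys → d ≢ e → d ∉ zs → Nx (ys ++ e ∷ d ∷ zs) c d → c ≡ e
  Nx-pred []            n₁ ne n₂ here = refl
  Nx-pred []            n₁ ne n₂ (there here) = ⊥-elim (n₂ (here refl))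
  Nx-pred []            n₁ ne n₂ (there (there n)) = ⊥-elim (n₂ (Nx-∈ʳ n))
  Nx-pred (y ∷ [])      n₁ ne n₂ here = ⊥-elim (ne refl)
  Nx-pred (y ∷ [])      n₁ ne n₂ (there n) = Nx-pred [] (n₁ ∘ there) ne n₂ n
  Nx-pred (y ∷ y′ ∷ ys) n₁ ne n₂ here = ⊥-elim (n₁ (there (here refl)))
  Nx-pred (y ∷ y′ ∷ ys) n₁ ne n₂ (there n) = Nx-pred (y′ ∷ ys) (n₁ ∘ there) ne n₂ n

Nx? : ∀ {N} (xs : List (Fin N)) u v → Dec (Nx xs u v)
Nx? []           u v = no λ ()
Nx? (x ∷ [])     u v = no λ { (there ()) }
Nx? (x ∷ y ∷ xs) u v with x ≟ u | y ≟ v | Nx? (y ∷ xs) u v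
... | yes refl | yes refl | _     = yes here
... | _        | _        | yes n = yes (there n)
... | no x≢u   | _        | no ¬n = no λ { here → x≢u refl ; (there n) → ¬n n }
... | _        | no y≢v   | no ¬n = no λ { here → y≢v refl ; (there n) → ¬n n }

-- Lets a cycle be regarded as a walk along its own edges only; `EO` is obtained from it.
Seg-Nx : ∀ {V : Set} {R : V → V → Set} {a b xs} → Seg R a b xs → Seg (λ u v → R u v × Nx xs u v) a b xs
Seg-Nx [ a ] = [ a ]
Seg-Nx (r ∷ s) with Seg-Nx s
... | [ _ ]  = (r , here) ∷ [ _ ]
... | q ∷ s′ = (r , here) ∷ mapSeg (λ (r , n) → r , there n) (q ∷ s′)

swap-≈ : ∀ {V : Set} (xs ys : List V) → xs ++ ys ≈ ys ++ xs
swap-≈ xs ys = same-sums λ f → S-++ f xs ys ∙ +-comm (S f xs) (S f ys) ∙ sym (S-++ f ys xs)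

rev-≈ : ∀ {V : Set} (xs : List V) → reverse xs ≈ xs
rev-≈ xs = same-sums λ f → S-rev f xs

≈-sym : ∀ {V : Set} {xs ys : List V} → xs ≈ ys → ys ≈ xs
≈-sym e = same-sums λ f → sym (sums e f)

≈-trans : ∀ {V : Set} {xs ys zs : List V} → xs ≈ ys → ys ≈ zs → xs ≈ zs
≈-trans e e′ = same-sums λ f → sums e f ∙ sums e′ f

≡⇒≈ : ∀ {V : Set} {xs ys : List V} → xs ≡ ys → xs ≈ ys
≡⇒≈ refl = same-sums λ _ → refl

-- Deleting the edge from `u` to `v` opens the cycle: rotation brings `v` to the front, and `u` is
-- then last.
cut-cycle : ∀ {V : Set} {R : V → V → Set} {x xs u v} → Cyc R (x ∷ xs) → Nx ((x ∷ xs) ++ x ∷ []) u v → ∃ λ Q → Seg R v u Q × Q ≈ (x ∷ xs)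
cut-cycle {R = R} {x} {xs} {u} {v} c n with Nx-snoc (x ∷ xs) n
... | inj₂ (refl , ys , eq) with unclose c
...   | b , s , _ with last-eq ys (subst (Seg R x b) eq s)
...     | refl = x ∷ xs , s , same-sums λ _ → refl
cut-cycle {R = R} {x} {xs} {u} {v} c n | inj₁ n′ with Nx-split n′
... | ys , zs , eq with unclose (rotate (ys ++ u ∷ []) {v} {zs} (subst (Cyc R) (eq ∙ sym (++-assoc ys (u ∷ []) (v ∷ zs))) c))
...   | b , s , _ with last-eq (v ∷ zs ++ ys) (subst (Seg R v b) (sym (++-assoc (v ∷ zs) ys (u ∷ []))) s)
...     | refl = v ∷ zs ++ ys ++ u ∷ [] , s , ≈-trans (swap-≈ (v ∷ zs) (ys ++ u ∷ [])) (≡⇒≈ (++-assoc ys (u ∷ []) (v ∷ zs) ∙ sym eq))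

-- The setting with a universal vertex, and extremal cycles

record Ctx : Set where
  field
    N      : ℕ
    a      : Fin N → Fin N → Bool
    a-sym  : ∀ u v → a u v ≡ a v u
    a-irr  : ∀ v → a v v ≡ false
    w₀     : Fin N
    univ   : ∀ v → v ≢ w₀ → T (a w₀ v)
    k      : ℕ
    -- Degree and order exceed those of the original graph by one, on account of `w₀`.
    deg    : ∀ v → v ≢ w₀ → S (λ u → b2n (a v u)) (allFin N) ≡ suc k
    small  : N ≤ 3 * k + 4
    -- This is what remains of the connectivity of the original graph: an edge leaves the cycle at a
    -- vertex other than `w₀`.
    attach : ∀ (C : List (Fin N)) t z → t ∈ C → t ≢ w₀ → z ∉ C → z ≢ w₀ → ∃₂ λ t z → t ∈ C × t ≢ w₀ × z ∉ C × T (a t z)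
    -- A spanning cycle would turn into a Hamiltonian path on removal of `w₀`.
    nonspanning : ∀ C → Cyc (λ u v → T (a u v)) C → Uniq C → # C < N

module Extremal (Γ : Ctx) where
  open Ctx Γ public

  V : Set
  V = Fin N

  E : V → V → Set
  E u v = T (a u v)

  E-sym : ∀ {u v} → E u v → E v u
  E-sym {u} {v} = subst T (a-sym u v)

  E-irr : ∀ {v} → ¬ E v v
  E-irr {v} e = subst T (a-irr v) e

  dg : V → List V → ℕ
  dg w = S (λ u → b2n (a w u))

  dg-swap : ∀ xs ys → S (λ w → dg w ys) xs ≡ S (λ y → dg y xs) ys
  dg-swap xs ys = S-swap (λ w u → b2n (a w u)) xs ys ∙ S-cong ys (λ y _ → S-cong xs (λ x _ → cong b2n (a-sym x y)))

  dg-∈ : ∀ {w u xs} → E w u → u ∈ xs → 1 ≤ dg w xs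
  dg-∈ {w} {u} e u∈ = ≤-trans (≤-reflexive (sym (T⇒b2n e))) (S-∈ (λ u → b2n (a w u)) u∈)

  dg-none : ∀ {w} xs → (∀ {u} → u ∈ xs → ¬ E w u) → dg w xs ≡ 0
  dg-none xs h = S-0 xs (λ u u∈ → ¬T⇒b2n (h u∈))

  dg≤# : ∀ w xs → dg w xs ≤ # xs
  dg≤# w xs = S-≤# xs (λ u → b2n≤1 (a w u))

  own : ∀ {w} zs → w ∈ zs → suc (dg w zs) ≤ # zs
  own {w} (z ∷ zs) (here refl) = s≤s (≤-trans (≤-reflexive (cong (_+ dg w zs) (cong b2n (a-irr w)))) (dg≤# w zs))
  own {w} (z ∷ zs) (there m)   = ≤-trans (≤-reflexive (sym (+-suc _ _))) (+-mono-≤ (b2n≤1 (a w z)) (own zs m))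

  dg-all : ∀ {w} xs → (∀ {u} → u ∈ xs → E w u) → dg w xs ≡ # xs
  dg-all xs h = S-cong xs (λ u u∈ → T⇒b2n (h u∈))

  dg-full : ∀ {w y} xs → # xs ≤ dg w xs → y ∈ xs → E w y
  dg-full {w} {y} xs le y∈ with T? (a w y)
  ... | yes e = e
  ... | no ¬e = ⊥-elim (n≮n _ (≤-trans (S-mono-< xs (λ u → b2n≤1 (a w u)) y∈ (≤-reflexive (cong suc (¬T⇒b2n ¬e)))) le))

  -- A missed `z` and `w` itself would be two places of `zs` without a neighbour of `w`, one more
  -- than the degree allows.
  full : ∀ {w z} zs → w ∈ zs → z ∈ zs → z ≢ w → # zs ≤ suc (dg w zs) → E w z
  full {w} {z} zs w∈ z∈ z≢w le with T? (a w z)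
  ... | yes e = e
  ... | no ¬e = ⊥-elim (impossible 0 (+-mono-≤ le (+-mono-≤ (≤-trans (≤-reflexive (sym total)) (S-mono zs (λ u _ → pointwise u)))
      (+-mono-≤ (∈⇒cnt w∈) (∈⇒cnt z∈))))
                  (lem (dg w zs) (cnt w zs) (cnt z zs) (# zs)))
    where
    lem : ∀ d w z n → n + (d + (w + z) + (1 + 1)) ≡ suc d + (n + (w + z)) + suc 0
    lem = solve-∀
    total : S (λ u → b2n (a w u) + (δ w u + δ z u)) zs ≡ dg w zs + (cnt w zs + cnt z zs)
    total = S-+ (λ u → b2n (a w u)) (λ u → δ w u + δ z u) zs ∙ cong (dg w zs +_) (S-+ (δ w) (δ z) zs)
    pointwise : ∀ u → b2n (a w u) + (δ w u + δ z u) ≤ 1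
    pointwise u with w ≟ u | z ≟ u
    ... | yes refl | yes refl = ⊥-elim (z≢w refl)
    ... | yes refl | no _     = ≤-reflexive (cong (_+ 1) (cong b2n (a-irr w)))
    ... | no _     | yes refl = ≤-reflexive (cong (_+ 1) (¬T⇒b2n ¬e))
    ... | no _     | no _     = ≤-trans (≤-reflexive (+-identityʳ _)) (b2n≤1 (a w u))

  Iso : List V → V → Set
  Iso C u = u ∉ C × (∀ w → E u w → w ∈ C)

  Iso? : ∀ C u → Dec (Iso C u)
  Iso? C u = ¬? (u ∈? C) ×-dec all? (λ w → T? (a u w) →-dec (w ∈? C))

  iso : List V → ℕ
  iso C = S (λ u → ind (Iso? C u)) allV

  record Ext (C : List V) : Set where
    field
      cyc    : Cyc E C
      un     : Uniq C
      maxlen : ∀ C′ → Cyc E C′ → Uniq C′ → # C′ ≤ # C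
      miniso : ∀ C′ → Cyc E C′ → Uniq C′ → # C′ ≡ # C → iso C ≤ iso C′
  open Ext public

  Iso-≈ : ∀ {C C′} → C ≈ C′ → ∀ {u} → Iso C u → Iso C′ u
  Iso-≈ e (n , h) = (λ m → n (≈-∈ (≈-sym e) m)) , λ w ew → ≈-∈ e (h w ew)

  Ext-≈ : ∀ {C C′} → Ext C → C ≈ C′ → Cyc E C′ → Ext C′
  Ext-≈ {C} {C′} x e c = record
    { cyc = c
    ; un = ≈-Uniq e (un x)
    ; maxlen = λ D cD uD → subst (# D ≤_) (sums e _) (maxlen x D cD uD)
    ; miniso = λ D cD uD l → ≤-trans (S-mono allV (λ u _ → ind-mono (Iso? C′ u) (Iso? C u) (Iso-≈ (≈-sym e)))) (miniso x D cD uD (l ∙ sym (sums e _)))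
    }

  -- Lexicographic descent: first on the number of missed vertices, then, among longest cycles, on
  -- the number of isolated vertices outside.
  extremal : (∀ C → Ext C → ⊥) → ∀ C → Cyc E C → Uniq C → ⊥
  extremal h C c u = <-rec (λ m → ∀ C → N ∸ # C ≡ m → Cyc E C → Uniq C → ⊥) longest _ C refl c u
    where
    fewest : ∀ C → Cyc E C → Uniq C → (∀ D → Cyc E D → Uniq D → # D ≤ # C) → ⊥
    fewest C c u mx = <-rec (λ m → ∀ C → iso C ≡ m → Cyc E C → Uniq C → (∀ D → Cyc E D → Uniq D → # D ≤ # C) → ⊥)
      (λ m ih C eq c u mx → h C (record
        { cyc = c ; un = u ; maxlen = mx
        ; miniso = λ D cD uD l → ≮⇒≥ (λ lt → ih (subst (iso D <_) eq lt) D refl cD uD (λ F cF uF → subst (# F ≤_) (sym l) (mx F cF uF))) }))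
      _ C refl c u mx
    longest : ∀ m → (∀ {m′} → m′ < m → ∀ C → N ∸ # C ≡ m′ → Cyc E C → Uniq C → ⊥) → ∀ C → N ∸ # C ≡ m → Cyc E C → Uniq C → ⊥
    longest m ih C eq c u = fewest C c u (λ D cD uD → ≮⇒≥ (λ lt →
      ih (subst (N ∸ # D <_) eq (∸-monoʳ-< lt (#-Uniq-≤ uD))) D refl cD uD))

  -- Otherwise the universal vertex could be inserted between the last and the first vertex of the
  -- cycle.
  w₀∈ : ∀ {C} → Ext C → w₀ ∈ C
  w₀∈ {x ∷ xs} X with w₀ ∈? (x ∷ xs)
  ... | yes m = m
  ... | no w∉ with unclose (cyc X)
  ...   | b , s , _ = ⊥-elim (n≮n _ (maxlen X (w₀ ∷ x ∷ xs)
            (close (univ x (λ { refl → w∉ (here refl) }) ∷ s) (E-sym (univ b (λ { refl → w∉ (proj₂ (Seg-ends s)) }))))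
            (Uniq-∷ w∉ (un X))))
  w₀∈ {[]} X = ⊥-elim (cyc X)

  standard : ∀ {C} → Ext C → ∃ λ P → Ext (w₀ ∷ P) × C ≈ (w₀ ∷ P)
  standard X with ∈-∃++ (w₀∈ X)
  ... | ys , zs , refl = zs ++ ys , Ext-≈ X (swap-≈ ys (w₀ ∷ zs)) (rotate ys (cyc X)) , swap-≈ ys (w₀ ∷ zs)

-- The gaps between the vertices of a cycle that lie in a set

-- Gaps are non-empty by construction. One-vertex gaps are kept apart, since they have one end
-- instead of two and obey different adjacency conditions.
data Gap (V : Set) : Set where
  sg : V → Gap V
  bg : V → List V → V → Gap V

module _ {V : Set} where

  toL : Gap V → List V
  toL (sg y)     = y ∷ []
  toL (bg l m r) = l ∷ m ++ r ∷ []

  ends : Gap V → List V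
  ends (sg y)     = y ∷ []
  ends (bg l m r) = l ∷ r ∷ []

  snocGap : Gap V → V → Gap V
  snocGap (sg y)     c = bg y [] c
  snocGap (bg l m r) c = bg l (m ++ r ∷ []) c

  toL-snoc : ∀ g c → toL (snocGap g c) ≡ toL g ++ c ∷ []
  toL-snoc (sg y)     c = refl
  toL-snoc (bg l m r) c = refl

  flat : List (V × Gap V) → List V
  flat = concatMap (λ b → proj₁ b ∷ toL (proj₂ b))

  heads : List (V × Gap V) → List V
  heads = map proj₁

  gaps : List (V × Gap V) → List V
  gaps = concatMap (λ b → toL (proj₂ b))

  S-flat : ∀ f bs → S f (flat bs) ≡ S f (heads bs) + S f (gaps bs)
  S-flat f [] = refl
  S-flat f ((x , g) ∷ bs) =
    cong (f x +_) (S-++ f (toL g) (flat bs) ∙ cong (S f (toL g) +_) (S-flat f bs)) ∙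
      lem (f x) (S f (toL g)) (S f (heads bs)) (S f (gaps bs)) ∙ cong (f x + S f (heads bs) +_) (sym (S-++ f (toL g) (gaps bs)))
    where
    lem : ∀ a b c d → a + (b + (c + d)) ≡ a + c + (b + d)
    lem = solve-∀

  flat-head : ∀ (bs : List (V × Gap V)) x ys → ∃₂ λ h t → flat bs ++ x ∷ ys ≡ h ∷ t × h ∈ x ∷ heads bs
  flat-head []             x ys = x , ys , refl , here refl
  flat-head ((z , g) ∷ bs) x ys = z , _ , refl , there (here refl)

  module _ (X : V → Set) (X? : ∀ v → Dec (X v)) (c₀ : V) (Xc₀ : X c₀) where

    Blocks : List (V × Gap V) → Set
    Blocks bs = ∀ {b} → b ∈ bs → X (proj₁ b) × (∀ {u} → u ∈ toL (proj₂ b) → ¬ X u)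

    private
      fill : ∀ x g cs → X x → (∀ {u} → u ∈ toL g → ¬ X u) → (∀ {u v} → Nx (cs ++ c₀ ∷ []) u v → X u → X v → ⊥) →
        ∃₂ λ g′ bs → flat ((x , g′) ∷ bs) ≡ x ∷ toL g ++ cs × Blocks ((x , g′) ∷ bs)
      fill x g [] Xx ng nc = g , [] , refl , λ { (here refl) → Xx , ng }
      fill x g (c ∷ cs) Xx ng nc with X? c
      ... | no ¬Xc with fill x (snocGap g c) cs Xx ng′ (nc ∘ there)
        where
        ng′ : ∀ {u} → u ∈ toL (snocGap g c) → ¬ X u
        ng′ {u} u∈ with ∈-++⁻ (toL g) (subst (u ∈_) (toL-snoc g c) u∈)
        ... | inj₁ m           = ng m
        ... | inj₂ (here refl) = ¬Xc
      ...   | g′ , bs , eq , ok = g′ , bs , eq ∙ cong (x ∷_) (cong (_++ cs) (toL-snoc g c) ∙ ++-assoc (toL g) (c ∷ []) cs) , ok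
      fill x g (c ∷ []) Xx ng nc | yes Xc = ⊥-elim (nc here Xc Xc₀)
      fill x g (c ∷ c′ ∷ cs) Xx ng nc | yes Xc with X? c′
      ... | yes Xc′ = ⊥-elim (nc here Xc Xc′)
      ... | no ¬Xc′ with fill c (sg c′) cs Xc (λ { (here refl) → ¬Xc′ }) (λ n → nc (there (there n)))
      ...   | g′ , bs , eq , ok = g , (c , g′) ∷ bs , cong (λ zs → x ∷ toL g ++ zs) eq , λ { (here refl) → Xx , ng ; (there m) → ok m }

    -- As no two vertices of X are consecutive, every gap is non-empty; appending `c₀` extends this
    -- to the last gap, where the cycle closes.
    decomp : ∀ x cs → X x → (∀ {u v} → Nx (x ∷ cs ++ c₀ ∷ []) u v → X u → X v → ⊥) → ∃₂ λ g bs → flat ((x , g) ∷ bs) ≡ x ∷ cs × Blocks ((x , g) ∷ bs)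
    decomp x [] Xx nc = ⊥-elim (nc here Xx Xc₀)
    decomp x (c ∷ cs) Xx nc with X? c
    ... | yes Xc = ⊥-elim (nc here Xx Xc)
    ... | no ¬Xc = fill x (sg c) cs Xx (λ { (here refl) → ¬Xc }) (λ n → nc (there (there n)))

  Nx-++ʳ : ∀ xs {ys} {u v : V} → Nx ys u v → Nx (xs ++ ys) u v
  Nx-++ʳ []       n = n
  Nx-++ʳ (x ∷ xs) n = there (Nx-++ʳ xs n)

  Nx-++ˡ : ∀ {xs} ys {u v : V} → Nx xs u v → Nx (xs ++ ys) u v
  Nx-++ˡ ys here      = here
  Nx-++ˡ ys (there n) = there (Nx-++ˡ ys n)

  bg-neighbour : ∀ l m r {u : V} → u ∈ toL (bg l m r) → ∃ λ c → c ∈ toL (bg l m r) × (Nx (toL (bg l m r)) u c ⊎ Nx (toL (bg l m r)) c u)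
  bg-neighbour l []      r (here refl)         = r , there (here refl) , inj₁ here
  bg-neighbour l []      r (there (here refl)) = l , here refl , inj₂ here
  bg-neighbour l (c ∷ m) r (here refl)         = c , there (here refl) , inj₁ here
  bg-neighbour l (c ∷ m) r (there u∈) with bg-neighbour c m r u∈
  ... | d , d∈ , inj₁ n = d , there d∈ , inj₁ (there n)
  ... | d , d∈ , inj₂ n = d , there d∈ , inj₂ (there n)

  -- d counts how many further positions remain forbidden to f.
  scan : ∀ (f g : V → Bool) p → 1 ≤ p → ∀ d ys → d ≤ p → d ≤ # ys →
    (∀ m w post → ys ≡ m ++ w ∷ post → T (f w) → d ≤ # m) →
    (∀ pre u post → ys ≡ pre ++ u ∷ post → T (g u) → p ≤ # post) →
    (∀ pre u m w post → ys ≡ pre ++ u ∷ m ++ w ∷ post → T (g u) → T (f w) → p ≤ # m) →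
    S (b2n ∘ f) ys + S (b2n ∘ g) ys + d ≤ # ys
  scan f g p 1≤p d [] d≤p d≤0 hf hg hgf = d≤0
  scan f g p 1≤p d (y ∷ ys) d≤p d≤n hf hg hgf = go d d≤p d≤n hf (f y) (g y) refl refl
    where
    F G : ℕ
    F = S (b2n ∘ f) ys
    G = S (b2n ∘ g) ys
    next : ∀ e → e ≤ p → e ≤ # ys → (∀ m w post → ys ≡ m ++ w ∷ post → T (f w) → e ≤ # m) → F + G + e ≤ # ys
    next e e≤p e≤n h = scan f g p 1≤p e ys e≤p e≤n h
      (λ pre u post eq → hg (y ∷ pre) u post (cong (y ∷_) eq))
      (λ pre u m w post eq → hgf (y ∷ pre) u m w post (cong (y ∷_) eq))
    after : T (g y) → F + G + p ≤ # ys
    after t = next p ≤-refl (hg [] y ys refl t) (λ m w post eq → hgf [] y m w post (cong (y ∷_) eq) t)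
    go : ∀ d → d ≤ p → d ≤ suc (# ys) → (∀ m w post → y ∷ ys ≡ m ++ w ∷ post → T (f w) → d ≤ # m) →
      ∀ φ γ → φ ≡ f y → γ ≡ g y → b2n (f y) + F + (b2n (g y) + G) + d ≤ suc (# ys)
    go d d≤p d≤n h true true e e′ rewrite sym e | sym e′ with h [] y ys refl (subst T e _)
    -- A position in both sets occurs only when nothing is forbidden; it counts twice, and 1 ≤ p
    -- pays for the second time.
    ... | z≤n = linear (1 + F + (1 + G) + 0) (suc (# ys)) 0 (+-mono-≤ (after (subst T e′ _)) 1≤p) (lem F G (# ys) p)
      where
      lem : ∀ F G n p → 1 + F + (1 + G) + 0 + (n + p) + 0 ≡ suc n + (F + G + p + 1)
      lem = solve-∀
    -- The p positions newly forbidden by `g` outweigh the d old ones.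
    go d d≤p d≤n h false true e e′ rewrite sym e | sym e′ = linear (F + (1 + G) + d) (suc (# ys)) 0 (+-mono-≤ (after (subst T e′ _)) d≤p)
        (lem F G (# ys) p d)
      where
      lem : ∀ F G n p d → F + (1 + G) + d + (n + p) + 0 ≡ suc n + (F + G + p + d)
      lem = solve-∀
    go d d≤p d≤n h true false e e′ rewrite sym e | sym e′ with h [] y ys refl (subst T e _)
    ... | z≤n = s≤s (next 0 z≤n z≤n (λ _ _ _ _ _ → z≤n))
    go zero d≤p d≤n h false false e e′ rewrite sym e | sym e′ = ≤-trans (next 0 z≤n z≤n (λ _ _ _ _ _ → z≤n)) (n≤1+n _)
    go (suc d) d≤p (s≤s d≤n) h false false e e′ rewrite sym e | sym e′ =
      linear (F + G + suc d) (suc (# ys)) 0 (next d (≤-trans (n≤1+n d) d≤p) d≤n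
          (λ m w post eq t → ≤-pred (h (y ∷ m) w post (cong (y ∷_) eq) t))) (lem F G d (# ys))
      where
      lem : ∀ F G d n → F + G + suc d + n + 0 ≡ suc n + (F + G + d)
      lem = solve-∀

-- Rerouting the cycle through its gaps

module Counting (Γ : Ctx) where
  open Extremal Γ

  -- U is a walk outside the cycle with p vertices; link says that a walk along R between two vertices of X can be
  -- rearranged and closed up through U.  Walks along R leave the vertices in Y with their neighbours on the cycle.
  record Frame (P U : List V) (p : ℕ) : Set₁ where
    C : List V
    C = w₀ ∷ P
    On : V → V → Set
    On u v = Nx (C ++ w₀ ∷ []) u v ⊎ Nx (C ++ w₀ ∷ []) v u
    field
      X Y     : V → Set
      X?      : ∀ v → Dec (X v)
      Xw₀     : X w₀
      R       : V → V → Set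
      R-sym   : ∀ {u v} → R u v → R v u
      R⇒E     : ∀ {u v} → R u v → E u v
      mkR     : ∀ {u v} → E u v → ¬ Y u → ¬ Y v → R u v
      Rcyc    : Cyc R C
      nc      : ∀ {u v} → On u v → X u → X v → ⊥
      X⊆C     : ∀ {u} → X u → u ∈ C
      Y⊆C     : ∀ {u} → Y u → u ∈ C
      Ynb     : ∀ {u v} → On u v → Y u → X v
      1≤p     : 1 ≤ p
      #U      : # U ≡ p
      unCU    : Uniq (C ++ U)
      link    : ∀ {s t Q} → Seg R s t Q → X s → X t → ∀ es lost → (∀ f → S f Q + S f lost ≡ S f C + S f es) →
                Uniq ((C ++ U) ++ es) → (∀ {y} → y ∈ lost → ¬ Y y) → p + # es ≤ # lost
      -- A one-vertex gap could be replaced by U if p were at least 2; for p = 1 all neighbours of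
      -- its vertex must be in X.
      single  : ∀ {y} → y ∈ P → (∀ c → On c y → X c) → p ≤ 1 × (∀ u → E y u → X u)
      noU     : ∀ {u w x} → u ∈ U → X x → On x w → E u w → ⊥

  module Count {P U : List V} {p : ℕ} (F : Frame P U p) where
    open Frame F public

    abstract
      dc : ∃₂ λ g bs → flat ((w₀ , g) ∷ bs) ≡ w₀ ∷ P × Blocks X X? w₀ Xw₀ ((w₀ , g) ∷ bs)
      dc = decomp X X? w₀ Xw₀ w₀ P Xw₀ (λ n → nc (inj₁ n))

    Blk : Set
    Blk = V × Gap V

    g₀ : Gap V
    g₀ = proj₁ dc

    bs′ bs : List Blk
    bs′ = proj₁ (proj₂ dc)
    bs = (w₀ , g₀) ∷ bs′

    flat≡ : flat bs ≡ C
    flat≡ = proj₁ (proj₂ (proj₂ dc))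

    ok : Blocks X X? w₀ Xw₀ bs
    ok = proj₂ (proj₂ (proj₂ dc))

    unC : Uniq C
    unC = Uniq-++ˡ C unCU

    Xheads : ∀ {cs} → (∀ {b} → b ∈ cs → b ∈ bs) → ∀ {h} → h ∈ heads cs → X h
    Xheads {b ∷ cs} sub (here refl) = proj₁ (ok (sub (here refl)))
    Xheads {b ∷ cs} sub (there h∈)  = Xheads (sub ∘ there) h∈

    Xhead : ∀ {w cs} → X w → (∀ {b} → b ∈ cs → b ∈ bs) → ∀ {h} → h ∈ w ∷ heads cs → X h
    Xhead Xw sub (here refl) = Xw
    Xhead Xw sub (there m)   = Xheads sub m

    flat-++ : ∀ (xs ys : List Blk) → flat (xs ++ ys) ≡ flat xs ++ flat ys
    flat-++ = concatMap-++ (λ b → proj₁ b ∷ toL (proj₂ b))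

    ∈-mid : ∀ {A : Set} (xs : List A) {y ys} → y ∈ xs ++ y ∷ ys
    ∈-mid xs = ∈-++⁺ʳ xs (here refl)

    ∈-swap : ∀ {A : Set} (α β : List A) {b c} → c ∈ β ++ α → c ∈ α ++ b ∷ β
    ∈-swap α β m with ∈-++⁻ β m
    ... | inj₁ m′ = ∈-++⁺ʳ α (there m′)
    ... | inj₂ m′ = ∈-++⁺ˡ m′

    On-sub : ∀ pre mid post {u v} → C ≡ pre ++ mid ++ post → Nx mid u v ⊎ Nx mid v u → On u v
    On-sub pre mid post {u} {v} eq = λ { (inj₁ n) → inj₁ (up n) ; (inj₂ n) → inj₂ (up n) }
      where
      up : ∀ {u v} → Nx mid u v → Nx (C ++ w₀ ∷ []) u v
      up n = Nx-++ˡ (w₀ ∷ []) (subst (λ zs → Nx zs _ _) (sym eq) (Nx-++ʳ pre (Nx-++ˡ post n)))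

    block-at : ∀ α {x g β} → bs ≡ α ++ (x , g) ∷ β → C ≡ (flat α ++ x ∷ []) ++ toL g ++ flat β
    block-at α {x} {g} {β} eq = sym flat≡ ∙ cong flat eq ∙ flat-++ α ((x , g) ∷ β) ∙ sym (++-assoc (flat α) (x ∷ []) (toL g ++ flat β))

    -- A vertex of a big gap has a cycle neighbour inside the gap, hence outside X, whereas vertices
    -- of Y have both cycle neighbours in X.
    big-¬Y : ∀ {x l m r} → (x , bg l m r) ∈ bs → ∀ {u} → u ∈ toL (bg l m r) → ¬ Y u
    big-¬Y {x} {l} {m} {r} b∈ {u} u∈ Yu with ∈-∃++ b∈ | bg-neighbour l m r u∈
    ... | α , β , eq | c , c∈ , n = proj₂ (ok b∈) c∈ (Ynb (On-sub (flat α ++ x ∷ []) (toL (bg l m r)) (flat β) (block-at α eq) n) Yu)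

    -- The cycle neighbours of `y` are `x` and the head of the next block, or `w₀` after the last
    -- block. Both lie in X, so `single` applies.
    single-nbr : ∀ {x y} → (x , sg y) ∈ bs → p ≤ 1 × (∀ u → E y u → X u)
    single-nbr {x} {y} b∈ with ∈-∃++ b∈
    ... | α , β , eq with flat-head β w₀ []
    ...   | f , t , eqf , f∈ = single y∈P nbr
      where
      ¬Xy : ¬ X y
      ¬Xy = proj₂ (ok b∈) (here refl)
      Xx : X x
      Xx = proj₁ (ok b∈)
      C≡ : C ≡ flat α ++ x ∷ y ∷ flat β
      C≡ = block-at α eq ∙ ++-assoc (flat α) (x ∷ []) (y ∷ flat β)
      closed≡ : C ++ w₀ ∷ [] ≡ flat α ++ x ∷ y ∷ f ∷ t
      closed≡ = cong (_++ w₀ ∷ []) C≡ ∙ ++-assoc (flat α) (x ∷ y ∷ flat β) (w₀ ∷ []) ∙ cong (λ zs → flat α ++ x ∷ y ∷ zs) eqf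
      y∈C : y ∈ C
      y∈C = subst (y ∈_) (sym C≡) (∈-++⁺ʳ (flat α) (there (here refl)))
      y∈P : y ∈ P
      y∈P with y∈C
      ... | here refl = ⊥-elim (¬Xy Xw₀)
      ... | there m   = m
      Xf : X f
      Xf = Xhead Xw₀ (λ {b} m → subst (b ∈_) (sym eq) (∈-++⁺ʳ α (there m))) f∈
      u₁ : Uniq (flat α ++ x ∷ y ∷ flat β)
      u₁ = subst Uniq C≡ unC
      y∉α : y ∉ flat α
      y∉α m = Uniq-disj (flat α) u₁ m (there (here refl))
      y≢x : y ≢ x
      y≢x refl = ¬Xy Xx
      y∉β : y ∉ flat β
      y∉β = Uniq-head (Uniq-++ʳ (x ∷ []) (Uniq-++ʳ (flat α) u₁))
      y∉t : y ∉ f ∷ t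
      y∉t m with ∈-++⁻ (flat β) (subst (y ∈_) (sym eqf) m)
      ... | inj₁ m′          = y∉β m′
      ... | inj₂ (here refl) = ¬Xy Xw₀
      y∉αx : y ∉ flat α ++ x ∷ []
      y∉αx m with ∈-++⁻ (flat α) m
      ... | inj₁ m′       = y∉α m′
      ... | inj₂ (here e) = y≢x e
      nbr : ∀ c → On c y → X c
      nbr c (inj₁ n) = subst X (sym (Nx-pred (flat α) y∉α y≢x y∉t (subst (λ zs → Nx zs c y) closed≡ n))) Xx
      nbr c (inj₂ n) = subst X (sym (Nx-succ (flat α ++ x ∷ []) y∉αx y∉t
          (subst (λ zs → Nx zs y c) (closed≡ ∙ sym (++-assoc (flat α) (x ∷ []) (y ∷ f ∷ t))) n))) Xf

    -- The cycle cut on both sides of a big gap: the gap from `l` to `r`, and the rest from the next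
    -- vertex `h` of X round to `x`.
    record Opened (x l : V) (m : List V) (r : V) (rest : List Blk) : Set where
      field
        gap  : Seg R l r (toL (bg l m r))
        xl   : R x l
        h    : V
        Xh   : X h
        rh   : R r h
        long : Seg R h x (flat rest ++ x ∷ [])
    open Opened

    opened : ∀ α {x l m r β} → bs ≡ α ++ (x , bg l m r) ∷ β → Opened x l m r (β ++ α)
    opened α {x} {l} {m} {r} {β} eq with flat-head (β ++ α) x []
    ... | h , t , eqh , h∈ with cut x (toL (bg l m r)) h t (subst (λ zs → Seg R x x ((x ∷ toL (bg l m r)) ++ zs)) eqh (subst (Seg R x x) shape rot))
      where
      rot : Cyc R (x ∷ (toL (bg l m r) ++ flat β) ++ flat α)
      rot = rotate (flat α) (subst (Cyc R) (block-at α eq ∙ ++-assoc (flat α) (x ∷ []) (toL (bg l m r) ++ flat β)) Rcyc)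
      shape : (x ∷ (toL (bg l m r) ++ flat β) ++ flat α) ++ x ∷ [] ≡ (x ∷ toL (bg l m r)) ++ flat (β ++ α) ++ x ∷ []
      shape = cong (λ zs → (x ∷ zs) ++ x ∷ []) (++-assoc (toL (bg l m r)) (flat β) (flat α) ∙ cong (toL (bg l m r) ++_) (sym (flat-++ β α))) ∙
                ++-assoc (x ∷ toL (bg l m r)) (flat (β ++ α)) (x ∷ [])
    ...   | b , s , rb , long with last-eq (x ∷ l ∷ m) s
    ...     | refl = record { gap = suffix (x ∷ []) s ; xl = edge [] s ; h = h ; Xh = Xh′ ; rh = rb ; long = subst (Seg R h x) (sym eqh) long }
      where
      Xh′ : X h
      Xh′ = Xhead (proj₁ (ok (subst ((x , bg l m r) ∈_) (sym eq) (∈-mid α)))) (λ {b} m → subst (b ∈_) (sym eq) (∈-swap α β m)) h∈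

    S-opened : ∀ α {x l m r β} → bs ≡ α ++ (x , bg l m r) ∷ β → ∀ f → S f C ≡ f x + (S f (toL (bg l m r)) + S f (flat (β ++ α)))
    S-opened α {x} {l} {m} {r} {β} eq f =
      cong (S f) (block-at α eq ∙ ++-assoc (flat α) (x ∷ []) (toL (bg l m r) ++ flat β)) ∙
        S-++ f (flat α) (x ∷ toL (bg l m r) ++ flat β) ∙
          cong (λ n → S f (flat α) + (f x + n)) (S-++ f (toL (bg l m r)) (flat β)) ∙
            lem (S f (flat α)) (f x) (S f (toL (bg l m r))) (S f (flat β)) ∙
              cong (λ n → f x + (S f (toL (bg l m r)) + n)) (sym (cong (S f) (flat-++ β α) ∙ S-++ f (flat β) (flat α)))
      where
      lem : ∀ a x q b → a + (x + (q + b)) ≡ x + (q + (b + a))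
      lem = solve-∀

    private
      regroup : ∀ (G : List V) xi pre w post H → G ++ xi ∷ (pre ++ w ∷ post) ++ H ≡ (G ++ xi ∷ pre) ++ w ∷ post ++ H
      regroup G xi pre w post H = cong (λ zs → G ++ xi ∷ zs) (++-assoc pre (w ∷ post) H) ∙ sym (++-assoc G (xi ∷ pre) (w ∷ post ++ H))

      sum₁ : ∀ (f : V → ℕ) Q G xi x pre w post H es → S f (reverse (Q ++ (G ++ xi ∷ [])) ++ es ++ w ∷ post ++ H ++ x ∷ []) + S f pre
        ≡ f x + (S f Q + (S f G + (f xi + (S f (pre ++ w ∷ post) + S f H)))) + S f es
      sum₁ f Q G xi x pre w post H es
        rewrite S-++ f (reverse (Q ++ (G ++ xi ∷ []))) (es ++ w ∷ post ++ H ++ x ∷ []) | S-rev f (Q ++ (G ++ xi ∷ [])) | S-++ f Q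
            (G ++ xi ∷ []) | S-++ f G (xi ∷ [])
              | S-++ f es (w ∷ post ++ H ++ x ∷ []) | S-++ f post (H ++ x ∷ []) | S-++ f H (x ∷ []) | S-++ f pre (w ∷ post) = lem (S f Q)
                  (S f G) (f xi) (f x) (S f pre) (f w) (S f post) (S f H) (S f es)
        where
        lem : ∀ Q G xi x pre w post H es → Q + (G + (xi + 0)) + (es + (w + (post + (H + (x + 0))))) + pre ≡ x +
            (Q + (G + (xi + (pre + (w + post) + H)))) + es
        lem = solve-∀

      sum₂ : ∀ (f : V → ℕ) Q G xi x pre w post H es → S f (((G ++ xi ∷ pre) ++ w ∷ []) ++ es ++ reverse ((H ++ x ∷ []) ++ Q)) + S f post
        ≡ f x + (S f Q + (S f G + (f xi + (S f (pre ++ w ∷ post) + S f H)))) + S f es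
      sum₂ f Q G xi x pre w post H es
        rewrite S-++ f ((G ++ xi ∷ pre) ++ w ∷ []) (es ++ reverse ((H ++ x ∷ []) ++ Q)) | S-++ f (G ++ xi ∷ pre) (w ∷ []) | S-++ f G (xi ∷ pre)
              | S-++ f es (reverse ((H ++ x ∷ []) ++ Q)) | S-rev f ((H ++ x ∷ []) ++ Q) | S-++ f (H ++ x ∷ []) Q | S-++ f H (x ∷ []) | S-++
                  f pre (w ∷ post) = lem (S f Q) (S f G) (f xi) (f x) (S f pre) (f w) (S f post) (S f H) (S f es)
        where
        lem : ∀ Q G xi x pre w post H es → G + (xi + pre) + (w + 0) + (es + (H + (x + 0) + Q)) + post ≡ x +
            (Q + (G + (xi + (pre + (w + post) + H)))) + es
        lem = solve-∀

      sum₃ : ∀ (f : V → ℕ) Q G xi x pre u mid w post H → S f (((G ++ xi ∷ pre) ++ u ∷ []) ++ reverse Q ++ w ∷ post ++ H ++ x ∷ []) + S f mid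
        ≡ f x + (S f Q + (S f G + (f xi + (S f (pre ++ u ∷ mid ++ w ∷ post) + S f H)))) + 0
      sum₃ f Q G xi x pre u mid w post H
        rewrite S-++ f ((G ++ xi ∷ pre) ++ u ∷ []) (reverse Q ++ w ∷ post ++ H ++ x ∷ []) | S-++ f (G ++ xi ∷ pre) (u ∷ []) | S-++ f G (xi ∷ pre)
              | S-++ f (reverse Q) (w ∷ post ++ H ++ x ∷ []) | S-rev f Q | S-++ f post (H ++ x ∷ []) | S-++ f H (x ∷ []) | S-++ f pre
                  (u ∷ mid ++ w ∷ post) | S-++ f mid (w ∷ post)
        = lem (S f Q) (S f G) (f xi) (f x) (S f pre) (f u) (S f mid) (f w) (S f post) (S f H)
        where
        lem : ∀ Q G xi x pre u mid w post H → G + (xi + pre) + (u + 0) + (Q + (w + (post + (H + (x + 0))))) + mid ≡ x +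
            (Q + (G + (xi + (pre + (u + (mid + (w + post))) + H)))) + 0
        lem = solve-∀

    no-es : Uniq ((C ++ U) ++ [])
    no-es = subst Uniq (sym (++-identityʳ (C ++ U))) unCU

    one-es : ∀ {z} → z ∉ C ++ U → Uniq ((C ++ U) ++ z ∷ [])
    one-es {z} z∉ = ≈-Uniq (swap-≈ (z ∷ []) (C ++ U)) (Uniq-∷ z∉ unCU)

    -- Without the gap the cycle is a walk between two vertices of X, which closes up through U.
    big≥p : ∀ {x l m r} → (x , bg l m r) ∈ bs → p ≤ # (toL (bg l m r))
    big≥p {x} {l} {m} {r} b∈ with ∈-∃++ b∈
    ... | α , β , eq = subst (_≤ # (toL (bg l m r))) (+-identityʳ p) (link (long O) (Xh O) (proj₁ (ok b∈)) [] (toL (bg l m r)) sm no-es (big-¬Y b∈))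
      where
      O : Opened x l m r (β ++ α)
      O = opened α eq
      sm : ∀ f → S f (flat (β ++ α) ++ x ∷ []) + S f (toL (bg l m r)) ≡ S f C + 0
      sm f = cong (_+ S f (toL (bg l m r))) (S-++ f (flat (β ++ α)) (x ∷ [])) ∙ lem (S f (flat (β ++ α))) (f x) (S f (toL (bg l m r))) ∙
          cong (_+ 0) (sym (S-opened α eq f))
        where
        lem : ∀ a x q → a + (x + 0) + q ≡ x + (q + a) + 0
        lem = solve-∀

    -- Two big gaps; `β ++ α` reads the cycle from behind the first one, so the second may lie on
    -- either side of it in the list.
    module Pair (α : List Blk) {x l r : V} {m : List V} {β : List Blk} (eq : bs ≡ α ++ (x , bg l m r) ∷ β)
                (γ₁ : List Blk) {xi li ri : V} {mi : List V} {γ₂ : List Blk} (eqr : β ++ α ≡ γ₁ ++ (xi , bg li mi ri) ∷ γ₂) where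
      private
        O : Opened x l m r (β ++ α)
        O = opened α eq
        Q Qi G H : List V
        Q  = toL (bg l m r)
        Qi = toL (bg li mi ri)
        G  = flat γ₁
        H  = flat γ₂
        b∈ : (x , bg l m r) ∈ bs
        b∈ = subst ((x , bg l m r) ∈_) (sym eq) (∈-mid α)
        up : ∀ {b} → b ∈ γ₁ ++ (xi , bg li mi ri) ∷ γ₂ → b ∈ bs
        up {b} c = subst (b ∈_) (sym eq) (∈-swap α β (subst (b ∈_) (sym eqr) c))
        bi∈ : (xi , bg li mi ri) ∈ bs
        bi∈ = up (∈-mid γ₁)
        Xx : X x
        Xx = proj₁ (ok b∈)
        Xxi : X xi
        Xxi = proj₁ (ok bi∈)
        l∈ : l ∈ Q
        l∈ = here refl
        r∈ : r ∈ Q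
        r∈ = there (∈-++⁺ʳ m (here refl))
        flatr : flat (β ++ α) ≡ G ++ xi ∷ Qi ++ H
        flatr = cong flat eqr ∙ flat-++ γ₁ ((xi , bg li mi ri) ∷ γ₂)
        long′ : Seg R (h O) x (G ++ xi ∷ Qi ++ H ++ x ∷ [])
        long′ = subst (Seg R (h O) x) (cong (_++ x ∷ []) flatr ∙ ++-assoc G (xi ∷ Qi ++ H) (x ∷ []) ∙ cong (λ zs → G ++ xi ∷ zs)
            (++-assoc Qi H (x ∷ []))) (long O)
        long-at : ∀ pre w post → Qi ≡ pre ++ w ∷ post → Seg R (h O) x ((G ++ xi ∷ pre) ++ w ∷ post ++ H ++ x ∷ [])
        long-at pre w post e = subst (Seg R (h O) x) (cong (λ zs → G ++ xi ∷ zs ++ H ++ x ∷ []) e ∙ regroup G xi pre w post (H ++ x ∷ [])) long′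
        back : Seg R xi l (reverse (Q ++ (G ++ xi ∷ [])))
        back = rev R-sym (join (gap O) (rh O) (prefix G long′))
        SC : ∀ f → S f C ≡ f x + (S f Q + (S f G + (f xi + (S f Qi + S f H))))
        SC f = S-opened α eq f ∙ cong (λ n → f x + (S f Q + n))
            (cong (S f) flatr ∙ S-++ f G (xi ∷ Qi ++ H) ∙ cong (λ n → S f G + (f xi + n)) (S-++ f Qi H))
        ¬Yl : ¬ Y l
        ¬Yl = big-¬Y b∈ l∈
        ¬Yr : ¬ Y r
        ¬Yr = big-¬Y b∈ r∈
        inQi : ∀ pre {w post} → Qi ≡ pre ++ w ∷ post → w ∈ Qi
        inQi pre {w} e = subst (w ∈_) (sym e) (∈-mid pre)
        fwd : ∃ λ h′ → X h′ × Seg R r h′ (reverse ((H ++ x ∷ []) ++ Q))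
        fwd with flat-head γ₂ x []
        ... | h′ , t′ , e , h′∈ = h′ , Xhead Xx (λ m → up (∈-++⁺ʳ γ₁ (there m))) h′∈ ,
              rev R-sym (join (subst (Seg R h′ x) (sym e) (suffix (G ++ xi ∷ Qi)
                  (subst (Seg R (h O) x) (cong (λ zs → G ++ xi ∷ Qi ++ zs) e ∙ sym (++-assoc G (xi ∷ Qi) (h′ ∷ t′))) long′))) (xl O) (gap O))

      -- Route: from `xi` back to `h`, over to `r`, back to `l`, across to `w`, on to `x`. Only
      -- `pre` is left out.
      left-far : ∀ pre w post → Qi ≡ pre ++ w ∷ post → E l w → p ≤ # pre
      left-far pre w post e lw = subst (_≤ # pre) (+-identityʳ p)
        (link (join back (mkR lw ¬Yl (big-¬Y bi∈ (inQi pre e))) (suffix (G ++ xi ∷ pre) (long-at pre w post e))) Xxi Xx [] pre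
          (λ f → sum₁ f Q G xi x pre w post H [] ∙ cong (_+ 0)
              (cong (λ zs → f x + (S f Q + (S f G + (f xi + (S f zs + S f H))))) (sym e) ∙ sym (SC f)))
          no-es (λ {y} y∈ → big-¬Y bi∈ (subst (y ∈_) (sym e) (∈-++⁺ˡ y∈))))

      -- Route: from `h` through `xi` to `w`, across to `r`, back to `l`, over to `x`, and back to
      -- `h′`, the first vertex of X behind the second gap. Only `post` is left out.
      right-far : ∀ pre w post → Qi ≡ pre ++ w ∷ post → E r w → p ≤ # post
      right-far pre w post e rw with fwd
      ... | h′ , Xh′ , s = subst (_≤ # post) (+-identityʳ p)
        (link (join (prefix (G ++ xi ∷ pre) (long-at pre w post e)) (mkR (E-sym rw) (big-¬Y bi∈ (inQi pre e)) ¬Yr) s) (Xh O) Xh′ [] post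
          (λ f → sum₂ f Q G xi x pre w post H [] ∙ cong (_+ 0)
              (cong (λ zs → f x + (S f Q + (S f G + (f xi + (S f zs + S f H))))) (sym e) ∙ sym (SC f)))
          no-es (λ {y} y∈ → big-¬Y bi∈ (subst (y ∈_) (sym e) (∈-++⁺ʳ pre (there y∈)))))

      -- Route: from `h` to `u`, across to `r`, back to `l`, across to `w`, on to `x`. Only `mid` is
      -- left out.
      right-left-far : ∀ pre u mid w post → Qi ≡ pre ++ u ∷ mid ++ w ∷ post → E r u → E l w → p ≤ # mid
      right-left-far pre u mid w post e ru lw = subst (_≤ # mid) (+-identityʳ p)
        (link (join (prefix (G ++ xi ∷ pre) (long-at pre u (mid ++ w ∷ post) e)) (mkR (E-sym ru) (big-¬Y bi∈ (inQi pre e)) ¬Yr)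
                (join (rev R-sym (gap O)) (mkR lw ¬Yl (big-¬Y bi∈ (inQi (pre ++ u ∷ mid) e′)))
                    (suffix (G ++ xi ∷ pre ++ u ∷ mid) (long-at (pre ++ u ∷ mid) w post e′)))) (Xh O) Xx [] mid
          (λ f → sum₃ f Q G xi x pre u mid w post H ∙ cong (_+ 0)
              (cong (λ zs → f x + (S f Q + (S f G + (f xi + (S f zs + S f H))))) (sym e) ∙ sym (SC f)))
          no-es (λ {y} y∈ → big-¬Y bi∈ (subst (y ∈_) (sym e) (∈-++⁺ʳ pre (there (∈-++⁺ˡ y∈))))))
        where
        e′ : Qi ≡ (pre ++ u ∷ mid) ++ w ∷ post
        e′ = e ∙ sym (++-assoc pre (u ∷ mid) (w ∷ post))

      -- The route of `left-far` with the step from `l` to the second gap made through `z`: nothing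
      -- is lost and a vertex is gained. `rights-apart` varies `right-far` in the same way.
      lefts-apart : ∀ {z} → z ∉ C ++ U → E z l → E z li → ⊥
      lefts-apart {z} z∉ zl zli with link (join back (mkR (E-sym zl) ¬Yl ¬Yz)
          (join [ z ] (mkR zli ¬Yz (big-¬Y bi∈ (here refl))) (suffix (G ++ xi ∷ []) (long-at [] li (mi ++ ri ∷ []) refl)))) Xxi Xx (z ∷ []) []
          (λ f → sum₁ f Q G xi x [] li (mi ++ ri ∷ []) H (z ∷ []) ∙ cong (_+ (f z + 0)) (sym (SC f))) (one-es z∉) (λ ())
        where
        ¬Yz : ¬ Y z
        ¬Yz y = z∉ (∈-++⁺ˡ (Y⊆C y))
      ... | bad with subst (_≤ 0) (+-comm p 1) bad
      ...   | ()

      rights-apart : ∀ {z} → z ∉ C ++ U → E z r → E z ri → ⊥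
      rights-apart {z} z∉ zr zri with fwd
      ... | h′ , Xh′ , s with link (join (prefix (G ++ xi ∷ li ∷ mi) (long-at (li ∷ mi) ri [] refl))
          (mkR (E-sym zri) (big-¬Y bi∈ (inQi (li ∷ mi) refl)) ¬Yz) (mkR zr ¬Yz ¬Yr ∷ s)) (Xh O) Xh′ (z ∷ []) []
          (λ f → sum₂ f Q G xi x (li ∷ mi) ri [] H (z ∷ []) ∙ cong (_+ (f z + 0)) (sym (SC f))) (one-es z∉) (λ ())
        where
        ¬Yz : ¬ Y z
        ¬Yz y = z∉ (∈-++⁺ˡ (Y⊆C y))
      ...   | bad with subst (_≤ 0) (+-comm p 1) bad
      ...     | ()

      pair-bound : dg l Qi + dg r Qi + p ≤ # Qi
      pair-bound = scan (a l) (a r) p 1≤p p Qi ≤-refl (big≥p bi∈) left-far right-far right-left-far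

at-most-one : ∀ {A : Set} (f : A → ℕ) bs → (∀ b → f b ≤ 1) → (∀ α b β c γ → bs ≡ α ++ b ∷ β ++ c ∷ γ → 1 ≤ f b → 1 ≤ f c → ⊥) → S f bs ≤ 1
at-most-one f [] f≤1 ex = z≤n
at-most-one f (b ∷ bs) f≤1 ex with f b in eq
... | zero = at-most-one f bs f≤1 (λ α b′ β c γ e → ex (b ∷ α) b′ β c γ (cong (b ∷_) e))
... | suc n with S f bs in eq′
...   | zero = subst (_≤ 1) (eq ∙ sym (+-identityʳ (suc n))) (f≤1 b)
...   | suc m with S-pos f bs (subst (1 ≤_) (sym eq′) (s≤s z≤n))
...     | c , c∈ , fc with ∈-∃++ c∈
...       | β , γ , e = ⊥-elim (ex [] b β c γ (cong (b ∷_) e) (subst (1 ≤_) (sym eq) (s≤s z≤n)) fc)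

ends≤ : ∀ {V : Set} (f : V → ℕ) g → S f (ends g) ≤ S f (toL g)
ends≤ f (sg y)     = ≤-refl
ends≤ f (bg l m r) = +-monoʳ-≤ (f l) (≤-trans (m≤n+m (f r + 0) (S f m)) (≤-reflexive (sym (S-++ f m (r ∷ [])))))

isBig : ∀ {V : Set} → Gap V → ℕ
isBig (sg _)     = 0
isBig (bg _ _ _) = 1

#ends : ∀ {V : Set} (g : Gap V) → # (ends g) ≡ 1 + isBig g
#ends (sg _)     = refl
#ends (bg _ _ _) = refl

-- Counting edges between X and the ends of the gaps

module Inequality (Γ : Ctx) {P U : List (Fin (Ctx.N Γ))} {p : ℕ} (Fr : Counting.Frame Γ P U p) where
  open Extremal Γ
  open Counting Γ
  open Count Fr public

  X⁻ GL EL R′ : List V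
  X⁻ = heads bs′
  GL = gaps bs
  EL = concatMap (λ b → ends (proj₂ b)) bs
  R′ = others (C ++ U)

  size Fb : Blk → ℕ
  size b = # (toL (proj₂ b))
  Fb b = S (λ w → dg w GL) (ends (proj₂ b))

  t ρ excess : ℕ
  t = S (λ b → isBig (proj₂ b)) bs
  ρ = S (λ w → dg w R′) EL
  excess = S (λ b → size b ∸ p) bs

  SC : ∀ f → S f C ≡ f w₀ + S f X⁻ + S f GL
  SC f = cong (S f) (sym flat≡) ∙ S-flat f bs

  deg-split : ∀ w → w ≢ w₀ → k ≡ dg w X⁻ + dg w GL + dg w U + dg w R′
  deg-split w w≢ = suc-injective (sym (deg w w≢) ∙ sym (S-others f unCU) ∙ cong (_+ dg w R′)
      (S-++ f C U ∙ cong (_+ dg w U) (SC f ∙ cong (λ n → n + dg w X⁻ + dg w GL) (T⇒b2n (E-sym (univ w w≢))))) ∙ refl)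
    where
    f : V → ℕ
    f u = b2n (a w u)

  ends⊆ : ∀ g {w : V} → w ∈ ends g → w ∈ toL g
  ends⊆ (sg y)     m                   = m
  ends⊆ (bg l m r) (here refl)         = here refl
  ends⊆ (bg l m r) (there (here refl)) = there (∈-++⁺ʳ m (here refl))

  end-On : ∀ {x g} → (x , g) ∈ bs → ∀ {w} → w ∈ ends g → ∃ λ x′ → X x′ × On x′ w
  end-On {x} {g} b∈ {w} w∈ with ∈-∃++ b∈
  ... | α , β , eq = side g w∈ (block-at α eq)
    where
    first : ∀ l zs → C ≡ (flat α ++ x ∷ []) ++ l ∷ zs → On x l
    first l zs e = inj₁ (Nx-++ˡ (w₀ ∷ []) (subst (λ zs → Nx zs x l) (sym (e ∙ ++-assoc (flat α) (x ∷ []) (l ∷ zs))) (Nx-here (flat α))))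
    side : ∀ g {w} → w ∈ ends g → C ≡ (flat α ++ x ∷ []) ++ toL g ++ flat β → ∃ λ x′ → X x′ × On x′ w
    side (sg y)     (here refl) e = x , proj₁ (ok b∈) , first y _ e
    side (bg l m r) (here refl) e = x , proj₁ (ok b∈) , first l _ e
    side (bg l m r) (there (here refl)) e with flat-head β w₀ []
    ... | h , t , eh , h∈ = h , Xhead Xw₀ (λ {b} m → subst (b ∈_) (sym eq) (∈-++⁺ʳ α (there m))) h∈ ,
        inj₂ (subst (λ zs → Nx zs r h) (sym shape) (Nx-here ((flat α ++ x ∷ []) ++ l ∷ m)))
      where
      shape : C ++ w₀ ∷ [] ≡ ((flat α ++ x ∷ []) ++ l ∷ m) ++ r ∷ h ∷ t
      shape = cong (_++ w₀ ∷ []) e ∙ ++-assoc (flat α ++ x ∷ []) (toL (bg l m r) ++ flat β) (w₀ ∷ []) ∙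
                cong (λ zs → (flat α ++ x ∷ []) ++ zs) (++-assoc (toL (bg l m r)) (flat β) (w₀ ∷ []) ∙ cong (toL (bg l m r) ++_) eh ∙
                    ++-assoc (l ∷ m) (r ∷ []) (h ∷ t)) ∙
                  sym (++-assoc (flat α ++ x ∷ []) (l ∷ m) (r ∷ h ∷ t))

  end≢w₀ : ∀ {x g} → (x , g) ∈ bs → ∀ {w} → w ∈ toL g → w ≢ w₀
  end≢w₀ b∈ w∈ refl = proj₂ (ok b∈) w∈ Xw₀

  -- An end is next to a vertex of X on the cycle, so `noU` excludes neighbours in U.
  deg-end : ∀ {x g} → (x , g) ∈ bs → ∀ {w} → w ∈ ends g → k ≡ dg w X⁻ + dg w GL + dg w R′
  deg-end {x} {g} b∈ {w} w∈ = deg-split w (end≢w₀ b∈ (ends⊆ g w∈)) ∙ cong (_+ dg w R′) (cong (dg w X⁻ + dg w GL +_) (dg-none U none) ∙ +-identityʳ _)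
    where
    none : ∀ {u} → u ∈ U → ¬ E w u
    none u∈ wu with end-On b∈ w∈
    ... | x′ , Xx′ , on = noU u∈ Xx′ on (E-sym wu)

  ∈-EL : ∀ {w} (cs : List Blk) → w ∈ concatMap (λ b → ends (proj₂ b)) cs → ∃ λ b → b ∈ cs × w ∈ ends (proj₂ b)
  ∈-EL (b ∷ cs) w∈ with ∈-++⁻ (ends (proj₂ b)) w∈
  ... | inj₁ m = b , here refl , m
  ... | inj₂ m with ∈-EL cs m
  ...   | c , c∈ , m′ = c , there c∈ , m′

  uniq-w₀EU : Uniq (w₀ ∷ EL ++ U)
  uniq-w₀EU = uniq λ v → ≤-trans (bound v) (once unCU v)
    where
    bound : ∀ v → cnt v (w₀ ∷ EL ++ U) ≤ cnt v (C ++ U)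
    bound v = ≤-trans (≤-reflexive (cong (δ v w₀ +_) (S-++ (δ v) EL U)))
      (≤-trans (linear (δ v w₀ + (cnt v EL + cnt v U)) (δ v w₀ + cnt v X⁻ + cnt v GL + cnt v U) (cnt v X⁻) EL≤GL
          (lem (δ v w₀) (cnt v EL) (cnt v U) (cnt v X⁻) (cnt v GL)))
        (≤-reflexive (sym (S-++ (δ v) C U ∙ cong (_+ cnt v U) (SC (δ v))))))
      where
      lem : ∀ w e u x g → w + (e + u) + g + x ≡ w + x + g + u + e
      lem = solve-∀
      EL≤GL : cnt v EL ≤ cnt v GL
      EL≤GL = ≤-trans (≤-reflexive (S-concatMap (δ v) (λ b → ends (proj₂ b)) bs))
        (≤-trans (S-mono bs (λ b _ → ends≤ (δ v) (proj₂ b))) (≤-reflexive (sym (S-concatMap (δ v) (λ b → toL (proj₂ b)) bs))))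

  X⁻≢w₀ : ∀ {x} → x ∈ X⁻ → x ≢ w₀
  X⁻≢w₀ {x} x∈ refl = n≮n 1 (≤-trans (s≤s (∈⇒cnt x∈))
      (≤-trans (m≤m+n _ (cnt w₀ GL)) (≤-trans (≤-reflexive (cong (λ n → n + cnt w₀ X⁻ + cnt w₀ GL) (sym (δ-refl w₀)) ∙ sym (SC (δ w₀))))
      (once unC w₀))))

  X⁻-deg : ∀ {x} → x ∈ X⁻ → dg x (EL ++ U) ≤ k
  X⁻-deg {x} x∈ = ≤-pred (≤-trans (≤-reflexive (cong (_+ dg x (EL ++ U)) (sym (T⇒b2n (E-sym (univ x (X⁻≢w₀ x∈)))))))
    (≤-trans (S-Uniq-≤ (λ u → b2n (a x u)) uniq-w₀EU) (≤-reflexive (deg x (X⁻≢w₀ x∈)))))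

  -- Double counting of the edges between X without `w₀` and the ends together with U: from the side
  -- of X there are at most k per vertex, and at each end they make up k less the edges into gaps
  -- and to the outside.
  count : k * # EL + S (λ u → dg u X⁻) U ≤ k * # X⁻ + S Fb bs + ρ
  count = linear (k * # EL + S (λ u → dg u X⁻) U) (k * # X⁻ + S Fb bs + ρ) 0 upper
      (cong (λ n → n + S (λ u → dg u X⁻) U + k * # X⁻ + 0) total ∙ lem (S (λ w → dg w X⁻) EL) (S Fb bs) ρ (S (λ u → dg u X⁻) U) (k * # X⁻))
    where
    lem : ∀ x f r u n → x + f + r + u + n + 0 ≡ n + f + r + (x + u)
    lem = solve-∀
    total : k * # EL ≡ S (λ w → dg w X⁻) EL + S Fb bs + ρ
    total = sym (S-const k EL) ∙ S-cong EL (λ w w∈ → each w w∈) ∙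
      S-+ (λ w → dg w X⁻ + dg w GL) (λ w → dg w R′) EL ∙ cong (_+ ρ)
          (S-+ (λ w → dg w X⁻) (λ w → dg w GL) EL ∙ cong (S (λ w → dg w X⁻) EL +_) (S-concatMap (λ w → dg w GL) (λ b → ends (proj₂ b)) bs))
      where
      each : ∀ w → w ∈ EL → k ≡ dg w X⁻ + dg w GL + dg w R′
      each w w∈ with ∈-EL bs w∈
      ... | b , b∈ , m = deg-end b∈ m
    upper : S (λ w → dg w X⁻) EL + S (λ u → dg u X⁻) U ≤ k * # X⁻
    upper = ≤-trans (≤-reflexive (sym (S-++ (λ w → dg w X⁻) EL U) ∙ dg-swap (EL ++ U) X⁻))
      (≤-trans (S-mono X⁻ (λ x x∈ → X⁻-deg x∈)) (≤-reflexive (S-const k X⁻)))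

  #EL : # EL ≡ # bs + t
  #EL = S-concatMap (λ _ → 1) (λ b → ends (proj₂ b)) bs ∙ S-cong bs (λ b _ → #ends (proj₂ b)) ∙ S-+ (λ _ → 1) (λ b → isBig (proj₂ b)) bs

  #bs : # bs ≡ suc (# X⁻)
  #bs = cong suc (sym (S-map (λ _ → 1) proj₁ bs′))

  #C : # C ≡ suc (# X⁻) + S size bs
  #C = SC (λ _ → 1) ∙ cong (suc (# X⁻) +_) (S-concatMap (λ _ → 1) (λ b → toL (proj₂ b)) bs)

  #total : # C + p + # R′ ≡ N
  #total = cong (λ n → # C + n + # R′) (sym #U) ∙ cong (_+ # R′) (sym (S-++ (λ _ → 1) C U)) ∙ S-others (λ _ → 1) unCU ∙ #-allFin N

  size≥p : ∀ {b} → b ∈ bs → p ≤ size b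
  size≥p {x , sg y}     b∈ = proj₁ (single-nbr b∈)
  size≥p {x , bg l m r} b∈ = big≥p b∈

  single-dg : ∀ {x y} → (x , sg y) ∈ bs → ∀ zs → (∀ {u} → u ∈ zs → ¬ X u) → dg y zs ≡ 0
  single-dg b∈ zs h = dg-none zs (λ u∈ yu → h u∈ (proj₂ (single-nbr b∈) _ yu))

  GL-¬X : ∀ {u} → u ∈ GL → ¬ X u
  GL-¬X = go bs (λ b∈ → b∈)
    where
    go : ∀ cs → (∀ {b} → b ∈ cs → b ∈ bs) → ∀ {u} → u ∈ gaps cs → ¬ X u
    go (b ∷ cs) sub u∈ with ∈-++⁻ (toL (proj₂ b)) u∈
    ... | inj₁ m = proj₂ (ok (sub (here refl))) m
    ... | inj₂ m = go cs (sub ∘ there) m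

  single-F : ∀ {x y} → (x , sg y) ∈ bs → Fb (x , sg y) ≡ 0
  single-F b∈ = +-identityʳ _ ∙ single-dg b∈ GL GL-¬X

  dg-GL : ∀ w → dg w GL ≡ S (λ b → dg w (toL (proj₂ b))) bs
  dg-GL w = S-concatMap (λ u → b2n (a w u)) (λ b → toL (proj₂ b)) bs

  S-split : ∀ (f : Blk → ℕ) α {b β} → bs ≡ α ++ b ∷ β → S f bs ≡ f b + S f (β ++ α)
  S-split f α {b} {β} eq = cong (S f) eq ∙ S-++ f α (b ∷ β) ∙ lem (S f α) (f b) (S f β) ∙ cong (f b +_) (sym (S-++ f β α))
    where
    lem : ∀ x y z → x + (y + z) ≡ y + (z + x)
    lem = solve-∀

  pair : ∀ α {x l m r β} → bs ≡ α ++ (x , bg l m r) ∷ β → ∀ {b} → b ∈ β ++ α → dg l (toL (proj₂ b)) + dg r (toL (proj₂ b)) + p ≤ size b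
  pair α {x} {l} {m} {r} {β} eq {xi , bg li mi ri} b∈ with ∈-∃++ b∈
  ... | γ₁ , γ₂ , eqr = Pair.pair-bound α eq γ₁ eqr
  pair α {x} {l} {m} {r} {β} eq {xi , sg y} b∈ =
    ≤-trans (≤-reflexive (cong (_+ p) (cong₂ _+_ (none (here refl)) (none (there (∈-++⁺ʳ m (here refl))))))) (size≥p y∈)
    where
    y∈ : (xi , sg y) ∈ bs
    y∈ = subst ((xi , sg y) ∈_) (sym eq) (∈-swap α β b∈)
    none : ∀ {w} → w ∈ toL (bg l m r) → dg w (y ∷ []) ≡ 0
    none w∈ = dg-none (y ∷ []) λ { (here refl) wy → proj₂ (ok (subst ((x , bg l m r) ∈_) (sym eq) (∈-mid α))) w∈
        (proj₂ (single-nbr y∈) _ (E-sym wy)) }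

  -- Each end has at most size - 1 neighbours in its own gap; in every other gap the two ends
  -- together have at most its size less p, by `pair`.
  F-bound : ∀ {x l m r} → (x , bg l m r) ∈ bs → Fb (x , bg l m r) + 2 ≤ excess + size (x , bg l m r) + p
  F-bound {x} {l} {m} {r} b∈ with ∈-∃++ b∈
  ... | α , β , eq = linear (Fb b + 2) (excess + size b + p) 0
        (+-mono-≤ (+-mono-≤ (own (toL (bg l m r)) (here refl)) (own (toL (bg l m r)) (there (∈-++⁺ʳ m (here refl))))) sumpair)
        (cong (λ u → u + 2 + (size b + size b + S (λ c → size c ∸ p) (β ++ α)) + 0) Fb≡ ∙
          lem (dg l Q) (dg r Q) D (size b) (S (λ c → size c ∸ p) (β ++ α)) (size b ∸ p) p (sym (m∸n+n≡m (size≥p b∈))) ∙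
            cong (λ n → n + size b + p + (suc (dg l Q) + suc (dg r Q) + D)) (sym (S-split (λ c → size c ∸ p) α eq)))
    where
    b : Blk
    b = x , bg l m r
    Q : List V
    Q = toL (bg l m r)
    D : ℕ
    D = S (λ c → dg l (toL (proj₂ c)) + dg r (toL (proj₂ c))) (β ++ α)
    Fb≡ : Fb b ≡ dg l Q + dg r Q + D
    Fb≡ = cong₂ (λ u v → u + (v + 0)) (dg-GL l ∙ S-split (λ c → dg l (toL (proj₂ c))) α eq) (dg-GL r ∙ S-split (λ c → dg r (toL (proj₂ c))) α eq) ∙
      lem′ (dg l Q) (S (λ c → dg l (toL (proj₂ c))) (β ++ α)) (dg r Q) (S (λ c → dg r (toL (proj₂ c))) (β ++ α)) ∙
        cong (dg l Q + dg r Q +_) (sym (S-+ (λ c → dg l (toL (proj₂ c))) (λ c → dg r (toL (proj₂ c))) (β ++ α)))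
      where
      lem′ : ∀ a b c d → a + b + (c + d + 0) ≡ a + c + (b + d)
      lem′ = solve-∀
    sumpair : D ≤ S (λ c → size c ∸ p) (β ++ α)
    sumpair = S-mono (β ++ α) (λ c c∈ → ≤-trans (≤-reflexive (sym (m+n∸n≡m (dg l (toL (proj₂ c)) + dg r (toL (proj₂ c))) p)))
        (∸-monoˡ-≤ p (pair α eq c∈)))
    lem : ∀ u v d s n e p → s ≡ e + p → u + v + d + 2 + (s + s + n) + 0 ≡ e + n + s + p + (suc u + suc v + d)
    lem u v d s n e p refl = lem₂ u v d n e p
      where
      lem₂ : ∀ u v d n e p → u + v + d + 2 + (e + p + (e + p) + n) + 0 ≡ e + n + (e + p) + p + (suc u + suc v + d)
      lem₂ = solve-∀

  -- A vertex outside is adjacent to at most one left end, at most one right end, and no vertex of a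
  -- one-vertex gap.
  ρ≤ : ρ ≤ 2 * # R′
  ρ≤ = ≤-trans (≤-reflexive (dg-swap EL R′)) (≤-trans (S-mono R′ each) (≤-reflexive (S-const 2 R′)))
    where
    Lz Rz : V → Blk → ℕ
    Lz z (x , sg y)     = 0
    Lz z (x , bg l m r) = b2n (a z l)
    Rz z (x , sg y)     = 0
    Rz z (x , bg l m r) = b2n (a z r)
    Lz≤1 : ∀ z b → Lz z b ≤ 1
    Lz≤1 z (x , sg y)     = z≤n
    Lz≤1 z (x , bg l m r) = b2n≤1 (a z l)
    Rz≤1 : ∀ z b → Rz z b ≤ 1
    Rz≤1 z (x , sg y)     = z≤n
    Rz≤1 z (x , bg l m r) = b2n≤1 (a z r)
    each : ∀ z → z ∈ R′ → dg z EL ≤ 2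
    each z z∈ = ≤-trans (≤-reflexive (S-concatMap (λ u → b2n (a z u)) (λ b → ends (proj₂ b)) bs ∙ S-cong bs (λ b b∈ → two b b∈) ∙ S-+ (Lz z)
        (Rz z) bs))
        (+-mono-≤ (at-most-one (Lz z) bs (Lz≤1 z) exL) (at-most-one (Rz z) bs (Rz≤1 z) exR))
      where
      z∉ : z ∉ C ++ U
      z∉ = ∈-others⁻ z∈
      two : ∀ b → b ∈ bs → dg z (ends (proj₂ b)) ≡ Lz z b + Rz z b
      two (x , sg y) b∈ = dg-none (y ∷ []) λ { (here refl) zy → z∉ (∈-++⁺ˡ (X⊆C (proj₂ (single-nbr b∈) z (E-sym zy)))) }
      two (x , bg l m r) b∈ = cong (b2n (a z l) +_) (+-identityʳ _)
      exL : ∀ α b β c γ → bs ≡ α ++ b ∷ β ++ c ∷ γ → 1 ≤ Lz z b → 1 ≤ Lz z c → ⊥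
      exL α (x , bg l m r) β (x′ , bg l′ m′ r′) γ eq h₁ h₂ = Pair.lefts-apart α eq β (++-assoc β ((x′ , bg l′ m′ r′) ∷ γ) α) z∉ (b2n⇒T h₁) (b2n⇒T h₂)
      exR : ∀ α b β c γ → bs ≡ α ++ b ∷ β ++ c ∷ γ → 1 ≤ Rz z b → 1 ≤ Rz z c → ⊥
      exR α (x , bg l m r) β (x′ , bg l′ m′ r′) γ eq h₁ h₂ = Pair.rights-apart α eq β (++-assoc β ((x′ , bg l′ m′ r′) ∷ γ) α) z∉ (b2n⇒T h₁) (b2n⇒T h₂)

  -- When all gaps have one vertex, the neighbours of all ends lie in X and so on the cycle.
  ρ≡0 : t ≡ 0 → ρ ≡ 0
  ρ≡0 t≡0 = S-0 EL (λ w w∈ → each w w∈)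
    where
    R′-¬X : ∀ {u} → u ∈ R′ → ¬ X u
    R′-¬X u∈ Xu = ∈-others⁻ u∈ (∈-++⁺ˡ (X⊆C Xu))
    each : ∀ w → w ∈ EL → dg w R′ ≡ 0
    each w w∈ with ∈-EL bs w∈
    ... | (x , sg y) , b∈ , here refl = single-dg b∈ R′ R′-¬X
    ... | (x , bg l m r) , b∈ , _ = ⊥-elim (n≮n 0 (≤-trans (S-∈ (λ b → isBig (proj₂ b)) b∈) (≤-reflexive t≡0)))

-- Exchanges on an extremal cycle

module OnCycle (Γ : Ctx) (P : List (Fin (Ctx.N Γ))) (ext : Extremal.Ext Γ (Ctx.w₀ Γ ∷ P)) where
  open Extremal Γ

  C : List V
  C = w₀ ∷ P

  On EO : V → V → Set
  On u v = Nx (C ++ w₀ ∷ []) u v ⊎ Nx (C ++ w₀ ∷ []) v u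
  EO u v = E u v × On u v

  On-sym : ∀ {u v} → On u v → On v u
  On-sym (inj₁ n) = inj₂ n
  On-sym (inj₂ n) = inj₁ n

  EO-sym : ∀ {u v} → EO u v → EO v u
  EO-sym (e , o) = E-sym e , On-sym o

  onCyc : Cyc EO C
  onCyc = mapSeg (λ (e , n) → e , inj₁ n) (Seg-Nx (cyc ext))

  on-cut : ∀ {u v} → On u v → ∃ λ Q → Seg EO v u Q × Q ≈ C
  on-cut (inj₁ n) = cut-cycle onCyc n
  on-cut (inj₂ n) with cut-cycle onCyc n
  ... | Q , s , e = reverse Q , rev EO-sym s , ≈-trans (rev-≈ Q) e

  around : ∀ {y} → y ∈ C → ∃ λ cs → ∃₂ λ c d → Seg EO c d cs × EO y c × EO d y × (y ∷ cs) ≈ C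
  around {y} y∈ with ∈-∃++ y∈
  ... | α , β , eq = open-at (β ++ α) (rotate α (subst (Cyc EO) eq onCyc)) (≈-trans (swap-≈ (y ∷ β) α) (≡⇒≈ (sym eq)))
    where
    open-at : ∀ cs → Cyc EO (y ∷ cs) → (y ∷ cs) ≈ C → ∃ λ cs → ∃₂ λ c d → Seg EO c d cs × EO y c × EO d y × (y ∷ cs) ≈ C
    open-at [] (r ∷ s) e with head-eq s
    ... | refl = ⊥-elim (E-irr (proj₁ r))
    open-at (c ∷ cs) s e with cut y (c ∷ cs) y [] s
    ... | d , r ∷ s′ , q , _ with head-eq s′
    ...   | refl = c ∷ cs , c , d , s′ , r , q , e

  -- Maximality as an exchange rule: the identity of sums makes the new cycle free of repetitions
  -- and fixes its length.
  no-longer : ∀ {Q} es lost → Cyc E Q → (∀ f → S f Q + S f lost ≡ S f C + S f es) → Uniq (C ++ es) → # es ≤ # lost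
  no-longer {Q} es lost c sm u = linear (# es) (# lost) 0 (maxlen ext Q c uQ) (lem (# es) (# C) ∙ sym (sm (λ _ → 1)) ∙ +-comm (# Q) (# lost))
    where
    lem : ∀ e c → e + c + 0 ≡ c + e
    lem = solve-∀
    uQ : Uniq Q
    uQ = uniq λ v → ≤-trans (m≤m+n (cnt v Q) (cnt v lost)) (≤-trans (≤-reflexive (sm (δ v) ∙ sym (S-++ (δ v) C es))) (once u v))

  P≢w₀ : ∀ {t} → t ∈ P → t ≢ w₀
  P≢w₀ t∈ refl = Uniq-head (un ext) t∈

  segC : ∃ λ b → Seg E w₀ b C × E b w₀
  segC = unclose (cyc ext)

  attached : ∃₂ λ t z → t ∈ P × z ∉ C × E t z
  attached with S-pos (λ _ → 1) (others C) outside
    where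
    outside : 1 ≤ # (others C)
    outside = linear 1 (# (others C)) 0 (nonspanning C (cyc ext) (un ext))
      (cong (λ n → 1 + n + 0) (sym (S-others (λ _ → 1) (un ext) ∙ #-allFin N)) ∙ lem (# C) (# (others C)))
      where
      lem : ∀ c o → 1 + (c + o) + 0 ≡ o + suc c
      lem = solve-∀
  ... | z , z∈ , _ with start P refl (cyc ext)
    where
    start : ∀ P′ → P ≡ P′ → Cyc E (w₀ ∷ P′) → ∃ λ t → t ∈ P
    start []       _ (r ∷ s) with head-eq s
    ... | refl = ⊥-elim (E-irr r)
    start (t ∷ _) refl _     = t , here refl
  ...   | t , t∈ with attach C t z (there t∈) (P≢w₀ t∈) (∈-others⁻ z∈) (λ { refl → ∈-others⁻ z∈ (here refl) })
  ...     | t′ , z′ , here refl , t≢ , _ = ⊥-elim (t≢ refl)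
  ...     | t′ , z′ , there t′∈ , t≢ , z∉ , e = t′ , z′ , t′∈ , z∉ , e

  -- The three neighbours are `w₀` and the two cycle neighbours of `t`, which differ from `w₀`
  -- because both sides are non-empty.
  three : ∀ {α t β} → P ≡ α ++ t ∷ β → 1 ≤ # α → 1 ≤ # β → 3 ≤ dg t C
  three {a₀ ∷ α} {t} {b₀ ∷ β} e _ _ with segC
  ... | b , s , _ with cut a₀ α t (b₀ ∷ β) (suffix (w₀ ∷ []) (subst (λ zs → Seg E w₀ b (w₀ ∷ zs)) e s))
  ...   | c , sα , ct , sβ = +-mono-≤ (≤-reflexive (sym (T⇒b2n (E-sym (univ t (P≢w₀ (subst (t ∈_) (sym e) (∈-++⁺ʳ (a₀ ∷ α) (here refl)))))))))
            (≤-trans (+-mono-≤ (dg-∈ (E-sym ct) (proj₂ (Seg-ends sα)))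
                (≤-trans (dg-∈ {xs = b₀ ∷ β} (edge [] sβ) (here refl)) (m≤n+m (dg t (b₀ ∷ β)) (b2n (a t t)))))
              (≤-reflexive (sym (cong (dg t) e ∙ S-++ (λ v → b2n (a t v)) (a₀ ∷ α) (t ∷ b₀ ∷ β)))))

-- Paths outside the cycle

module CaseB (Γ : Ctx) (P : List (Fin (Ctx.N Γ))) (ext : Extremal.Ext Γ (Ctx.w₀ Γ ∷ P)) where
  open Extremal Γ
  open OnCycle Γ P ext

  -- The first vertex must be attached to `P`: the path can then replace a stretch of the cycle,
  -- with `w₀` available at its other end.
  record Out (u₁ uₚ : V) (U : List V) : Set where
    field
      seg : Seg E u₁ uₚ U
      unU : Uniq U
      off : ∀ {u} → u ∈ U → u ∉ C
      at  : ∃ λ t → t ∈ P × E t u₁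
  open Out

  Max : ℕ → Set
  Max p = ∀ {v₁ vₚ W} → Out v₁ vₚ W → # W ≤ p

  unCU : ∀ {u₁ uₚ U} → Out u₁ uₚ U → Uniq (C ++ U)
  unCU o = Uniq-join C (un ext) (unU o) (λ v∈ v∈′ → off o v∈′ v∈)

  off≢w₀ : ∀ {u₁ uₚ U} → Out u₁ uₚ U → ∀ {u} → u ∈ U → u ≢ w₀
  off≢w₀ o u∈ refl = off o u∈ (here refl)

  insert : ∀ {u₁ uₚ U s t Q} → Uniq (C ++ U) → Seg E u₁ uₚ U → Seg E s t Q → E t u₁ → E uₚ s →
    ∀ es lost → (∀ f → S f Q + S f lost ≡ S f C + S f es) → Uniq ((C ++ U) ++ es) → # U + # es ≤ # lost
  insert {U = U} {Q = Q} uCU sU sQ tu us es lost sm u = subst (_≤ # lost) (S-++ (λ _ → 1) U es)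
    (no-longer (U ++ es) lost (close (join sQ tu sU) us) sm′ (subst Uniq (++-assoc C U es) u))
    where
    lem : ∀ q u l c e → q + l ≡ c + e → q + u + l ≡ c + (u + e)
    lem q u l c e h = l₁ q u l ∙ cong (u +_) h ∙ l₂ u c e
      where
      l₁ : ∀ q u l → q + u + l ≡ u + (q + l)
      l₁ = solve-∀
      l₂ : ∀ u c e → u + (c + e) ≡ c + (u + e)
      l₂ = solve-∀
    sm′ : ∀ f → S f (Q ++ U) + S f lost ≡ S f C + S f (U ++ es)
    sm′ f = cong (_+ S f lost) (S-++ f Q U) ∙ lem (S f Q) (S f U) (S f lost) (S f C) (S f es) (sm f) ∙ cong (S f C +_) (sym (S-++ f U es))

  []-es : ∀ {U} → Uniq (C ++ U) → Uniq ((C ++ U) ++ [])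
  []-es {U} u = subst Uniq (sym (++-identityʳ (C ++ U))) u

  -- The path can replace either stretch of the cycle between `t` and `w₀`.
  sides : ∀ {u₁ uₚ U} → Out u₁ uₚ U → ∀ {α t β} → P ≡ α ++ t ∷ β → E t u₁ → # U ≤ # α × # U ≤ # β
  sides {u₁} {uₚ} {U} o {α} {t} {β} eq tu with segC
  ... | b , s , bw =
      subst (_≤ # α) (+-identityʳ (# U)) (subst (λ n → n + 0 ≤ # α) (S-rev (λ _ → 1) U)
        (insert (≈-Uniq e₁ (unCU o)) (rev E-sym (seg o)) (join (suffix (w₀ ∷ α) s′) bw [ w₀ ]) wu (E-sym tu) [] α sm₁ ([]-es (≈-Uniq e₁ (unCU o)))))
    , subst (_≤ # β) (+-identityʳ (# U)) (insert (unCU o) (seg o) (prefix (w₀ ∷ α) s′) tu (E-sym wu) [] β sm₂ ([]-es (unCU o)))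
    where
    s′ : Seg E w₀ b (w₀ ∷ α ++ t ∷ β)
    s′ = subst (λ zs → Seg E w₀ b (w₀ ∷ zs)) eq s
    wu : E w₀ uₚ
    wu = univ uₚ (off≢w₀ o (proj₂ (Seg-ends (seg o))))
    e₁ : C ++ U ≈ C ++ reverse U
    e₁ = same-sums λ f → S-++ f C U ∙ cong (S f C +_) (sym (S-rev f U)) ∙ sym (S-++ f C (reverse U))
    SP : ∀ f → S f P ≡ S f α + (f t + S f β)
    SP f = cong (S f) eq ∙ S-++ f α (t ∷ β)
    sm₁ : ∀ f → S f (t ∷ β ++ w₀ ∷ []) + S f α ≡ S f C + 0
    sm₁ f rewrite SP f | S-++ f β (w₀ ∷ []) = lem (f t) (S f β) (f w₀) (S f α)
      where
      lem : ∀ t b w a → t + (b + (w + 0)) + a ≡ w + (a + (t + b)) + 0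
      lem = solve-∀
    sm₂ : ∀ f → S f (w₀ ∷ α ++ t ∷ []) + S f β ≡ S f C + 0
    sm₂ f rewrite SP f | S-++ f α (t ∷ []) = lem (f t) (S f β) (f w₀) (S f α)
      where
      lem : ∀ t b w a → w + (a + (t + 0)) + b ≡ w + (a + (t + b)) + 0
      lem = solve-∀

  R′ : List V → List V
  R′ U = others (C ++ U)

  #CU : ∀ {u₁ uₚ U} → Out u₁ uₚ U → # C + # U ≤ 3 * k + 4
  #CU {U = U} o = ≤-trans (≤-reflexive (sym (S-++ (λ _ → 1) C U))) (≤-trans (#-Uniq-≤ (unCU o)) small)

  -- The two sides of `t`, the path, `t` and `w₀` make at least 3p+2 vertices, and there are at most
  -- 3k+4.
  p≤k : ∀ {u₁ uₚ U} → Out u₁ uₚ U → # U ≤ k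
  p≤k {U = U} o with at o
  ... | t , t∈ , tu with ∈-∃++ t∈
  ...   | α , β , eq with sides o eq tu
  ...     | l , r = ≮⇒≥ λ k<p → impossible 0 (+-mono-≤ (+-mono-≤ (#CU o) (+-mono-≤ l r)) (+-mono-≤ k<p (+-mono-≤ k<p k<p)))
            (cong (λ n → 1 + n + # U + (# U + # U) + (suc k + (suc k + suc k))) (cong # eq ∙ S-++ (λ _ → 1) α (t ∷ β)) ∙ lem (# α) (# β) (# U) k)
    where
    lem : ∀ x y u k → 1 + (x + (1 + y)) + u + (u + u) + (suc k + (suc k + suc k)) ≡ 3 * k + 4 + (x + y) + (u + (u + u)) + suc 0
    lem = solve-∀

  module _ {u₁ uₚ U} (o : Out u₁ uₚ U) (mx : Max (# U)) where

    last-inside : ∀ {w} → E uₚ w → w ∉ C → w ∈ U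
    last-inside {w} e w∉ with w ∈? U
    ... | yes w∈ = w∈
    ... | no w∉U = ⊥-elim (n≮n (# U) (subst (_≤ # U) (S-++ (λ _ → 1) U (w ∷ []) ∙ +-comm (# U) 1) (mx (record
          { seg = join (seg o) e [ w ]
          ; unU = ≈-Uniq (swap-≈ (w ∷ []) U) (Uniq-∷ w∉U (unU o))
          ; off = λ u∈ → off′ u∈
          ; at = at o }))))
      where
      off′ : ∀ {u} → u ∈ U ++ w ∷ [] → u ∉ C
      off′ u∈ with ∈-++⁻ U u∈
      ... | inj₁ m           = off o m
      ... | inj₂ (here refl) = w∉

    last-deg : suc k ≡ dg uₚ C + dg uₚ U
    last-deg = sym (deg uₚ (off≢w₀ o uₚ∈)) ∙ sym (S-others f (unCU o)) ∙ cong₂ _+_ (S-++ f C U) (dg-none (R′ U) none) ∙ +-identityʳ _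
      where
      f : V → ℕ
      f u = b2n (a uₚ u)
      uₚ∈ : uₚ ∈ U
      uₚ∈ = proj₂ (Seg-ends (seg o))
      none : ∀ {u} → u ∈ R′ U → ¬ E uₚ u
      none u∈ e = ∈-others⁻ u∈ (∈-++⁺ʳ C (last-inside e (λ m → ∈-others⁻ u∈ (∈-++⁺ˡ m))))

    -- By maximality every neighbour of `uₚ` outside the cycle is one of the other p - 1 vertices of
    -- the path.
    last-C : k + 2 ≤ dg uₚ C + # U
    last-C = linear (k + 2) (dg uₚ C + # U) 0 (own U (proj₂ (Seg-ends (seg o))))
        (lem k (# U) ∙ cong (λ n → suc n + # U) last-deg ∙ lem₂ (dg uₚ C) (dg uₚ U) (# U))
      where
      lem : ∀ k u → k + 2 + u + 0 ≡ suc (suc k) + u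
      lem = solve-∀
      lem₂ : ∀ c d u → suc (c + d) + u ≡ c + u + suc d
      lem₂ = solve-∀

    -- As p ≤ k, `last-C` leaves `uₚ` a neighbour on the cycle besides `w₀`, so the reversed path is
    -- attached as well.
    flip-out : Out uₚ u₁ (reverse U)
    flip-out = record
      { seg = rev E-sym (seg o)
      ; unU = ≈-Uniq (≈-sym (rev-≈ U)) (unU o)
      ; off = λ u∈ → off o (≈-∈ (rev-≈ U) u∈)
      ; at = attachₚ }
      where
      positive : 1 ≤ dg uₚ P
      positive = linear 1 (dg uₚ P) 0 (+-mono-≤ last-C (+-mono-≤ (p≤k o) (b2n≤1 (a uₚ w₀)))) (lem (b2n (a uₚ w₀)) (dg uₚ P) (# U) k)
        where
        lem : ∀ w c u k → 1 + (w + c + u + (k + 1)) + 0 ≡ c + (k + 2 + (u + w))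
        lem = solve-∀
      attachₚ : ∃ λ t → t ∈ P × E t uₚ
      attachₚ with S-pos (λ u → b2n (a uₚ u)) P positive
      ... | t , t∈ , e = t , t∈ , E-sym (b2n⇒T e)

    flip-max : Max (# (reverse U))
    flip-max {W = W} o′ = subst (# W ≤_) (sym (S-rev (λ _ → 1) U)) (mx o′)

  first-C : ∀ {u₁ uₚ U} → Out u₁ uₚ U → Max (# U) → k + 2 ≤ dg u₁ C + # U
  first-C {u₁} {uₚ} {U} o mx = subst (λ n → k + 2 ≤ dg u₁ C + n) (S-rev (λ _ → 1) U) (last-C (flip-out o mx) (flip-max o mx))

  -- An attached `t` has three neighbours on the cycle, one outside, and degree k+1.
  3≤k : 3 ≤ k
  3≤k with attached
  ... | t , z , t∈ , z∉ , tz with ∈-∃++ t∈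
  ...   | α , β , eq with sides o eq tz
    where
    o : Out z z (z ∷ [])
    o = record { seg = [ z ] ; unU = Uniq-∷ (λ ()) Uniq-[] ; off = λ { (here refl) → z∉ } ; at = t , t∈ , tz }
  ...     | l , r = ≤-pred (≤-trans (≤-trans (≤-reflexive (+-comm 1 3)) (+-mono-≤ (three eq l r) (dg-∈ {xs = z ∷ []} tz (here refl))))
              (≤-trans (≤-reflexive (sym (S-++ (λ u → b2n (a t u)) C (z ∷ []))))
                  (≤-trans (S-Uniq-≤ (λ u → b2n (a t u)) uCz) (≤-reflexive (deg t (P≢w₀ t∈))))))
    where
    uCz : Uniq (C ++ z ∷ [])
    uCz = ≈-Uniq (swap-≈ (z ∷ []) C) (Uniq-∷ z∉ (un ext))

-- Whether a vertex of C is adjacent to both ends u₁, uₚ of an outside path, or only to u₁, or only to uₚ.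
data Kind : Set where
  both fst snd : Kind

-- The value 1 means that the whole path fits between two such vertices of X, so a gap between them
-- is long: it has at least p vertices.
cmp : Kind → Kind → ℕ
cmp fst fst = 0
cmp snd snd = 0
cmp _   _   = 1

-- The number of long gaps on the way from `s` through `ts` back to `w₀`; since `w₀` is of kind
-- `both`, the last one is always long.
far : Kind → List Kind → ℕ
far s []       = 1
far s (t ∷ ts) = cmp s t + far t ts

isFst isSnd : Kind → ℕ
isFst snd = 0
isFst _   = 1
isSnd fst = 0
isSnd _   = 1

hasFst hasSnd : List Kind → ℕ
hasFst []         = 0
hasFst (fst ∷ ts) = 1
hasFst (_ ∷ ts)   = hasFst ts
hasSnd []         = 0
hasSnd (snd ∷ ts) = 1
hasSnd (_ ∷ ts)   = hasSnd ts

private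
  hasSnd≤1 : ∀ ts → hasSnd ts ≤ 1
  hasSnd≤1 []          = z≤n
  hasSnd≤1 (snd ∷ ts)  = ≤-refl
  hasSnd≤1 (both ∷ ts) = hasSnd≤1 ts
  hasSnd≤1 (fst ∷ ts)  = hasSnd≤1 ts

  newFst newSnd : Kind → List Kind → ℕ
  newFst fst ts = 0
  newFst _   ts = hasFst ts
  newSnd snd ts = 0
  newSnd _   ts = hasSnd ts

  -- Every arrival at a vertex of kind `both`, the final `w₀` included, is over a long gap; so is
  -- the first arrival at `fst`, and at `snd`, unless the start has that kind. The two sums on the
  -- left count all of `ts` once and kind `both` once more.
  far-bound : ∀ s ts → S isFst ts + S isSnd ts + 1 + newFst s ts + newSnd s ts ≤ far s ts + # ts
  far-bound both []  = ≤-refl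
  far-bound fst  []  = ≤-refl
  far-bound snd  []  = ≤-refl
  far-bound s (t ∷ ts) = grow s t
    where
    f g F G : ℕ
    f = S isFst ts
    g = S isSnd ts
    F = hasFst ts
    G = hasSnd ts
    grow : ∀ s t → isFst t + f + (isSnd t + g) + 1 + newFst s (t ∷ ts) + newSnd s (t ∷ ts) ≤ cmp s t + far t ts + suc (# ts)
    grow both both = linear (1 + f + (1 + g) + 1 + F + G) (1 + far both ts + suc (# ts)) 0 (far-bound both ts) (lem f g F G (far both ts) (# ts))
      where
      lem : ∀ f g F G x n → 1 + f + (1 + g) + 1 + F + G + (x + n) + 0 ≡ 1 + x + suc n + (f + g + 1 + F + G)
      lem = solve-∀
    grow both fst = linear (1 + f + g + 1 + 1 + G) (1 + far fst ts + suc (# ts)) 0 (far-bound fst ts) (lem f g G (far fst ts) (# ts))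
      where
      lem : ∀ f g G x n → 1 + f + g + 1 + 1 + G + (x + n) + 0 ≡ 1 + x + suc n + (f + g + 1 + 0 + G)
      lem = solve-∀
    grow both snd = linear (f + (1 + g) + 1 + F + 1) (1 + far snd ts + suc (# ts)) 0 (far-bound snd ts) (lem f g F (far snd ts) (# ts))
      where
      lem : ∀ f g F x n → f + (1 + g) + 1 + F + 1 + (x + n) + 0 ≡ 1 + x + suc n + (f + g + 1 + F + 0)
      lem = solve-∀
    grow fst both = linear (1 + f + (1 + g) + 1 + 0 + G) (1 + far both ts + suc (# ts)) F (far-bound both ts) (lem f g F G (far both ts) (# ts))
      where
      lem : ∀ f g F G x n → 1 + f + (1 + g) + 1 + 0 + G + (x + n) + F ≡ 1 + x + suc n + (f + g + 1 + F + G)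
      lem = solve-∀
    grow fst fst = linear (1 + f + g + 1 + 0 + G) (far fst ts + suc (# ts)) 0 (far-bound fst ts) (lem f g G (far fst ts) (# ts))
      where
      lem : ∀ f g G x n → 1 + f + g + 1 + 0 + G + (x + n) + 0 ≡ x + suc n + (f + g + 1 + 0 + G)
      lem = solve-∀
    grow fst snd = linear (f + (1 + g) + 1 + 0 + 1) (1 + far snd ts + suc (# ts)) F (far-bound snd ts) (lem f g F (far snd ts) (# ts))
      where
      lem : ∀ f g F x n → f + (1 + g) + 1 + 0 + 1 + (x + n) + F ≡ 1 + x + suc n + (f + g + 1 + F + 0)
      lem = solve-∀
    grow snd both = linear (1 + f + (1 + g) + 1 + F + 0) (1 + far both ts + suc (# ts)) G (far-bound both ts) (lem f g F G (far both ts) (# ts))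
      where
      lem : ∀ f g F G x n → 1 + f + (1 + g) + 1 + F + 0 + (x + n) + G ≡ 1 + x + suc n + (f + g + 1 + F + G)
      lem = solve-∀
    grow snd fst = linear (1 + f + g + 1 + 1 + 0) (1 + far fst ts + suc (# ts)) G (far-bound fst ts) (lem f g G (far fst ts) (# ts))
      where
      lem : ∀ f g G x n → 1 + f + g + 1 + 1 + 0 + (x + n) + G ≡ 1 + x + suc n + (f + g + 1 + 0 + G)
      lem = solve-∀
    grow snd snd = linear (f + (1 + g) + 1 + F + 0) (far snd ts + suc (# ts)) 0 (far-bound snd ts) (lem f g F (far snd ts) (# ts))
      where
      lem : ∀ f g F x n → f + (1 + g) + 1 + F + 0 + (x + n) + 0 ≡ x + suc n + (f + g + 1 + F + 0)
      lem = solve-∀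

  fst-count : ∀ ts → S isFst ts + hasSnd ts ≤ # ts
  fst-count []          = z≤n
  fst-count (both ∷ ts) = s≤s (fst-count ts)
  fst-count (fst ∷ ts)  = s≤s (fst-count ts)
  fst-count (snd ∷ ts)  = linear (S isFst ts + 1) (suc (# ts)) (hasSnd ts) (fst-count ts) (lem (S isFst ts) (hasSnd ts) (# ts))
    where
    lem : ∀ f h n → f + 1 + n + h ≡ suc n + (f + h)
    lem = solve-∀

  snd-count : ∀ ts → S isSnd ts + hasFst ts ≤ # ts
  snd-count []          = z≤n
  snd-count (both ∷ ts) = s≤s (snd-count ts)
  snd-count (snd ∷ ts)  = s≤s (snd-count ts)
  snd-count (fst ∷ ts)  = linear (S isSnd ts + 1) (suc (# ts)) (hasFst ts) (snd-count ts) (lem (S isSnd ts) (hasFst ts) (# ts))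
    where
    lem : ∀ f h n → f + 1 + n + h ≡ suc n + (f + h)
    lem = solve-∀

  no-snd : ∀ ts → hasSnd ts ≡ 0 → # ts ≤ S isFst ts
  no-snd []          _ = z≤n
  no-snd (both ∷ ts) h = s≤s (no-snd ts h)
  no-snd (fst ∷ ts)  h = s≤s (no-snd ts h)

  covered : ∀ ts → # ts ≤ S isFst ts + S isSnd ts
  covered []          = z≤n
  covered (both ∷ ts) = ≤-trans (s≤s (covered ts)) (+-monoʳ-≤ (suc (S isFst ts)) (n≤1+n (S isSnd ts)))
  covered (fst ∷ ts)  = s≤s (covered ts)
  covered (snd ∷ ts)  = ≤-trans (s≤s (covered ts)) (≤-reflexive (sym (+-suc _ _)))

-- A vertex of kind `fst` forces at least two long gaps. The 3k is matched by `k₂` three times if no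
-- `snd` occurs, where `uₚ` has the fewer neighbours, and by `k₁` twice and `k₂` once otherwise.
kinds-clash : ∀ ts k q c → hasFst ts ≡ 1 → k ≤ 1 + S isFst ts + q → k ≤ 1 + S isSnd ts + q →
  2 * suc (# ts) + (1 + q) * far both ts ≤ c → c + (2 + q) ≤ 3 * k + 4 → ⊥
kinds-clash ts k q c hF k₁ k₂ hc hk = main (hasSnd ts) refl (hasSnd≤1 ts)
  where
  f g n x : ℕ
  f = S isFst ts
  g = S isSnd ts
  n = # ts
  x = far both ts
  fb : f + g + 1 + hasFst ts + hasSnd ts ≤ x + n
  fb = far-bound both ts
  2≤x : 2 ≤ x
  2≤x = linear 2 x (hasSnd ts) (+-mono-≤ (far-bound both ts) (covered ts))
    (lem f g (hasSnd ts) x n ∙ cong (λ h → x + (f + g + 1 + h + hasSnd ts + n)) (sym hF))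
    where
    lem : ∀ f g s x n → 2 + (x + n + (f + g)) + s ≡ x + (f + g + 1 + 1 + s + n)
    lem = solve-∀
  qx : q * 2 ≤ q * x
  qx = *-monoʳ-≤ q 2≤x
  main : ∀ s → hasSnd ts ≡ s → s ≤ 1 → ⊥
  main zero e _ = impossible 0
      (+-mono-≤ (+-mono-≤ (+-mono-≤ hc hk) qx) (+-mono-≤ (+-mono-≤ (+-mono-≤ k₂ k₂) k₂)
          (+-mono-≤ fb (+-mono-≤ (no-snd ts e) (+-mono-≤ (snd-count ts) (snd-count ts))))))
      (cong₂ (λ hs hf → 2 * suc n + (1 + q) * x + (c + (2 + q)) + q * 2 + (k + k + k + (f + g + 1 + hf + hs + (n + (g + hf + (g + hf)))))) e
          hF ∙ lem f g n x q c k)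
    where
    lem : ∀ f g n x q c k → 2 * suc n + (1 + q) * x + (c + (2 + q)) + q * 2 + (k + k + k + (f + g + 1 + 1 + 0 + (n + (g + 1 + (g + 1)))))
      ≡ c + (3 * k + 4) + q * x + (1 + g + q + (1 + g + q) + (1 + g + q) + (x + n + (f + (n + n)))) + suc 0
    lem = solve-∀
  main (suc zero) e _ = impossible 0
      (+-mono-≤ (+-mono-≤ (+-mono-≤ hc hk) qx) (+-mono-≤ (+-mono-≤ (+-mono-≤ k₁ k₁) k₂) (+-mono-≤ fb (fst-count ts))))
      (cong₂ (λ hs hf → 2 * suc n + (1 + q) * x + (c + (2 + q)) + q * 2 + (k + k + k + (f + g + 1 + hf + hs + (f + hs)))) e hF ∙ lem f g n x q c k)
    where
    lem : ∀ f g n x q c k → 2 * suc n + (1 + q) * x + (c + (2 + q)) + q * 2 + (k + k + k + (f + g + 1 + 1 + 1 + (f + 1)))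
      ≡ c + (3 * k + 4) + q * x + (1 + f + q + (1 + f + q) + (1 + g + q) + (x + n + n)) + suc 0
    lem = solve-∀
  main (suc (suc s)) e (s≤s ())

-- Both ends of a longest outside path have the same neighbours on the cycle

module SameNeighbours (Γ : Ctx) (P : List (Fin (Ctx.N Γ))) (ext : Extremal.Ext Γ (Ctx.w₀ Γ ∷ P)) where
  open Extremal Γ
  open OnCycle Γ P ext
  open CaseB Γ P ext
  open Out

  module _ {u₁ uₚ : V} {U : List V} (o : Out u₁ uₚ U) (mx : Max (# U)) (q : ℕ) (p≡ : # U ≡ 2 + q) where

    private
      X : V → Set
      X x = x ∈ C × (E u₁ x ⊎ E uₚ x)

      X? : ∀ x → Dec (X x)
      X? x = (x ∈? C) ×-dec (T? (a u₁ x) ⊎-dec T? (a uₚ x))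

      u₁∈ : u₁ ∈ U
      u₁∈ = proj₁ (Seg-ends (seg o))

      uₚ∈ : uₚ ∈ U
      uₚ∈ = proj₂ (Seg-ends (seg o))

      E₁w : E u₁ w₀
      E₁w = E-sym (univ u₁ (off≢w₀ o u₁∈))

      Eₚw : E uₚ w₀
      Eₚw = E-sym (univ uₚ (off≢w₀ o uₚ∈))

      Xw₀ : X w₀
      Xw₀ = here refl , inj₁ E₁w

      far-apart : ∀ {s t Q} lost → Seg E s t Q → (∀ f → S f Q + S f lost ≡ S f C + 0) → (E u₁ t × E uₚ s) ⊎ (E uₚ t × E u₁ s) → # U ≤ # lost
      far-apart lost sQ sm (inj₁ (e , e′)) = subst (_≤ # lost) (+-identityʳ (# U))
          (insert (unCU o) (seg o) sQ (E-sym e) e′ [] lost sm ([]-es (unCU o)))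
      far-apart lost sQ sm (inj₂ (e , e′)) = subst (_≤ # lost) (+-identityʳ _ ∙ S-rev (λ _ → 1) U)
          (insert (unCU o′) (seg o′) sQ (E-sym e) e′ [] lost sm ([]-es (unCU o′)))
        where
        o′ : Out uₚ u₁ (reverse U)
        o′ = flip-out o mx

      near-apart : ∀ {s t Q u} lost → Seg E s t Q → (∀ f → S f Q + S f lost ≡ S f C + 0) → u ∈ U → E u t → E u s → 1 ≤ # lost
      near-apart {u = u} lost sQ sm u∈ et es = insert uCu [ u ] sQ (E-sym et) es [] lost sm ([]-es uCu)
        where
        uCu : Uniq (C ++ u ∷ [])
        uCu = ≈-Uniq (swap-≈ (u ∷ []) C) (Uniq-∷ (off o u∈) (un ext))

      nc : ∀ {u v} → Nx (C ++ w₀ ∷ []) u v → X u → X v → ⊥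
      nc {u} {v} n (_ , eu) (_ , ev) with on-cut (inj₁ n)
      ... | Q , s , e = clash eu ev
        where
        sQ : Seg E v u Q
        sQ = mapSeg proj₁ s
        sm : ∀ f → S f Q + 0 ≡ S f C + 0
        sm f = cong (_+ 0) (sums e f)
        zero-p : # U ≤ 0 → ⊥
        zero-p h with subst (_≤ 0) p≡ h
        ... | ()
        zero-1 : 1 ≤ 0 → ⊥
        zero-1 ()
        clash : E u₁ u ⊎ E uₚ u → E u₁ v ⊎ E uₚ v → ⊥
        clash (inj₁ x) (inj₁ y) = zero-1 (near-apart [] sQ sm u₁∈ x y)
        clash (inj₁ x) (inj₂ y) = zero-p (far-apart [] sQ sm (inj₁ (x , y)))
        clash (inj₂ x) (inj₁ y) = zero-p (far-apart [] sQ sm (inj₂ (x , y)))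
        clash (inj₂ x) (inj₂ y) = zero-1 (near-apart [] sQ sm uₚ∈ x y)

      abstract
        dc : ∃₂ λ g bs → flat ((w₀ , g) ∷ bs) ≡ w₀ ∷ P × Blocks X X? w₀ Xw₀ ((w₀ , g) ∷ bs)
        dc = decomp X X? w₀ Xw₀ w₀ P Xw₀ nc

      Blk : Set
      Blk = V × Gap V

      g₀ : Gap V
      g₀ = proj₁ dc

      bs′ bs : List Blk
      bs′ = proj₁ (proj₂ dc)
      bs = (w₀ , g₀) ∷ bs′

      flat≡ : flat bs ≡ C
      flat≡ = proj₁ (proj₂ (proj₂ dc))

      ok : Blocks X X? w₀ Xw₀ bs
      ok = proj₂ (proj₂ (proj₂ dc))

      kind : V → Kind
      kind x = if a u₁ x then (if a uₚ x then both else fst) else snd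

      kinds : List Blk → List Kind
      kinds = map (λ b → kind (proj₁ b))

      kind-cmp : ∀ {x y} → X x → X y → cmp (kind x) (kind y) ≡ 1 → (E u₁ x × E uₚ y) ⊎ (E uₚ x × E u₁ y)
      kind-cmp {x} {y} (_ , ex) (_ , ey) = table (a u₁ x) (a uₚ x) (a u₁ y) (a uₚ y) ex ey
        where
        K : Bool → Bool → Kind
        K i j = if i then (if j then both else fst) else snd
        table : ∀ i j i′ j′ → T i ⊎ T j → T i′ ⊎ T j′ → cmp (K i j) (K i′ j′) ≡ 1 → (T i × T j′) ⊎ (T j × T i′)
        table true  true  true  _     _ _ _ = inj₂ (_ , _)
        table true  true  false true  _ _ _ = inj₁ (_ , _)
        table true  false _     true  _ _ _ = inj₁ (_ , _)
        table true  false true  false _ _ ()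
        table false true  true  _     _ _ _ = inj₂ (_ , _)
        table false true  false true  _ _ ()
        table false false _     _     (inj₁ ()) _ _
        table false false _     _     (inj₂ ()) _ _
        table _     _     false false _ (inj₁ ()) _
        table _     _     false false _ (inj₂ ()) _

      kind-w₀ : kind w₀ ≡ both
      kind-w₀ with a u₁ w₀ | a uₚ w₀ | E₁w | Eₚw
      ... | true | true | _ | _ = refl

      next : List Blk → V
      next []            = w₀
      next ((x , _) ∷ _) = x

      -- A long gap has p = 1 + (1 + q) vertices or more, or else the path, in one direction or the
      -- other, could replace it.
      gap≥ : ∀ α {x g β} → bs ≡ α ++ (x , g) ∷ β → 1 + cmp (kind x) (kind (next β)) * (1 + q) ≤ # (toL g)
      gap≥ α {x} {g} {β} eq with next-shape α β eq
        where
        next-shape : ∀ α β → bs ≡ α ++ (x , g) ∷ β → ∃ λ t → flat β ++ flat α ++ x ∷ [] ≡ next β ∷ t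
        next-shape []      []      e    = _ , cong (_∷ []) (sym (cong proj₁ (∷-injectiveˡ e)))
        next-shape (b ∷ α) []      e    = _ , cong (λ y → y ∷ (toL (proj₂ b) ++ flat α) ++ x ∷ []) (sym (cong proj₁ (∷-injectiveˡ e)))
        next-shape α       (b ∷ β) e    = _ , refl
      ... | t , eqt with cut x (toL g) (next β) t (subst (λ zs → Seg E x x ((x ∷ toL g) ++ zs)) eqt (subst (Seg E x x) shape rot))
        where
        rot : Cyc E (x ∷ (toL g ++ flat β) ++ flat α)
        rot = rotate (flat α) (subst (Cyc E) (sym flat≡ ∙ cong flat eq ∙ concatMap-++ (λ b → proj₁ b ∷ toL (proj₂ b)) α ((x , g) ∷ β)) (cyc ext))
        shape : (x ∷ (toL g ++ flat β) ++ flat α) ++ x ∷ [] ≡ (x ∷ toL g) ++ flat β ++ flat α ++ x ∷ []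
        shape = cong (λ zs → (x ∷ zs) ++ x ∷ []) (++-assoc (toL g) (flat β) (flat α)) ∙
          ++-assoc (x ∷ toL g) (flat β ++ flat α) (x ∷ []) ∙ cong ((x ∷ toL g) ++_) (++-assoc (flat β) (flat α) (x ∷ []))
      ...   | _ , _ , _ , s = by-cmp (cmp (kind x) (kind (next β))) refl
        where
        SC : ∀ f → S f C ≡ S f (flat α) + (f x + (S f (toL g) + S f (flat β)))
        SC f = cong (S f) (sym flat≡ ∙ cong flat eq ∙ concatMap-++ (λ b → proj₁ b ∷ toL (proj₂ b)) α ((x , g) ∷ β)) ∙ S-++ f (flat α)
            (x ∷ toL g ++ flat β) ∙ cong (λ n → S f (flat α) + (f x + n)) (S-++ f (toL g) (flat β))
        sm : ∀ f → S f (next β ∷ t) + S f (toL g) ≡ S f C + 0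
        sm f = cong (λ zs → S f zs + S f (toL g)) (sym eqt) ∙ cong (_+ S f (toL g))
            (S-++ f (flat β) (flat α ++ x ∷ []) ∙ cong (S f (flat β) +_) (S-++ f (flat α) (x ∷ []))) ∙ lem (S f (flat β)) (S f (flat α))
            (f x) (S f (toL g)) ∙ cong (_+ 0) (sym (SC f))
          where
          lem : ∀ b a x g → b + (a + (x + 0)) + g ≡ a + (x + (g + b)) + 0
          lem = solve-∀
        x∈ : (x , g) ∈ bs
        x∈ = subst ((x , g) ∈_) (sym eq) (∈-++⁺ʳ α (here refl))
        Xnext : X (next β)
        Xnext = go β (λ {b} m → subst (b ∈_) (sym eq) (∈-++⁺ʳ α (there m)))
          where
          go : ∀ β → (∀ {b} → b ∈ β → b ∈ bs) → X (next β)
          go []      _   = Xw₀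
          go (b ∷ β) sub = proj₁ (ok (sub (here refl)))
        nonempty : ∀ (g : Gap V) → 1 ≤ # (toL g)
        nonempty (sg _)     = ≤-refl
        nonempty (bg _ _ _) = s≤s z≤n
        by-cmp : ∀ c → cmp (kind x) (kind (next β)) ≡ c → 1 + c * (1 + q) ≤ # (toL g)
        by-cmp zero          e = nonempty g
        by-cmp (suc zero)    e = ≤-trans (≤-reflexive (cong suc (+-identityʳ (suc q)) ∙ sym p≡))
            (far-apart (toL g) s sm (kind-cmp (proj₁ (ok x∈)) Xnext e))
        by-cmp (suc (suc c)) e = ⊥-elim (bad (kind x) (kind (next β)) e)
          where
          bad : ∀ s t → cmp s t ≡ suc (suc c) → ⊥
          bad both both ()
          bad both fst  ()
          bad both snd  ()
          bad fst  both ()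
          bad fst  fst  ()
          bad fst  snd  ()
          bad snd  both ()
          bad snd  fst  ()
          bad snd  snd  ()

      -- Each block supplies its vertex of X and one gap vertex, hence the factor 2; each long gap
      -- supplies 1 + q more.
      long : ∀ α {x g} β → bs ≡ α ++ (x , g) ∷ β → 2 * suc (# (kinds β)) + (1 + q) * far (kind x) (kinds β) ≤ # (flat ((x , g) ∷ β))
      long α {x} {g} [] eq = linear (2 * 1 + (1 + q) * 1) (suc (# (toL g ++ []))) 0 (gap≥ α eq)
          (cong (λ n → 2 * 1 + (1 + q) * 1 + n + 0) (sym (cong # (++-identityʳ (toL g)))) ∙ lem q (# (toL g ++ [])) ∙ cong
              (λ c → suc (# (toL g ++ [])) + (1 + c * (1 + q))) (sym closing))
        where
        lem : ∀ q n → 2 * 1 + (1 + q) * 1 + n + 0 ≡ suc n + (1 + 1 * (1 + q))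
        lem = solve-∀
        closing : cmp (kind x) (kind w₀) ≡ 1
        closing = cong (cmp (kind x)) kind-w₀ ∙ cb (kind x)
          where
          cb : ∀ s → cmp s both ≡ 1
          cb both = refl
          cb fst  = refl
          cb snd  = refl
      long α {x} {g} ((y , g′) ∷ β) eq = linear (2 * suc (suc K) + (1 + q) * (c + f)) (suc (# (toL g ++ flat ((y , g′) ∷ β)))) 0
          (+-mono-≤ (gap≥ α eq) (long (α ++ (x , g) ∷ []) β (eq ∙ sym (++-assoc α ((x , g) ∷ []) ((y , g′) ∷ β)))))
          (lem K q c f (# (toL g)) (# (flat ((y , g′) ∷ β))) ∙ cong (λ n → suc n + (1 + c * (1 + q) + (2 * suc K + (1 + q) * f)))
              (sym (S-++ (λ _ → 1) (toL g) (flat ((y , g′) ∷ β)))))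
        where
        K c f : ℕ
        K = # (kinds β)
        c = cmp (kind x) (kind y)
        f = far (kind y) (kinds β)
        lem : ∀ K q c f g r → 2 * suc (suc K) + (1 + q) * (c + f) + (g + r) + 0 ≡ suc (g + r) + (1 + c * (1 + q) + (2 * suc K + (1 + q) * f))
        lem = solve-∀

      ts : List Kind
      ts = kinds bs′

      gaps-none : ∀ {u} → (∀ {x} → x ∈ C → E u x → X x) → dg u (gaps bs) ≡ 0
      gaps-none {u} h = S-concatMap (λ v → b2n (a u v)) (λ b → toL (proj₂ b)) bs ∙ S-0 bs
          (λ b b∈ → dg-none (toL (proj₂ b)) (λ {x} x∈ e → proj₂ (ok b∈) x∈ (h (inC b∈ x∈) e)))
        where
        inC : ∀ {b x} → b ∈ bs → x ∈ toL (proj₂ b) → x ∈ C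
        inC {b} {x} b∈ x∈ with ∈-∃++ b∈
        ... | α , β , e = subst (x ∈_) flat≡ (subst (λ cs → x ∈ flat cs) (sym e)
            (subst (x ∈_) (sym (concatMap-++ (λ b → proj₁ b ∷ toL (proj₂ b)) α (b ∷ β))) (∈-++⁺ʳ (flat α) (there (∈-++⁺ˡ x∈)))))

      dgC : ∀ {u} → (∀ {x} → x ∈ C → E u x → X x) → (κ : Kind → ℕ) → (∀ x → b2n (a u x) ≤ κ (kind x)) → dg u C ≤ 1 + S κ ts
      dgC {u} h κ le = ≤-trans (≤-reflexive (cong (dg u) (sym flat≡) ∙ S-flat (λ v → b2n (a u v)) bs ∙ cong (dg u (heads bs) +_)
          (gaps-none h) ∙ +-identityʳ _))
        (+-mono-≤ (b2n≤1 (a u w₀)) (≤-trans (≤-reflexive (S-map (λ v → b2n (a u v)) proj₁ bs′))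
            (≤-trans (S-mono bs′ (λ b _ → le (proj₁ b))) (≤-reflexive (sym (S-map κ (λ b → kind (proj₁ b)) bs′))))))

      le₁ : ∀ x → b2n (a u₁ x) ≤ isFst (kind x)
      le₁ x with a u₁ x | a uₚ x
      ... | true  | true  = ≤-refl
      ... | true  | false = ≤-refl
      ... | false | _     = z≤n

      leₚ : ∀ x → b2n (a uₚ x) ≤ isSnd (kind x)
      leₚ x with a u₁ x | a uₚ x
      ... | true  | true  = ≤-refl
      ... | true  | false = z≤n
      ... | false | true  = ≤-refl
      ... | false | false = z≤n

      shorten : ∀ {c d} → k + 2 ≤ c + # U → c ≤ d → k ≤ d + q
      shorten {c} {d} h le = linear k (d + q) 0 (+-mono-≤ h le) (cong (λ n → k + (c + n + d) + 0) p≡ ∙ lem k c d q)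
        where
        lem : ∀ k c d q → k + (c + (2 + q) + d) + 0 ≡ d + q + (k + 2 + c)
        lem = solve-∀

    -- A neighbour of `u₁` alone would be of kind `fst`. The converse inclusion comes from the
    -- reversed path.
    same-neighbours : ∀ {x} → x ∈ C → E u₁ x → E uₚ x
    same-neighbours {x} x∈ e₁ with T? (a uₚ x)
    ... | yes e = e
    ... | no ¬e = ⊥-elim (kinds-clash ts k q (# C) present
            (shorten (first-C o mx) (dgC (λ m e → m , inj₁ e) isFst le₁))
            (shorten (last-C o mx) (dgC (λ m e → m , inj₂ e) isSnd leₚ))
            (subst₂ (λ s n → 2 * suc (# ts) + (1 + q) * far s ts ≤ n) kind-w₀ (cong # flat≡) (long [] bs′ refl))
            (subst (λ n → # C + n ≤ 3 * k + 4) p≡ (#CU o)))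
      where
      x-fst : kind x ≡ fst
      x-fst = table (a u₁ x) (a uₚ x) e₁ ¬e
        where
        table : ∀ i j → T i → ¬ T j → (if i then (if j then both else fst) else snd) ≡ fst
        table true false _ _ = refl
        table true true  _ h = ⊥-elim (h _)
      found : ∀ cs → (∀ {b} → b ∈ cs → b ∈ bs) → x ∈ flat cs → ∃ λ g → (x , g) ∈ cs
      found ((y , g) ∷ cs) sub (here refl) = g , here refl
      found ((y , g) ∷ cs) sub (there m) with ∈-++⁻ (toL g) m
      ... | inj₁ m′ = ⊥-elim (proj₂ (ok (sub (here refl))) m′ (x∈ , inj₁ e₁))
      ... | inj₂ m′ with found cs (sub ∘ there) m′
      ...   | g′ , b∈ = g′ , there b∈
      has : ∀ {g} cs → (x , g) ∈ cs → hasFst (kinds cs) ≡ 1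
      has ((y , g) ∷ cs) (here refl) rewrite x-fst = refl
      has ((y , g) ∷ cs) (there m) with kind y
      ... | fst  = refl
      ... | both = has cs m
      ... | snd  = has cs m
      present : hasFst ts ≡ 1
      present with found bs (λ m → m) (subst (x ∈_) (sym flat≡) x∈)
      ... | g , here refl = ⊥-elim (¬e Eₚw)
      ... | g , there b∈  = has bs′ b∈

private
  -- Here all x + 1 gaps are big. The bound on the order is used x + 2 times and the degree bound 2x
  -- + 4 times; the remainder is positive because x ≥ 2, whence x = 2 + x′.
  path-arith : ∀ k x′ q n r A SU SF ρ → let x = 2 + x′ ; p = 2 + q in
    k * (suc x + suc x) + SU ≤ k * x + SF + ρ → SF + 2 * suc x ≤ n * suc x + A + p * suc x → A ≡ n + p * suc x →
    suc x + A + p + r ≤ 3 * k + 4 → ρ ≤ 2 * r → x + x ≤ SU → k + 2 ≤ suc x + p → ⊥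
  path-arith k x′ q n r A SU SF ρ h₁ h₂ refl h₃ h₄ h₅ h₆ =
    impossible (x′ * x′ + 5 * x′ + 1 + q * (x′ * x′ + 4 * x′ + 2) + (2 + x′) * r)
      (+-mono-≤ (+-mono-≤ h₁ h₂) (+-mono-≤ (*-monoʳ-≤ (4 + x′) h₃) (+-mono-≤ h₄ (+-mono-≤ h₅ (*-monoʳ-≤ (8 + 2 * x′) h₆)))))
      (lem k x′ q n r SU SF ρ)
    where
    lem : ∀ k x′ q n r SU SF ρ →
      k * (suc (2 + x′) + suc (2 + x′)) + SU + (SF + 2 * suc (2 + x′)) +
          ((4 + x′) * (suc (2 + x′) + (n + (2 + q) * suc (2 + x′)) + (2 + q) + r) + (ρ + (2 + x′ + (2 + x′) + (8 + 2 * x′) * (k + 2))))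
      ≡ k * (2 + x′) + SF + ρ + (n * suc (2 + x′) + (n + (2 + q) * suc (2 + x′)) + (2 + q) * suc (2 + x′)) +
          ((4 + x′) * (3 * k + 4) + (2 * r + (SU + (8 + 2 * x′) * (suc (2 + x′) + (2 + q)))))
        + suc (x′ * x′ + 5 * x′ + 1 + q * (x′ * x′ + 4 * x′ + 2) + (2 + x′) * r)
    lem = solve-∀

-- The case without isolated vertices outside

module NoOutsidePath (Γ : Ctx) (P : List (Fin (Ctx.N Γ))) (ext : Extremal.Ext Γ (Ctx.w₀ Γ ∷ P)) where
  open Extremal Γ
  open OnCycle Γ P ext
  open CaseB Γ P ext hiding (R′)
  open SameNeighbours Γ P ext
  open Out

  module _ {u₁ uₚ : V} {U : List V} (o : Out u₁ uₚ U) (mx : Max (# U)) (q : ℕ) (p≡ : # U ≡ 2 + q) where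

    private
      X : V → Set
      X x = x ∈ C × E u₁ x

      Xₚ : ∀ {x} → X x → E uₚ x
      Xₚ (x∈ , e) = same-neighbours o mx q p≡ x∈ e

      reversed : ∀ {x} → x ∈ C → E uₚ x → E u₁ x
      reversed = same-neighbours (flip-out o mx) (flip-max o mx) q (S-rev (λ _ → 1) U ∙ p≡)

      u₁∈ : u₁ ∈ U
      u₁∈ = proj₁ (Seg-ends (seg o))

      uₚ∈ : uₚ ∈ U
      uₚ∈ = proj₂ (Seg-ends (seg o))

      link : ∀ {s t Q} → Seg E s t Q → X s → X t → ∀ es lost → (∀ f → S f Q + S f lost ≡ S f C + S f es) →
        Uniq ((C ++ U) ++ es) → (∀ {y} → y ∈ lost → ¬ ⊥) → # U + # es ≤ # lost
      link sQ Xs Xt es lost sm u _ = insert (unCU o) (seg o) sQ (E-sym (proj₂ Xt)) (Xₚ Xs) es lost sm u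

      nc : ∀ {u v} → On u v → X u → X v → ⊥
      nc on Xu Xv with on-cut on
      ... | Q , s , e with link (mapSeg proj₁ s) Xv Xu [] [] (λ f → cong (_+ 0) (sums e f)) ([]-es (unCU o)) (λ ())
      ...   | h with subst (λ n → n + 0 ≤ 0) p≡ h
      ...     | ()

      p≰1 : ¬ (# U ≤ 1)
      p≰1 h with subst (_≤ 1) p≡ h
      ... | s≤s ()

      -- Replacing the single vertex by U, which has at least two, would lengthen the cycle.
      single : ∀ {y} → y ∈ P → (∀ c → On c y → X c) → # U ≤ 1 × (∀ u → E y u → X u)
      single {y} y∈ h with around (there y∈)
      ... | cs , c , d , s , yc , dy , e = ⊥-elim (p≰1 (subst (_≤ 1) (+-identityʳ (# U))
              (link (mapSeg proj₁ s) (h c (On-sym (proj₂ yc))) (h d (proj₂ dy)) [] (y ∷ [])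
                  (λ f → lem (S f cs) (f y) ∙ cong (_+ 0) (sums e f)) ([]-es (unCU o)) (λ _ b → b))))
        where
        lem : ∀ c y → c + (y + 0) ≡ y + c + 0
        lem = solve-∀

      -- The part of the path from `u₁` to `u` would fit between `x` and `w` at no loss.
      noU : ∀ {u w x} → u ∈ U → X x → On x w → E u w → ⊥
      noU {u} {w} {x} u∈ Xx on uw with on-cut on | ∈-∃++ u∈
      ... | Q , s , e | U₁ , U₂ , eq with insert uCU₁ (prefix U₁ (subst (Seg E u₁ uₚ) eq (seg o))) (mapSeg proj₁ s) (E-sym (proj₂ Xx)) uw []
          [] (λ f → cong (_+ 0) (sums e f)) ([]-es uCU₁)
        where
        uCU₁ : Uniq (C ++ U₁ ++ u ∷ [])
        uCU₁ = Uniq-++ˡ (C ++ U₁ ++ u ∷ []) (subst Uniq (cong (C ++_) (eq ∙ sym (++-assoc U₁ (u ∷ []) U₂)) ∙ sym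
            (++-assoc C (U₁ ++ u ∷ []) U₂)) (unCU o))
      ...   | h with subst (λ n → n + 0 ≤ 0) (S-++ (λ _ → 1) U₁ (u ∷ []) ∙ +-comm (# U₁) 1) h
      ...     | ()

      frame : Counting.Frame Γ P U (# U)
      frame = record
        { X = X ; Y = λ _ → ⊥ ; X? = λ x → (x ∈? C) ×-dec T? (a u₁ x)
        ; Xw₀ = here refl , E-sym (univ u₁ (off≢w₀ o u₁∈))
        ; R = E ; R-sym = E-sym ; R⇒E = λ e → e ; mkR = λ e _ _ → e ; Rcyc = cyc ext ; nc = nc
        ; X⊆C = proj₁ ; Y⊆C = λ () ; Ynb = λ _ ()
        ; 1≤p = subst (1 ≤_) (sym p≡) (s≤s z≤n) ; #U = refl ; unCU = unCU o
        ; link = link ; single = single ; noU = noU }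

      open Inequality Γ frame using (X⁻; bs; bs′; GL; EL; R′; size; Fb; ρ; t; excess; count; F-bound; ρ≤; #EL; #bs; #total; size≥p; single-nbr; ok; SC; GL-¬X)
        renaming (#C to #C′)

      x : ℕ
      x = # X⁻

      big : ∀ {b} → b ∈ bs → isBig (proj₂ b) ≡ 1
      big {y , sg z}     b∈ = ⊥-elim (p≰1 (proj₁ (single-nbr b∈)))
      big {y , bg _ _ _} b∈ = refl

      t≡ : t ≡ suc x
      t≡ = S-cong bs (λ b b∈ → big b∈) ∙ #bs

      F≤ : S Fb bs + 2 * suc x ≤ excess * suc x + S size bs + # U * suc x
      F≤ = subst₂ _≤_ (S-+ Fb (λ _ → 2) bs ∙ cong (S Fb bs +_) (S-const 2 bs ∙ cong (2 *_) #bs))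
          (S-+ (λ b → excess + size b) (λ _ → # U) bs ∙ cong₂ _+_
              (S-+ (λ _ → excess) size bs ∙ cong (_+ S size bs) (S-const excess bs ∙ cong (excess *_) #bs)) (S-const (# U) bs ∙ cong (# U *_) #bs))
          (S-mono bs (λ b b∈ → each b∈))
        where
        each : ∀ {b} → b ∈ bs → Fb b + 2 ≤ excess + size b + # U
        each {y , sg z}     b∈ = ⊥-elim (p≰1 (proj₁ (single-nbr b∈)))
        each {y , bg _ _ _} b∈ = F-bound b∈

      A≡ : S size bs ≡ excess + # U * suc x
      A≡ = S-cong bs (λ b b∈ → sym (m∸n+n≡m (size≥p b∈))) ∙ S-+ (λ b → size b ∸ # U) (λ _ → # U) bs ∙ cong (excess +_)
          (S-const (# U) bs ∙ cong (# U *_) #bs)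

      heads-X : ∀ cs → (∀ {b} → b ∈ cs → b ∈ bs) → ∀ {y} → y ∈ heads cs → X y
      heads-X (b ∷ cs) sub (here refl) = proj₁ (ok (sub (here refl)))
      heads-X (b ∷ cs) sub (there m)   = heads-X cs (sub ∘ there) m

      X⁻-X : ∀ {y} → y ∈ X⁻ → X y
      X⁻-X = heads-X bs′ there

      SU≥ : x + x ≤ S (λ u → dg u X⁻) U
      SU≥ = split-ends (seg o) refl
        where
        split-ends : ∀ {W} → Seg E u₁ uₚ W → W ≡ U → x + x ≤ S (λ u → dg u X⁻) U
        split-ends [ _ ] e = ⊥-elim (p≰1 (≤-reflexive (sym (cong # e))))
        split-ends (_ ∷ s) refl = +-mono-≤ (≤-reflexive (sym (dg-all X⁻ (λ m → proj₂ (X⁻-X m)))))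
          (≤-trans (≤-reflexive (sym (dg-all X⁻ (λ m → Xₚ (X⁻-X m))))) (S-∈ (λ u → dg u X⁻) (proj₂ (Seg-ends s))))

      dg₁C : dg u₁ C ≤ suc x
      dg₁C = ≤-trans (≤-reflexive (SC (λ v → b2n (a u₁ v)) ∙ cong (b2n (a u₁ w₀) + dg u₁ X⁻ +_) gaps0 ∙ +-identityʳ _))
          (+-mono-≤ (b2n≤1 (a u₁ w₀)) (dg≤# u₁ X⁻))
        where
        inGL : ∀ {y} → y ∈ GL → y ∈ C
        inGL {y} y∈ = cnt⇒∈ C (≤-trans (∈⇒cnt y∈) (≤-trans (m≤n+m (cnt y GL) _) (≤-reflexive (sym (SC (δ y))))))
        gaps0 : dg u₁ GL ≡ 0
        gaps0 = dg-none GL (λ m e → GL-¬X m (inGL m , e))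

      k≤ : k + 2 ≤ suc x + # U
      k≤ = ≤-trans (first-C o mx) (+-monoˡ-≤ (# U) dg₁C)

      -- The ends have so few neighbours on the cycle that p = k and both are adjacent to all of U.
      -- Every vertex of U can then be made an end, so `t` is adjacent to all k of them and to three
      -- vertices of the cycle, against degree k+1.
      one-cut : x ≤ 1 → ⊥
      one-cut x≤1 with at o
      ... | t , t∈ , tu with ∈-∃++ t∈
      ...   | α , β , eq with sides o eq tu
      ...     | pα , pβ = impossible 1 (+-mono-≤ (+-mono-≤ degs (three eq (1≤ pα) (1≤ pβ))) k≤p) (lem (dg t C) k (# U))
        where
        lem : ∀ c k u → c + u + 3 + k ≡ suc k + c + u + suc 1
        lem = solve-∀
        k≤p : k ≤ # U
        k≤p = linear k (# U) 0 (+-mono-≤ k≤ x≤1) (lem₁ k x (# U))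
          where
          lem₁ : ∀ k x u → k + (suc x + u + 1) + 0 ≡ u + (k + 2 + x)
          lem₁ = solve-∀
        nearly-full : ∀ {c d} → suc k ≡ c + d → c ≤ dg u₁ C → # U ≤ suc d
        nearly-full {c} {d} e le = linear (# U) (suc d) 0 (+-mono-≤ (p≤k o) (+-mono-≤ le (+-mono-≤ dg₁C x≤1)))
          (lem₁ (# U) (dg u₁ C) k x ∙ cong (λ n → # U + dg u₁ C + suc x + n) e ∙ lem₂ (# U) c (dg u₁ C) x d)
          where
          lem₁ : ∀ u c k x → u + (k + (c + (suc x + 1))) + 0 ≡ u + c + suc x + suc k
          lem₁ = solve-∀
          lem₂ : ∀ u c d₁ x d → u + d₁ + suc x + (c + d) ≡ suc d + (u + (c + (d₁ + x)))
          lem₂ = solve-∀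
        full₁ : # U ≤ suc (dg u₁ U)
        full₁ = nearly-full (last-deg (flip-out o mx) (flip-max o mx) ∙ cong (dg u₁ C +_) (S-rev (λ v → b2n (a u₁ v)) U)) ≤-refl
        fullₚ : # U ≤ suc (dg uₚ U)
        fullₚ = nearly-full (last-deg o mx) (S-mono C (λ y y∈ → le y y∈ (T? (a uₚ y))))
          where
          le : ∀ y → y ∈ C → Dec (E uₚ y) → b2n (a uₚ y) ≤ b2n (a u₁ y)
          le y y∈ (yes e) = ≤-trans (b2n≤1 (a uₚ y)) (≤-reflexive (sym (T⇒b2n (reversed y∈ e))))
          le y y∈ (no ¬e) = ≤-trans (≤-reflexive (¬T⇒b2n ¬e)) z≤n
        -- The ends are adjacent to all of U, so every other vertex of U is the end of a walk through U from u₁ as well.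
        all-t : ∀ {W} → Seg E u₁ uₚ W → W ≡ U → ∀ {u} → u ∈ U → E t u
        all-t [ _ ] refl (here refl) = tu
        all-t (r ∷ s) refl (here refl) = tu
        all-t (_∷_ {b = b} {xs = W} r s) refl {u} (there m) with ∈-∃++ m
        ... | m₁ , [] , e with last-eq m₁ (subst (Seg E b uₚ) e s)
        ...   | refl = E-sym (Xₚ (there t∈ , E-sym tu))
        all-t (_∷_ {b = b} {xs = W} r s) refl {u} (there m) | m₁ , c ∷ m₂ , e =
          E-sym (same-neighbours o′ mx′ q (#W′ ∙ p≡) (there t∈) (E-sym tu))
          where
          s′ : Seg E b uₚ (m₁ ++ u ∷ c ∷ m₂)
          s′ = subst (Seg E b uₚ) e s
          sc : Seg E c uₚ (c ∷ m₂)
          sc = suffix (m₁ ++ u ∷ []) (subst (Seg E b uₚ) (sym (++-assoc m₁ (u ∷ []) (c ∷ m₂))) s′)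
          sb : Seg E b u (m₁ ++ u ∷ [])
          sb = prefix m₁ s′
          W≡ : W ≡ (m₁ ++ u ∷ []) ++ c ∷ m₂
          W≡ = e ∙ sym (++-assoc m₁ (u ∷ []) (c ∷ m₂))
          c∈W : c ∈ W
          c∈W = subst (c ∈_) (sym W≡) (∈-++⁺ʳ (m₁ ++ u ∷ []) (here refl))
          b∈W : b ∈ W
          b∈W = subst (b ∈_) (sym W≡) (∈-++⁺ˡ (proj₁ (Seg-ends sb)))
          u₁∉W : u₁ ∉ W
          u₁∉W = Uniq-head (unU o)
          b≢uₚ : b ≢ uₚ
          b≢uₚ refl = Uniq-disj (m₁ ++ u ∷ []) (subst Uniq W≡ (Uniq-++ʳ (u₁ ∷ []) (unU o))) (proj₁ (Seg-ends sb)) (proj₂ (Seg-ends sc))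
          -- The new path jumps from `u₁` to `c`, runs to `uₚ`, jumps back to `b` and ends in `u`.
          W′ : List V
          W′ = u₁ ∷ (c ∷ m₂) ++ m₁ ++ u ∷ []
          W′≈ : W′ ≈ u₁ ∷ W
          W′≈ = same-sums λ f → cong (f u₁ +_) (sums (swap-≈ (c ∷ m₂) (m₁ ++ u ∷ [])) f ∙ cong (S f) (sym W≡))
          #W′ : # W′ ≡ # U
          #W′ = sums W′≈ (λ _ → 1)
          o′ : Out u₁ u W′
          o′ = record
            { seg = full U u₁∈ (there c∈W) (λ { refl → u₁∉W c∈W }) full₁ ∷ join sc (full U uₚ∈ (there b∈W) b≢uₚ fullₚ) sb
            ; unU = ≈-Uniq (≈-sym W′≈) (unU o)
            ; off = λ v∈ → off o (≈-∈ W′≈ v∈)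
            ; at = at o }
          mx′ : Max (# W′)
          mx′ {W = Z} oz = subst (# Z ≤_) (sym #W′) (mx oz)
        1≤ : ∀ {m} → # U ≤ m → 1 ≤ m
        1≤ h = ≤-trans (subst (1 ≤_) (sym p≡) (s≤s z≤n)) h
        degs : dg t C + # U ≤ suc k
        degs = ≤-trans (≤-reflexive (cong (dg t C +_) (sym (dg-all U (all-t (seg o) refl))) ∙ sym (S-++ (λ v → b2n (a t v)) C U)))
          (≤-trans (S-Uniq-≤ (λ v → b2n (a t v)) (unCU o)) (≤-reflexive (deg t (P≢w₀ t∈))))

    no-path : ⊥
    no-path = by-x x refl
      where
      by-x : ∀ x′ → x ≡ x′ → ⊥
      by-x zero e = one-cut (subst (_≤ 1) (sym e) z≤n)
      by-x (suc zero) e = one-cut (≤-reflexive e)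
      by-x (suc (suc x′)) e = path-arith k x′ q excess (# R′) (S size bs) (S (λ u → dg u X⁻) U) (S Fb bs) ρ
        (subst₂ (λ m n → k * m + S (λ u → dg u X⁻) U ≤ k * n + S Fb bs + ρ) (#EL ∙ cong₂ _+_ #bs t≡ ∙ cong (λ n → suc n + suc n) e) e count)
        (subst₂ (λ y p → S Fb bs + 2 * suc y ≤ excess * suc y + S size bs + p * suc y) e p≡ F≤)
        (subst₂ (λ y p → S size bs ≡ excess + p * suc y) e p≡ A≡)
        (subst₂ (λ y p → suc y + S size bs + p + # R′ ≤ 3 * k + 4) e p≡
            (≤-trans (≤-reflexive (cong (λ n → n + # U + # R′) (sym #C′) ∙ #total)) small))
        ρ≤ (subst (λ y → y + y ≤ S (λ u → dg u X⁻) U) e SU≥) (subst₂ (λ y p → k + 2 ≤ suc y + p) e p≡ k≤)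

  -- A longest attached path exists, and the hypothesis gives it at least two vertices.
  no-outside-edge : (∀ {u} → u ∉ C → ∃ λ w → w ∉ C × E u w) → ⊥
  no-outside-edge onward with attached
  ... | t , z , t∈ , z∉ , tz = <-rec (λ m → ∀ {u₁ uₚ U} → N ∸ # U ≡ m → Out u₁ uₚ U → ⊥) longest _ refl
      (record { seg = [ z ] ; unU = Uniq-∷ (λ ()) Uniq-[] ; off = λ { (here refl) → z∉ } ; at = t , t∈ , tz })
    where
    two : ∀ {u₁ uₚ U} → Out u₁ uₚ U → ∃ λ w → Out u₁ w (u₁ ∷ w ∷ [])
    two {u₁} o with onward (off o (proj₁ (Seg-ends (seg o))))
    ... | w , w∉ , e = w , record
          { seg = e ∷ [ w ] ; unU = Uniq-∷ (λ { (here refl) → E-irr e }) (Uniq-∷ (λ ()) Uniq-[])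
          ; off = λ { (here refl) → off o (proj₁ (Seg-ends (seg o))) ; (there (here refl)) → w∉ } ; at = at o }
    longest : ∀ m → (∀ {m′} → m′ < m → ∀ {u₁ uₚ U} → N ∸ # U ≡ m′ → Out u₁ uₚ U → ⊥) → ∀ {u₁ uₚ U} → N ∸ # U ≡ m → Out u₁ uₚ U → ⊥
    longest m ih {U = U} eq o = no-path o mx (# U ∸ 2) (sym (+-comm 2 _ ∙ m∸n+n≡m (mx (proj₂ (two o)))))
      where
      mx : Max (# U)
      mx {W = W} o′ = ≮⇒≥ λ lt → ih (subst (N ∸ # W <_) eq (∸-monoʳ-< lt (#-Uniq-≤ (unU o′)))) refl o′

-- The hopping closure of an isolated vertex

module Hopping (Γ : Ctx) (P : List (Fin (Ctx.N Γ))) (ext : Extremal.Ext Γ (Ctx.w₀ Γ ∷ P))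
               (v : Fin (Ctx.N Γ)) (isoᵥ : Extremal.Iso Γ (Ctx.w₀ Γ ∷ P) v) where
  open Extremal Γ
  open OnCycle Γ P ext

  -- A vertex of Y can give up its place to `v` on a cycle of the same length; its neighbours
  -- therefore deserve the same treatment as those of `v`.
  X Y : ℕ → V → Set
  X zero    u = E v u
  X (suc i) u = E v u ⊎ ∃ λ y → Y i y × E y u
  Y i y = y ∈ C × (∀ c → On y c → X i c)

  On? : ∀ u w → Dec (On u w)
  On? u w = Nx? (C ++ w₀ ∷ []) u w ⊎-dec Nx? (C ++ w₀ ∷ []) w u

  X? : ∀ i u → Dec (X i u)
  Y? : ∀ i u → Dec (Y i u)
  X? zero    u = T? (a v u)
  X? (suc i) u = T? (a v u) ⊎-dec any? (λ y → Y? i y ×-dec T? (a y u))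
  Y? i u = (u ∈? C) ×-dec all? (λ c → On? u c →-dec X? i c)

  X-suc : ∀ i {u} → X i u → X (suc i) u
  Y-suc : ∀ i {u} → Y i u → Y (suc i) u
  X-suc zero    e                   = inj₁ e
  X-suc (suc i) (inj₁ e)            = inj₁ e
  X-suc (suc i) (inj₂ (y , Yy , e)) = inj₂ (y , Y-suc i Yy , e)
  Y-suc i (m , h) = m , λ c o → X-suc i (h c o)

  X-mono : ∀ {i j} → i ≤ j → ∀ {u} → X i u → X j u
  X-mono {i} {zero}  z≤n x = x
  X-mono {i} {suc j} i≤j x with m≤n⇒m<n∨m≡n i≤j
  ... | inj₁ (s≤s i≤j′) = X-suc j (X-mono i≤j′ x)
  ... | inj₂ refl       = x

  Y-mono : ∀ {i j} → i ≤ j → ∀ {u} → Y i u → Y j u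
  Y-mono i≤j (m , h) = m , λ c o → X-mono i≤j (h c o)

  X₀ : ∀ i {u} → E v u → X i u
  X₀ i e = X-mono {zero} {i} z≤n e

  NC : ℕ → Set
  NC i = ∀ {u w} → On u w → X i u → X i w → ⊥

  disjoint : ∀ i → NC i → ∀ {u} → X i u → Y i u → ⊥
  disjoint i nc Xu (u∈ , h) with around u∈
  ... | _ , c , _ , _ , (_ , on) , _ = nc on Xu (h c on)

  -- For vertices of an earlier Y, "both cycle neighbours are in X" is weakened to a condition on
  -- the edges of the walk. Unlike adjacency on the cycle it is needed only below level i, so
  -- rearranging at level i can add new edges.
  Eᵢ : ℕ → V → V → Set
  Eᵢ i u w = E u w × (∀ ℓ → ℓ < i → Y ℓ u → X ℓ w) × (∀ ℓ → ℓ < i → Y ℓ w → X ℓ u)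

  Eᵢ-sym : ∀ {i u w} → Eᵢ i u w → Eᵢ i w u
  Eᵢ-sym (e , f , g) = E-sym e , g , f

  lower : ∀ {i u w} → Eᵢ (suc i) u w → Eᵢ i u w
  lower (e , f , g) = e , (λ ℓ h → f ℓ (m≤n⇒m≤1+n h)) , λ ℓ h → g ℓ (m≤n⇒m≤1+n h)

  EO⇒Eᵢ : ∀ {i u w} → EO u w → Eᵢ i u w
  EO⇒Eᵢ (e , o) = e , (λ ℓ _ Yu → proj₂ Yu _ o) , λ ℓ _ Yw → proj₂ Yw _ (On-sym o)

  -- A new edge of a rearrangement stays in `Eᵢ` when its ends are free.
  Free : ℕ → V → Set
  Free i u = ∀ ℓ → ℓ < i → ¬ Y ℓ u

  free-edge : ∀ {i u w} → E u w → Free i u → Free i w → Eᵢ i u w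
  free-edge e fu fw = e , (λ ℓ h Yu → ⊥-elim (fu ℓ h Yu)) , λ ℓ h Yw → ⊥-elim (fw ℓ h Yw)

  Reached : List V → Set
  Reached Q = ∃ λ Q′ → ∃₂ λ s t → Seg E s t Q′ × E v s × E v t × Q′ ≈ Q

  Reached-≈ : ∀ {Q Q′} → Q ≈ Q′ → Reached Q → Reached Q′
  Reached-≈ e (R , s , t , w , vs , vt , e′) = R , s , t , w , vs , vt , ≈-trans e′ e

  -- A walk with ends in X i can be rearranged to have both ends adjacent to v: an end adjacent to y ∈ Y (i-1) is
  -- exchanged for a neighbour of y on the walk, which lies in X (i-1).
  hop : ∀ i → (∀ j → j < i → NC j) → ∀ {s t Q} → Seg (Eᵢ i) s t Q → X i s → X i t → Free i s → Free i t →
    (∀ ℓ → ℓ < i → ∀ {y} → Y ℓ y → y ∈ Q) → Reached Q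
  hop zero nc {s} {t} {Q} sQ Xs Xt _ _ _ = Q , s , t , mapSeg proj₁ sQ , Xs , Xt , same-sums λ _ → refl
  hop (suc i) nc {s} {t} {Q} sQ Xs Xt Fs Ft Y⊆Q = settle (classify Xs) (classify Xt)
    where
    D : ∀ {u} → X i u → Y i u → ⊥
    D = disjoint i (nc i (n<1+n i))

    X-free : ∀ {u} → X i u → Free i u
    X-free Xu ℓ h Yu = D Xu (Y-mono (<⇒≤ h) Yu)

    drop : ∀ {u} → Free (suc i) u → Free i u
    drop F ℓ h = F ℓ (m≤n⇒m≤1+n h)

    Via : V → V → Set
    Via u y = Y i y × E y u × Free i y

    classify : ∀ {u} → X (suc i) u → X i u ⊎ ∃ (Via u)
    classify {u} Xu with X? i u
    ... | yes h = inj₁ h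
    classify {u} (inj₁ e) | no ¬h = inj₁ (X₀ i e)
    -- `y` is new at this level: from an earlier Y it would have put `u` into X i already.
    classify {u} (inj₂ (y , Yy , e)) | no ¬h = inj₂ (y , Yy , e , λ ℓ h Yℓ → ¬h (X-mono h (inj₂ (y , Yℓ , e))))

    succ-X : ∀ {y q} → Y i y → Eᵢ (suc i) y q → X i q
    succ-X Yy (_ , f , _) = f i (n<1+n i) Yy

    pred-X : ∀ {y q} → Y i y → Eᵢ (suc i) q y → X i q
    pred-X Yy (_ , _ , g) = g i (n<1+n i) Yy

    finish : ∀ {s′ t′ Q′} → Seg (Eᵢ i) s′ t′ Q′ → X i s′ → X i t′ → Q′ ≈ Q → Reached Q
    finish sQ′ Xs′ Xt′ e = Reached-≈ e (hop i (λ j h → nc j (m≤n⇒m≤1+n h)) sQ′ Xs′ Xt′ (X-free Xs′) (X-free Xt′)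
      (λ ℓ h Yy → ≈-∈ (≈-sym e) (Y⊆Q ℓ (m≤n⇒m≤1+n h) Yy)))

    lowSeg : ∀ {c d xs} → Seg (Eᵢ (suc i)) c d xs → Seg (Eᵢ i) c d xs
    lowSeg = mapSeg lower

    -- The walk s...y q...t becomes s...y t...q, and `q` lies in X i because it follows `y`.
    one : ∀ {s t R y} → Seg (Eᵢ (suc i)) s t R → R ≈ Q → X i s → Free (suc i) t → Via t y → Reached Q
    one {s} {t} {R} {y} sR eR Xs Ft (Yy , yt , Fy) with ∈-∃++ (≈-∈ (≈-sym eR) (Y⊆Q i (n<1+n i) Yy))
    ... | α , [] , refl with last-eq α sR
    ...   | refl = ⊥-elim (Ft i (n<1+n i) Yy)
    one {s} {t} {R} {y} sR eR Xs Ft (Yy , yt , Fy) | α , q ∷ β , refl =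
      finish (join (lowSeg (prefix α sR)) (free-edge yt Fy (drop Ft)) (rev Eᵢ-sym (lowSeg post))) Xs (succ-X Yy (edge α sR))
          (≈-trans (same-sums eqv) eR)
      where
      post : Seg (Eᵢ (suc i)) q t (q ∷ β)
      post = suffix (α ++ y ∷ []) (subst (Seg (Eᵢ (suc i)) s t) (sym (++-assoc α (y ∷ []) (q ∷ β))) sR)
      eqv : ∀ f → S f ((α ++ y ∷ []) ++ reverse (q ∷ β)) ≡ S f (α ++ y ∷ q ∷ β)
      eqv f = S-++ f (α ++ y ∷ []) (reverse (q ∷ β)) ∙ cong (S f (α ++ y ∷ []) +_) (S-rev f (q ∷ β)) ∙
        sym (S-++ f (α ++ y ∷ []) (q ∷ β)) ∙ cong (S f) (++-assoc α (y ∷ []) (q ∷ β))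

    -- Let the walk be s...p y₁ q...t. It becomes p...s y₁ t...q if y₂ = y₁; with `r` the successor
    -- of `y₂`, it becomes p...s y₁...y₂ t...r if `y₂` comes later, and q...t y₂...s y₁ p...r if it
    -- comes earlier.
    two : ∀ {y₁ y₂} → Via s y₁ → Via t y₂ → Reached Q
    two {y₁} {y₂} (Y₁ , e₁ , F₁) (Y₂ , e₂ , F₂) with ∈-∃++ (Y⊆Q i (n<1+n i) Y₁)
    ... | [] , β , refl with head-eq sQ
    ...   | refl = ⊥-elim (Fs i (n<1+n i) Y₁)
    two {y₁} {y₂} (Y₁ , e₁ , F₁) (Y₂ , e₂ , F₂) | α , [] , refl with last-eq α sQ
    ... | refl = ⊥-elim (Ft i (n<1+n i) Y₁)
    two {y₁} {y₂} (Y₁ , e₁ , F₁) (Y₂ , e₂ , F₂) | x ∷ α , q ∷ β , refl with cut x α y₁ (q ∷ β) sQ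
    ... | p , sα , py , syβ with ∈-++⁻ (x ∷ α) (Y⊆Q i (n<1+n i) Y₂)
    ...   | inj₂ (here refl) =
            finish (join (rev Eᵢ-sym (lowSeg sα)) (free-edge (E-sym e₁) (drop Fs) F₁)
                (join [ y₁ ] (free-edge e₂ F₁ (drop Ft)) (rev Eᵢ-sym (lowSeg (suffix (y₁ ∷ []) syβ)))))
              (pred-X Y₁ py) (succ-X Y₁ (edge [] syβ)) (same-sums λ f → S-++ f (reverse (x ∷ α)) (y₁ ∷ reverse (q ∷ β)) ∙ cong₂
                  (λ m n → m + (f y₁ + n)) (S-rev f (x ∷ α)) (S-rev f (q ∷ β)) ∙ sym (S-++ f (x ∷ α) (y₁ ∷ q ∷ β)))
    ...   | inj₂ (there m) with ∈-∃++ m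
    ...     | m₁ , [] , eβ with last-eq m₁ (suffix′ eβ)
      where
      suffix′ : q ∷ β ≡ m₁ ++ y₂ ∷ [] → Seg (Eᵢ (suc i)) q t (m₁ ++ y₂ ∷ [])
      suffix′ e = subst (Seg (Eᵢ (suc i)) q t) e (suffix (y₁ ∷ []) syβ)
    ...       | refl = ⊥-elim (Ft i (n<1+n i) Y₂)
    two {y₁} {y₂} (Y₁ , e₁ , F₁) (Y₂ , e₂ , F₂) | x ∷ α , q ∷ β , refl | p , sα , py , syβ | inj₂ (there m) | m₁ , r ∷ m₂ , eβ =
            finish (join (rev Eᵢ-sym (lowSeg sα)) (free-edge (E-sym e₁) (drop Fs) F₁)
                (join (lowSeg (prefix (y₁ ∷ m₁) s₂)) (free-edge e₂ F₂ (drop Ft)) (rev Eᵢ-sym (lowSeg post))))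
              (pred-X Y₁ py) (succ-X Y₂ (edge (y₁ ∷ m₁) s₂)) (same-sums eqv)
      where
      s₂ : Seg (Eᵢ (suc i)) y₁ t (y₁ ∷ m₁ ++ y₂ ∷ r ∷ m₂)
      s₂ = subst (λ zs → Seg (Eᵢ (suc i)) y₁ t (y₁ ∷ zs)) eβ syβ
      post : Seg (Eᵢ (suc i)) r t (r ∷ m₂)
      post = suffix (y₁ ∷ m₁ ++ y₂ ∷ []) (subst (Seg (Eᵢ (suc i)) y₁ t) (cong (y₁ ∷_) (sym (++-assoc m₁ (y₂ ∷ []) (r ∷ m₂)))) s₂)
      eqv : ∀ f → S f (reverse (x ∷ α) ++ (y₁ ∷ m₁ ++ y₂ ∷ []) ++ reverse (r ∷ m₂)) ≡ S f ((x ∷ α) ++ y₁ ∷ q ∷ β)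
      eqv f = S-++ f (reverse (x ∷ α)) _ ∙ cong₂ _+_ (S-rev f (x ∷ α))
          (S-++ f (y₁ ∷ m₁ ++ y₂ ∷ []) (reverse (r ∷ m₂)) ∙ cong (S f (y₁ ∷ m₁ ++ y₂ ∷ []) +_) (S-rev f (r ∷ m₂)) ∙
        sym (S-++ f (y₁ ∷ m₁ ++ y₂ ∷ []) (r ∷ m₂)) ∙ cong (λ zs → S f (y₁ ∷ zs)) (++-assoc m₁ (y₂ ∷ []) (r ∷ m₂) ∙ sym eβ)) ∙ sym
            (S-++ f (x ∷ α) (y₁ ∷ q ∷ β))
    two {y₁} {y₂} (Y₁ , e₁ , F₁) (Y₂ , e₂ , F₂) | x ∷ α , q ∷ β , refl | p , sα , py , syβ | inj₁ m with ∈-∃++ m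
    ... | m₁ , [] , eα with last-eq m₁ (subst (Seg (Eᵢ (suc i)) s p) eα sα)
    ...   | refl = ⊥-elim (D (pred-X Y₁ py) Y₂)
    two {y₁} {y₂} (Y₁ , e₁ , F₁) (Y₂ , e₂ , F₂) | x ∷ α , q ∷ β , refl | p , sα , py , syβ | inj₁ m | m₁ , r ∷ m₂ , eα =
            finish (join (join (lowSeg (suffix (y₁ ∷ []) syβ)) (free-edge (E-sym e₂) (drop Ft) F₂) (rev Eᵢ-sym (lowSeg (prefix m₁ s₂))))
                (free-edge (E-sym e₁) (drop Fs) F₁)
                     (join [ y₁ ] (Eᵢ-sym (lower py)) (rev Eᵢ-sym (lowSeg post))))
              (succ-X Y₁ (edge [] syβ)) (succ-X Y₂ (edge m₁ s₂)) (same-sums eqv)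
      where
      s₂ : Seg (Eᵢ (suc i)) s p (m₁ ++ y₂ ∷ r ∷ m₂)
      s₂ = subst (Seg (Eᵢ (suc i)) s p) eα sα
      post : Seg (Eᵢ (suc i)) r p (r ∷ m₂)
      post = suffix (m₁ ++ y₂ ∷ []) (subst (Seg (Eᵢ (suc i)) s p) (sym (++-assoc m₁ (y₂ ∷ []) (r ∷ m₂))) s₂)
      eqv : ∀ f → S f (((q ∷ β) ++ reverse (m₁ ++ y₂ ∷ [])) ++ y₁ ∷ reverse (r ∷ m₂)) ≡ S f ((x ∷ α) ++ y₁ ∷ q ∷ β)
      eqv f = S-++ f ((q ∷ β) ++ reverse (m₁ ++ y₂ ∷ [])) _ ∙ cong₂ (λ m n → m + (f y₁ + n))
          (S-++ f (q ∷ β) (reverse (m₁ ++ y₂ ∷ [])) ∙ cong (S f (q ∷ β) +_) (S-rev f (m₁ ++ y₂ ∷ []) ∙ S-++ f m₁ (y₂ ∷ []))) (S-rev f (r ∷ m₂)) ∙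
        lem (S f (q ∷ β)) (S f m₁) (f y₂) (f y₁) (S f (r ∷ m₂)) ∙ sym
            (S-++ f (x ∷ α) (y₁ ∷ q ∷ β) ∙ cong (_+ (f y₁ + S f (q ∷ β))) (cong (S f) eα ∙ S-++ f m₁ (y₂ ∷ r ∷ m₂)))
        where
        lem : ∀ b m y₂ y₁ r → b + (m + (y₂ + 0)) + (y₁ + r) ≡ m + (y₂ + r) + (y₁ + b)
        lem = solve-∀

    settle : X i s ⊎ ∃ (Via s) → X i t ⊎ ∃ (Via t) → Reached Q
    settle (inj₁ Xs) (inj₁ Xt)       = finish (lowSeg sQ) Xs Xt (same-sums λ _ → refl)
    settle (inj₁ Xs) (inj₂ (y , V))  = one sQ (same-sums λ _ → refl) Xs Ft V
    settle (inj₂ (y , V)) (inj₁ Xt)  = one (rev Eᵢ-sym sQ) (rev-≈ Q) Xt Fs V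
    settle (inj₂ (y , V)) (inj₂ (y′ , V′)) = two V V′

  unC : Uniq C
  unC = un ext

  v∉C : v ∉ C
  v∉C = proj₁ isoᵥ

  unCv : Uniq (C ++ v ∷ [])
  unCv = ≈-Uniq (swap-≈ (v ∷ []) C) (Uniq-∷ v∉C unC)

  not-spanning : ∀ {Q} → Q ≈ C → Reached Q → ⊥
  not-spanning e (Q′ , s , t , sQ , vs , vt , e′) with no-longer (v ∷ []) [] (close (vs ∷ sQ) (E-sym vt))
      (λ f → lem (f v) (S f Q′) ∙ cong (_+ (f v + 0)) (sums e′ f ∙ sums e f)) unCv
    where
    lem : ∀ v q → v + q + 0 ≡ q + (v + 0)
    lem = solve-∀
  ... | ()

  -- If the cycle reads b c...p y q...d, the edge from `b` to `y` gives the spanning walk c...p y b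
  -- d...q with both ends in X i; after `hop` it closes up through `v`.
  Y-independent : ∀ i → (∀ j → j ≤ i → NC j) → ∀ {b y} → Y i b → Y i y → E b y → ⊥
  Y-independent i nc {b} {y} Yb Yy by with around (proj₁ Yb)
  ... | cs , c , d , s , bc , db , e with ≈-∈ (≈-sym e) (proj₁ Yy)
  ...   | here refl = E-irr by
  ...   | there m with ∈-∃++ m
  ...     | F₁ , F₂ , refl = split F₁ F₂ s e bc db
    where
    D : ∀ {u} → X i u → Y i u → ⊥
    D = disjoint i (nc i ≤-refl)
    free : ∀ {u w} → Y i u → Y i w → E u w → Free i u
    free Yu Yw uw ℓ h Yℓ = D (X-mono h (inj₂ (_ , Yℓ , uw))) Yw
    split : ∀ F₁ F₂ → Seg EO c d (F₁ ++ y ∷ F₂) → (b ∷ F₁ ++ y ∷ F₂) ≈ C → EO b c → EO d b → ⊥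
    split [] F₂ s e bc db with head-eq s
    ... | refl = D (proj₂ Yb y (proj₂ bc)) Yy
    split (z ∷ F₁) [] s e bc db with last-eq (z ∷ F₁) s
    ... | refl = D (proj₂ Yb y (On-sym (proj₂ db))) Yy
    split (z ∷ F₁) (q ∷ F₂) s e bc db with cut z F₁ y (q ∷ F₂) s
    ... | p , s₁ , py , s₂ = not-spanning (≈-trans (same-sums eqv) e)
        (hop i (λ j h → nc j (<⇒≤ h)) (join (mapSeg EO⇒Eᵢ s₁) (EO⇒Eᵢ py)
            (join [ y ] (free-edge (E-sym by) (free Yy Yb (E-sym by)) (free Yb Yy by))
            (EO⇒Eᵢ (EO-sym db) ∷ rev Eᵢ-sym (mapSeg EO⇒Eᵢ (suffix (y ∷ []) s₂)))))
          Xc Xq (λ ℓ h Yc → D Xc (Y-mono (<⇒≤ h) Yc)) (λ ℓ h Yq → D Xq (Y-mono (<⇒≤ h) Yq))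
              (λ ℓ h Yu → ≈-∈ (≈-sym (≈-trans (same-sums eqv) e)) (proj₁ Yu)))
      where
      Xc : X i c
      Xc = proj₂ Yb c (proj₂ bc)
      Xq : X i q
      Xq = proj₂ Yy q (proj₂ (edge [] s₂))
      eqv : ∀ f → S f ((z ∷ F₁) ++ y ∷ b ∷ reverse (q ∷ F₂)) ≡ S f (b ∷ (z ∷ F₁) ++ y ∷ q ∷ F₂)
      eqv f = S-++ f (z ∷ F₁) (y ∷ b ∷ reverse (q ∷ F₂)) ∙ cong (λ n → S f (z ∷ F₁) + (f y + (f b + n))) (S-rev f (q ∷ F₂)) ∙ lem
          (S f (z ∷ F₁)) (f y) (f b) (S f (q ∷ F₂)) ∙ cong (f b +_) (sym (S-++ f (z ∷ F₁) (y ∷ q ∷ F₂)))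
        where
        lem : ∀ z y b q → z + (y + (b + q)) ≡ b + (z + (y + q))
        lem = solve-∀

  -- Cut between two consecutive vertices of X i, the cycle becomes a spanning walk to which `hop`
  -- applies.
  nc-step : ∀ i → (∀ j → j < i → NC j) → NC i
  nc-step i nc {u} {w} on Xu Xw with on-cut on
  ... | Q , s , e = not-spanning e (hop i nc (mapSeg EO⇒Eᵢ s) Xw Xu (free i nc (On-sym on) Xw Xu) (free i nc on Xu Xw)
      (λ ℓ h Yy → ≈-∈ (≈-sym e) (proj₁ Yy)))
    where
    free : ∀ i → (∀ j → j < i → NC j) → ∀ {u w} → On u w → X i u → X i w → Free i u
    free (suc i) nc on (inj₁ e) Xw ℓ h Yu = nc ℓ h on (X₀ ℓ e) (proj₂ Yu _ on)
    -- Here `u` has the neighbour `y` in Y i, so membership of `u` in Y would violate independence.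
    free (suc i) nc on (inj₂ (y , Yy , e)) Xw ℓ (s≤s h) Yu = Y-independent i (λ j h → nc j (s≤s h)) (Y-mono h Yu) Yy (E-sym e)

  ncs : ∀ i j → j < i → NC j
  ncs (suc i) j (s≤s j≤i) with m≤n⇒m<n∨m≡n j≤i
  ... | inj₁ j<i  = ncs i j j<i
  ... | inj₂ refl = nc-step j (ncs j)

  nc : ∀ i → NC i
  nc i = ncs (suc i) i ≤-refl

  -- Exchanging y for v on the cycle would leave fewer isolated vertices outside if y had a neighbour there.
  new-Y-inside : ∀ i {y u} → Y i y → Free i y → E y u → u ∈ C
  new-Y-inside i {y} {u} Yy Fy yu with u ∈? C
  ... | yes m = m
  ... | no u∉ with around (proj₁ Yy)
  ...   | cs , c , d , s , yc , dy , e with hop i (ncs i) (mapSeg EO⇒Eᵢ s) Xc Xd (free Xc) (free Xd) inside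
    where
    free : ∀ {u} → X i u → Free i u
    free Xu ℓ h Yu = disjoint i (nc i) Xu (Y-mono (<⇒≤ h) Yu)
    Xc : X i c
    Xc = proj₂ Yy c (proj₂ yc)
    Xd : X i d
    Xd = proj₂ Yy d (On-sym (proj₂ dy))
    inside : ∀ ℓ → ℓ < i → ∀ {z} → Y ℓ z → z ∈ cs
    inside ℓ h Yz with ≈-∈ (≈-sym e) (proj₁ Yz)
    ... | here refl = ⊥-elim (Fy ℓ h Yz)
    ... | there m   = m
  ...     | Q , p , q , sQ , vp , vq , e′ = ⊥-elim (n≮n _ (≤-trans fewer (miniso ext D (close (vp ∷ sQ) (E-sym vq)) uD #D)))
    where
    D : List V
    D = v ∷ Q
    Q⊆C : ∀ {w} → w ∈ Q → w ∈ C
    Q⊆C m = ≈-∈ e (there (≈-∈ e′ m))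
    uD : Uniq D
    uD = Uniq-∷ (λ m → v∉C (Q⊆C m)) (≈-Uniq (≈-sym e′) (Uniq-++ʳ (y ∷ []) (≈-Uniq (≈-sym e) unC)))
    #D : # D ≡ # C
    #D = cong suc (sums e′ (λ _ → 1)) ∙ sums e (λ _ → 1)
    y≁v : ¬ E y v
    y≁v yv = disjoint i (nc i) (X₀ i (E-sym yv)) Yy
    shrink : ∀ {w} → Iso D w → Iso C w
    shrink {w} (w∉ , h) = w∉C , nbr
      where
      w∉C : w ∉ C
      w∉C m with ≈-∈ (≈-sym e) m
      ... | there m′ = w∉ (there (≈-∈ (≈-sym e′) m′))
      ... | here refl with h u yu
      ...   | here refl = y≁v yu
      ...   | there m′  = u∉ (Q⊆C m′)
      nbr : ∀ x → E w x → x ∈ C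
      nbr x wx with h x wx
      ... | here refl = ⊥-elim (w∉C (proj₂ isoᵥ w (E-sym wx)))
      ... | there m′  = Q⊆C m′
    fewer : iso D < iso C
    fewer = S-mono-< allV (λ w → ind-mono (Iso? D w) (Iso? C w) shrink) (∈-allFin v)
      (≤-reflexive (cong suc (ind-no (Iso? D v) (λ iv → proj₁ iv (here refl))) ∙ sym (ind-yes (Iso? C v) isoᵥ)))

  Y-inside : ∀ i {y u} → Y i y → E y u → u ∈ C
  Y-inside zero Yy yu = new-Y-inside zero Yy (λ _ ()) yu
  Y-inside (suc i) {y} Yy yu with Y? i y
  ... | yes Yi = Y-inside i Yi yu
  ... | no ¬Yi = new-Y-inside (suc i) Yy (λ { ℓ (s≤s h) Yℓ → ¬Yi (Y-mono h Yℓ) }) yu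

  X-inside : ∀ i {u} → X i u → u ∈ C
  X-inside zero    e                   = proj₂ isoᵥ _ e
  X-inside (suc i) (inj₁ e)            = proj₂ isoᵥ _ e
  X-inside (suc i) (inj₂ (y , Yy , e)) = Y-inside i Yy e

  -- As long as the closure grows it gains a vertex per step, which cannot go on for N + 1 steps.
  stable : ∃ λ i → ∀ {u} → X (suc i) u → X i u
  stable with grow (suc N)
    where
    sizeX : ℕ → ℕ
    sizeX i = S (λ u → ind (X? i u)) allV
    grow : ∀ m → (∃ λ i → ∀ {u} → X (suc i) u → X i u) ⊎ m ≤ sizeX m
    grow zero = inj₂ z≤n
    grow (suc m) with grow m
    ... | inj₁ r = inj₁ r
    ... | inj₂ h with any? (λ u → X? (suc m) u ×-dec ¬? (X? m u))
    ...   | yes (u , Xu , ¬Xu) = inj₂ (≤-trans (s≤s h) (S-mono-< allV (λ w → ind-mono (X? m w) (X? (suc m) w) (X-suc m)) (∈-allFin u)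
              (≤-reflexive (cong suc (ind-no (X? m u) ¬Xu) ∙ sym (ind-yes (X? (suc m) u) Xu)))))
    ...   | no none = inj₁ (m , λ {u} Xu → decide u Xu)
      where
      decide : ∀ u → X (suc m) u → X m u
      decide u Xu with X? m u
      ... | yes h = h
      ... | no ¬h = ⊥-elim (none (u , Xu , ¬h))
  ... | inj₁ r = r
  ... | inj₂ h = ⊥-elim (n≮n N (≤-trans h (≤-trans (S-≤# allV (λ u → b2n≤1 (does (X? (suc N) u)))) (≤-reflexive (#-allFin N)))))

  level : ℕ
  level = proj₁ stable

  R : V → V → Set
  R u w = E u w × (Y level u → On u w) × (Y level w → On u w)

  R⇒Eᵢ : ∀ {u w} → R u w → Eᵢ level u w
  R⇒Eᵢ (e , f , g) = e , (λ ℓ h Yu → proj₂ Yu _ (f (Y-mono (<⇒≤ h) Yu))) , λ ℓ h Yw → proj₂ Yw _ (On-sym (g (Y-mono (<⇒≤ h) Yw)))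

  abstract
    frame : Counting.Frame Γ P (v ∷ []) 1
    frame = record
      { X = X level ; Y = Y level ; X? = X? level
      ; Xw₀ = X₀ level (E-sym (univ v (λ { refl → v∉C (here refl) })))
      ; R = R ; R-sym = λ (e , f , g) → E-sym e , (λ y → On-sym (g y)) , λ y → On-sym (f y)
      ; R⇒E = proj₁
      ; mkR = λ e ¬u ¬w → e , (λ y → ⊥-elim (¬u y)) , λ y → ⊥-elim (¬w y)
      ; Rcyc = mapSeg (λ (e , o) → e , (λ _ → o) , λ _ → o) onCyc
      ; nc = nc level ; X⊆C = X-inside level ; Y⊆C = proj₁ ; Ynb = λ on Yu → proj₂ Yu _ on
      ; 1≤p = ≤-refl ; #U = refl ; unCU = unCv
      ; link = link
      -- Stability enters here: the vertex of a one-vertex gap is in Y, so its neighbours are in the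
      -- next X, hence in X.
      ; single = λ y∈ h → ≤-refl , λ u yu → proj₂ stable (inj₂ (_ , (there y∈ , λ c o → h c (On-sym o)) , yu))
      ; noU = λ { (here refl) Xx on vw → nc level on Xx (X₀ level vw) } }
      where
      link : ∀ {s t Q} → Seg R s t Q → X level s → X level t → ∀ es lost → (∀ f → S f Q + S f lost ≡ S f C + S f es) →
        Uniq ((C ++ v ∷ []) ++ es) → (∀ {y} → y ∈ lost → ¬ Y level y) → 1 + # es ≤ # lost
      link {s} {t} {Q} sQ Xs Xt es lost sm u ¬Y with hop level (ncs level) (mapSeg R⇒Eᵢ sQ) Xs Xt (free Xs) (free Xt) inside
        where
        free : ∀ {u} → X level u → Free level u
        free Xu ℓ h Yu = disjoint level (nc level) Xu (Y-mono (<⇒≤ h) Yu)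
        inside : ∀ ℓ → ℓ < level → ∀ {y} → Y ℓ y → y ∈ Q
        inside ℓ h {y} Yy = cnt⇒∈ Q (≤-trans (≤-trans (∈⇒cnt (proj₁ Yy)) (m≤m+n (cnt y C) (cnt y es)))
          (≤-reflexive (sym (sm (δ y)) ∙ cong (cnt y Q +_) (∉⇒cnt lost (λ m → ¬Y m (Y-mono (<⇒≤ h) Yy))) ∙ +-identityʳ _)))
      ... | Q′ , p , q , sQ′ , vp , vq , e = no-longer (v ∷ es) lost (close (vp ∷ sQ′) (E-sym vq))
            (λ f → cong (λ n → f v + n + S f lost) (sums e f) ∙ lem (f v) (S f Q) (S f lost) ∙ cong (f v +_) (sm f) ∙ lem₂ (f v) (S f C) (S f es))
            (subst Uniq (++-assoc C (v ∷ []) es) u)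
        where
        lem : ∀ v q l → v + q + l ≡ v + (q + l)
        lem = solve-∀
        lem₂ : ∀ v c e → v + (c + e) ≡ c + (v + e)
        lem₂ = solve-∀

    v⇒X : ∀ {u} → E v u → Counting.Frame.X frame u
    v⇒X e = X₀ level e

private
  -- The order and k ≤ x give M + r ≤ k + 1. Each vertex counted by r lowers M and adds at most 2 to
  -- ρ, which for k ≥ 3 is not enough; with no such vertex the values of x and M are forced. For t =
  -- 0 the vanishing of ρ is used as well.
  tight-arith : ∀ k x t M r SF ρ → 3 ≤ k → k ≤ x → k * (suc x + t) + k ≤ k * x + SF + ρ → SF ≤ t * M + M →
    suc x + (M + suc x) + 1 + r ≤ 3 * k + 4 → ρ ≤ 2 * r → (t ≡ 0 → ρ ≡ 0) → x ≡ k × M ≡ suc k × ρ ≡ 0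
  tight-arith k x t M r SF ρ 3≤k k≤x h₁ h₂ h₃ h₄ h₅ = main r refl
    where
    M+r : M + r ≤ suc k
    M+r = linear (M + r) (suc k) 0 (+-mono-≤ h₃ (+-mono-≤ k≤x k≤x)) (lem M r k x)
      where
      lem : ∀ M r k x → M + r + (3 * k + 4 + (x + x)) + 0 ≡ suc k + (suc x + (M + suc x) + 1 + r + (k + k))
      lem = solve-∀
    h₆ : k * (t + 2) ≤ t * M + M + ρ
    h₆ = linear (k * (t + 2)) (t * M + M + ρ) 0 (+-mono-≤ h₁ h₂) (lem k t x M ρ SF)
      where
      lem : ∀ k t x M ρ SF → k * (t + 2) + (k * x + SF + ρ + (t * M + M)) + 0 ≡ t * M + M + ρ + (k * (suc x + t) + k + SF)
      lem = solve-∀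
    main : ∀ r′ → r ≡ r′ → x ≡ k × M ≡ suc k × ρ ≡ 0
    main zero refl = ≤-antisym x≤k k≤x , ≤-antisym M≤ M≥ , ρ0
      where
      ρ0 : ρ ≡ 0
      ρ0 = ≤-antisym h₄ z≤n
      M≤ : M ≤ suc k
      M≤ = subst (_≤ suc k) (+-identityʳ M) M+r
      M≥ : suc k ≤ M
      M≥ = ≰⇒> λ M≤k → impossible (k ∸ 1) (+-mono-≤ h₆ (*-monoʳ-≤ (suc t) M≤k))
        (lem k t M ∙ cong₂ (λ n j → t * M + M + n + suc t * k + j) (sym ρ0) (sym (+-comm 1 (k ∸ 1) ∙ m∸n+n≡m (≤-trans (s≤s z≤n) 3≤k))))
        where
        lem : ∀ k t M → k * (t + 2) + suc t * M ≡ t * M + M + 0 + suc t * k + k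
        lem = solve-∀
      x≤k : x ≤ k
      x≤k = ≮⇒≥ λ k<x → impossible 1 (+-mono-≤ h₃ (+-mono-≤ M≥ (+-mono-≤ k<x k<x))) (lem k x M)
        where
        lem : ∀ k x M → suc x + (M + suc x) + 1 + 0 + (suc k + (suc k + suc k)) ≡ 3 * k + 4 + (M + (x + x)) + suc 1
        lem = solve-∀
    main (suc r′) refl = ⊥-elim (by-t t refl)
      where
      M≤k : M ≤ k
      M≤k = linear M k r′ M+r (lem M k r′)
        where
        lem : ∀ M k r → M + suc k + r ≡ k + (M + suc r)
        lem = solve-∀
      by-t : ∀ t′ → t ≡ t′ → ⊥
      by-t zero refl = impossible 2 (+-mono-≤ (+-mono-≤ h₆ M≤k) 3≤k) (lem k M ∙ cong (λ n → M + n + k + k + 3) (sym (h₅ refl)))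
        where
        lem : ∀ k M → k * 2 + M + 3 ≡ M + 0 + k + k + 3
        lem = solve-∀
      by-t (suc t′) refl = impossible 0 (+-mono-≤ (+-mono-≤ h₆ h₄) (+-mono-≤ (+-mono-≤ M+r M+r) (+-mono-≤ 3≤k (*-monoʳ-≤ t′ M≤k)))) (lem k t′ M r′ ρ)
        where
        lem : ∀ k t M r ρ → k * (suc t + 2) + ρ + (M + suc r + (M + suc r) + (3 + t * M)) ≡ suc t * M + M + ρ + 2 * suc r +
            (suc k + suc k + (k + t * k)) + suc 0
        lem = solve-∀

-- Equality in the count

module Tight (Γ : Ctx) (P : List (Fin (Ctx.N Γ))) (ext : Extremal.Ext Γ (Ctx.w₀ Γ ∷ P))
             (v : Fin (Ctx.N Γ)) (isoᵥ : Extremal.Iso Γ (Ctx.w₀ Γ ∷ P) v) where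
  open Extremal Γ
  open CaseB Γ P ext using (3≤k) public
  open Hopping Γ P ext v isoᵥ using (frame; v∉C; v⇒X) public
  open Inequality Γ frame public

  bound : Blk → ℕ
  bound b = isBig (proj₂ b) * excess + (size b ∸ 1)

  F≤bound : ∀ {b} → b ∈ bs → Fb b ≤ bound b
  F≤bound {x , sg y}     b∈ = ≤-reflexive (single-F b∈)
  F≤bound {x , bg l m r} b∈ = linear (Fb b) (bound b) 0 (F-bound b∈) (lem (Fb b) excess (# (m ++ r ∷ [])))
    where
    b : Blk
    b = x , bg l m r
    lem : ∀ f e n → f + (e + suc n + 1) + 0 ≡ e + 0 + n + (f + 2)
    lem = solve-∀

  S-bound : S bound bs ≡ t * excess + excess
  S-bound = S-+ (λ b → isBig (proj₂ b) * excess) (λ b → size b ∸ 1) bs ∙ cong (_+ excess)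
      (S-cong bs (λ b _ → *-comm (isBig (proj₂ b)) excess) ∙ S-* excess (λ b → isBig (proj₂ b)) bs ∙ *-comm excess t)

  private
    v≢w₀ : v ≢ w₀
    v≢w₀ refl = v∉C (here refl)

    dg-v : dg v X⁻ ≡ k
    dg-v = sym (deg-split v v≢w₀ ∙ cong₂ (λ m n → m + n)
        (cong₂ (λ m n → dg v X⁻ + m + n) (dg-none GL (λ m e → GL-¬X m (v⇒X e))) (dg-none (v ∷ []) λ { (here refl) e → E-irr e }))
        (dg-none R′ (λ m e → ∈-others⁻ m (∈-++⁺ˡ (X⊆C (v⇒X e))))) ∙ lem (dg v X⁻))
      where
      lem : ∀ n → n + 0 + 0 + 0 ≡ n
      lem = solve-∀

    S-size : S size bs ≡ excess + suc (# X⁻)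
    S-size = S-cong bs (λ b b∈ → sym (m∸n+n≡m (size≥p b∈))) ∙ S-+ (λ b → size b ∸ 1) (λ _ → 1) bs ∙ cong (excess +_) #bs

    facts : # X⁻ ≡ k × excess ≡ suc k × ρ ≡ 0
    facts = tight-arith k (# X⁻) t excess (# R′) (S Fb bs) ρ 3≤k
      (subst (_≤ # X⁻) dg-v (dg≤# v X⁻))
      (subst₂ (λ m n → k * m + n ≤ k * # X⁻ + S Fb bs + ρ) (#EL ∙ cong (_+ t) #bs) (+-identityʳ _ ∙ dg-v) count)
      (≤-trans (S-mono bs (λ b b∈ → F≤bound b∈)) (≤-reflexive S-bound))
      (≤-trans (≤-reflexive (cong (λ n → n + 1 + # R′) (sym (#C ∙ cong (suc (# X⁻) +_) S-size)) ∙ #total)) small)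
      ρ≤ ρ≡0

  #X⁻≡k : # X⁻ ≡ k
  #X⁻≡k = proj₁ facts

  excess≡ : excess ≡ suc k
  excess≡ = proj₁ (proj₂ facts)

  -- Against the upper bound (t + 1)(k + 1) coming from `S-bound` this leaves the slack t + 1 - k.
  F-total : k * (t + 2) ≤ S Fb bs
  F-total = linear (k * (t + 2)) (S Fb bs) 0
    (subst₂ (λ m n → k * m + n ≤ k * # X⁻ + S Fb bs + ρ) (#EL ∙ cong (_+ t) #bs) (+-identityʳ _ ∙ dg-v) count)
    (cong (λ n → k * (t + 2) + (k * # X⁻ + S Fb bs + n) + 0) (proj₂ (proj₂ facts)) ∙ lem k t (# X⁻) (S Fb bs))
    where
    lem : ∀ k t x f → k * (t + 2) + (k * x + f + 0) + 0 ≡ f + (k * (suc x + t) + k)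
    lem = solve-∀

  X-heads : ∀ {u} → X u → u ∈ w₀ ∷ X⁻
  X-heads {u} Xu = cnt⇒∈ (w₀ ∷ X⁻) (≤-trans (∈⇒cnt (X⊆C Xu))
      (≤-reflexive (SC (δ u) ∙ cong (cnt u (w₀ ∷ X⁻) +_) (∉⇒cnt GL (λ m → GL-¬X m Xu)) ∙ +-identityʳ _)))

  -- Apart from `w₀`, X has k vertices and `v` has k neighbours in X, so the closure has added
  -- nothing.
  X⇒v : ∀ {u} → X u → E v u
  X⇒v Xu with X-heads Xu
  ... | here refl = E-sym (univ v v≢w₀)
  ... | there m   = dg-full X⁻ (≤-reflexive (#X⁻≡k ∙ sym dg-v)) m

  -- The closure property phrased by neighbours of `v` instead of X, so that it can be used on
  -- rotated cycles.
  closure : ∀ {d} → d ∈ P → (∀ c → On c d → E v c) → ∀ {u} → E d u → E v u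
  closure d∈ h du = X⇒v (proj₂ (single d∈ (λ c o → v⇒X (h c o))) _ du)

  -- Besides `w₀` the vertex `y` has k neighbours, all in X, and X has just k vertices other than
  -- `w₀`.
  single-all : ∀ {x y} → (x , sg y) ∈ bs → ∀ {u} → X u → E y u
  single-all {x} {y} b∈ Xu with X-heads Xu
  ... | here refl = E-sym (univ y (end≢w₀ b∈ (here refl)))
  ... | there m   = dg-full X⁻ (≤-reflexive (#X⁻≡k ∙ deg-end b∈ (here refl) ∙ cong₂ (λ m n → dg y X⁻ + m + n) (single-dg b∈ GL GL-¬X)
      (single-dg b∈ R′ R′-¬X) ∙ lem (dg y X⁻))) m
    where
    R′-¬X : ∀ {u} → u ∈ R′ → ¬ X u
    R′-¬X m Xu = ∈-others⁻ m (∈-++⁺ˡ (X⊆C Xu))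
    lem : ∀ n → n + 0 + 0 ≡ n
    lem = solve-∀

  spare : ℕ
  spare = S (λ b → size b ∸ 2) bs

  -- For a one-vertex gap the truncated size - 1 and size - 2 both vanish; for a big gap they differ
  -- by 1.
  spare+t : spare + t ≡ suc k
  spare+t = sym (S-cong bs (λ b _ → each (proj₂ b)) ∙ S-+ (λ b → size b ∸ 2) (λ b → isBig (proj₂ b)) bs) ∙ excess≡
    where
    each : ∀ g → # (toL g) ∸ 1 ≡ (# (toL g) ∸ 2) + isBig g
    each (sg y) = refl
    each (bg l m r) rewrite S-++ (λ _ → 1) m (r ∷ []) = +-comm (# m) 1 ∙ +-comm 1 (# m) ∙ cong (_+ 1) (sym (lem (# m)))
      where
      lem : ∀ n → n + 1 ∸ 1 ≡ n
      lem n = m+n∸n≡m n 1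

-- Rotations around the universal vertex

module Flips (Γ : Ctx) (P : List (Fin (Ctx.N Γ))) (ext : Extremal.Ext Γ (Ctx.w₀ Γ ∷ P)) where
  open Extremal Γ
  open OnCycle Γ P ext

  flip-tail-≈ : ∀ A B → P ≡ A ++ B → C ≈ (w₀ ∷ A ++ reverse B)
  flip-tail-≈ A B eP = same-sums λ f → cong (f w₀ +_) (cong (S f) eP ∙ S-++ f A B ∙ cong (S f A +_) (sym (S-rev f B)) ∙ sym (S-++ f A (reverse B)))

  -- A Pósa rotation: the chord from `c` to `d` allows `B` to be traversed backwards, and the first
  -- vertex of `B` closes the cycle at `w₀`.
  flip-tail : ∀ A A′ B B′ {c d} → P ≡ A ++ B → w₀ ∷ A ≡ A′ ++ c ∷ [] → B ≡ B′ ++ d ∷ [] → E c d → Ext (w₀ ∷ A ++ reverse B)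
  flip-tail A A′ [] [] _ _ () _
  flip-tail A A′ [] (_ ∷ _) _ _ () _
  flip-tail A A′ (b ∷ B) B′ {c} {d} eP eA eB cd with segC
  ... | z , s , _ with cut w₀ A b B (subst (λ zs → Seg E w₀ z (w₀ ∷ zs)) eP s)
  ...   | c′ , sA , _ , sB with last-eq A′ (subst (Seg E w₀ c′) eA sA) | last-eq B′ (subst (Seg E b z) eB sB)
  ...     | refl | refl = Ext-≈ ext (flip-tail-≈ A (b ∷ B) eP)
      (close (join sA cd (rev E-sym sB)) (E-sym (univ b (P≢w₀ (subst (b ∈_) (sym eP) (∈-++⁺ʳ A (here refl)))))))

  flip-head-≈ : ∀ A B → P ≡ A ++ B → C ≈ (w₀ ∷ reverse B ++ A)
  flip-head-≈ A B eP = same-sums λ f → cong (f w₀ +_)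
      (cong (S f) eP ∙ S-++ f A B ∙ +-comm (S f A) (S f B) ∙ cong (_+ S f A) (sym (S-rev f B)) ∙ sym (S-++ f (reverse B) A))

  -- The mirror image: the tail is run backwards from `w₀` to `b`, the chord leads to `h`, and the
  -- last vertex of the old head closes the cycle.
  flip-head : ∀ {h A b B} → P ≡ (h ∷ A) ++ b ∷ B → E b h → Ext (w₀ ∷ reverse (b ∷ B) ++ h ∷ A)
  flip-head {h} {A} {b} {B} eP bh with segC
  ... | z , s , zw with cut h A b B (suffix (w₀ ∷ []) (subst (λ zs → Seg E w₀ z (w₀ ∷ zs)) eP s))
  ...   | c , sA , _ , sB = Ext-≈ ext (flip-head-≈ (h ∷ A) (b ∷ B) eP)
      (close (E-sym zw ∷ join (rev E-sym sB) bh sA) (E-sym (univ c (P≢w₀ (subst (c ∈_) (sym eP) (∈-++⁺ˡ (proj₂ (Seg-ends sA))))))))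

module EndVertex (Γ : Ctx) (P : List (Fin (Ctx.N Γ))) (ext : Extremal.Ext Γ (Ctx.w₀ Γ ∷ P))
                 (v : Fin (Ctx.N Γ)) (isoᵥ : Extremal.Iso Γ (Ctx.w₀ Γ ∷ P) v) where
  open Extremal Γ
  open OnCycle Γ P ext using (C; On; P≢w₀)

  -- The cycle neighbours of the last vertex are `e` and `w₀`, both adjacent to `v`.
  end-closed : ∀ Z {e d} → C ≡ Z ++ e ∷ d ∷ [] → E v e → ∀ {u} → E d u → E v u
  end-closed Z {e} {d} eq ve = Tight.closure Γ P ext v isoᵥ d∈P nbr
    where
    uC : Uniq (Z ++ e ∷ d ∷ [])
    uC = subst Uniq eq (un ext)
    uC′ : Uniq ((Z ++ e ∷ []) ++ d ∷ [])
    uC′ = subst Uniq (sym (++-assoc Z (e ∷ []) (d ∷ []))) uC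
    d∉Ze : d ∉ Z ++ e ∷ []
    d∉Ze m = Uniq-disj (Z ++ e ∷ []) uC′ m (here refl)
    d∈P : d ∈ P
    d∈P = go Z eq
      where
      go : ∀ Z → w₀ ∷ P ≡ Z ++ e ∷ d ∷ [] → d ∈ P
      go []      q = subst (d ∈_) (sym (∷-injectiveʳ q)) (here refl)
      go (_ ∷ Z) q = subst (d ∈_) (sym (∷-injectiveʳ q)) (∈-++⁺ʳ Z (there (here refl)))
    d∉w : d ∉ w₀ ∷ []
    d∉w (here q) = P≢w₀ d∈P q
    closed : C ++ w₀ ∷ [] ≡ Z ++ e ∷ d ∷ w₀ ∷ []
    closed = cong (_++ w₀ ∷ []) eq ∙ ++-assoc Z (e ∷ d ∷ []) (w₀ ∷ [])
    vw₀ : E v w₀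
    vw₀ = E-sym (univ v (λ { refl → proj₁ isoᵥ (here refl) }))
    nbr : ∀ c → On c d → E v c
    nbr c (inj₂ n) = subst (E v) (sym (Nx-succ (Z ++ e ∷ []) d∉Ze d∉w
        (subst (λ zs → Nx zs d c) (closed ∙ sym (++-assoc Z (e ∷ []) (d ∷ w₀ ∷ []))) n))) vw₀
    nbr c (inj₁ n) = subst (E v) (sym (Nx-pred Z (λ m → d∉Ze (∈-++⁺ˡ m)) (λ { refl → d∉Ze (∈-++⁺ʳ Z (here refl)) }) d∉w
        (subst (λ zs → Nx zs c d) closed n))) ve

-- As s + t = k + 1, the slack is 2 - s. The sharper bound on the last gap saves 2 - A, hence s ≤ A.
last-arith : ∀ k t z F SFα B A s → k * (t + 2) ≤ F + SFα → SFα ≤ B → F + 2 ≤ k + suc z + A → t * suc k + suc k ≡ 1 * suc k + z + B → s + t ≡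
    suc k → s ≤ A
last-arith k t z F SFα B A s h₁ h₂ h₃ h₄ h₅ =
  linear s A 0 (+-mono-≤ (+-mono-≤ h₁ h₂) (+-mono-≤ h₃ (+-mono-≤ (≤-reflexive (sym h₄)) (≤-reflexive h₅)))) (lem k t z F SFα B A s)
  where
  lem : ∀ k t z F SFα B A s → s + (F + SFα + B + (k + suc z + A + (t * suc k + suc k + suc k))) + 0 ≡ A +
      (k * (t + 2) + SFα + (F + 2 + (1 * suc k + z + B + (s + t))))
  lem = solve-∀

-- For t = k + 1 the slack is 2, but the first and the last gap save 2 each.
both-arith : ∀ k t z z₀ F F₀ SFα B → k * (t + 2) ≤ F + (F₀ + SFα) → SFα ≤ B → F + 2 ≤ k + suc z → F₀ + 2 ≤ k + suc z₀ →
  t * suc k + suc k ≡ 1 * suc k + z + (1 * suc k + z₀ + B) → t ≡ suc k → ⊥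
both-arith k t z z₀ F F₀ SFα B h₁ h₂ h₃ h₄ h₅ h₆ =
  impossible 1 (+-mono-≤ (+-mono-≤ h₁ h₂) (+-mono-≤ h₃ (+-mono-≤ h₄ (+-mono-≤ (≤-reflexive (sym h₅)) (≤-reflexive h₆))))) (lem k t z z₀ F F₀ SFα B)
  where
  lem : ∀ k t z z₀ F F₀ SFα B → k * (t + 2) + SFα + (F + 2 + (F₀ + 2 + (1 * suc k + z + (1 * suc k + z₀ + B) + t)))
    ≡ F + (F₀ + SFα) + B + (k + suc z + (k + suc z₀ + (t * suc k + suc k + suc k))) + suc 1
  lem = solve-∀

-- Big gaps on both sides of the universal vertex

module LastBig (Γ : Ctx) (P : List (Fin (Ctx.N Γ))) (ext : Extremal.Ext Γ (Ctx.w₀ Γ ∷ P))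
               (v : Fin (Ctx.N Γ)) (isoᵥ : Extremal.Iso Γ (Ctx.w₀ Γ ∷ P) v) where
  open Extremal Γ
  open OnCycle Γ P ext using (segC; no-longer)
  open Tight Γ P ext v isoᵥ
  open Flips Γ P ext

  after-flip : ∀ {A B A′ B′ c d} → P ≡ A ++ B → w₀ ∷ A ≡ A′ ++ c ∷ [] → B ≡ B′ ++ d ∷ [] → E c d →
    ∀ Z {e f} → w₀ ∷ A ++ reverse B ≡ Z ++ e ∷ f ∷ [] → E v e → ∀ {u} → E f u → E v u
  after-flip {A} {B} {A′} {B′} eP eA eB cd = EndVertex.end-closed Γ (A ++ reverse B) (flip-tail A A′ B B′ eP eA eB cd) v
      (Iso-≈ (flip-tail-≈ A B eP) isoᵥ)

  from-w₀ : ∀ (γ : List Blk) x ys B → C ≡ (flat γ ++ x ∷ ys) ++ B → ∃ λ A → flat γ ++ x ∷ ys ≡ w₀ ∷ A × P ≡ A ++ B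
  from-w₀ γ x ys B eq with flat-head γ x ys
  ... | h , A , e , _ with eq ∙ cong (_++ B) e
  ...   | e′ with ∷-injectiveˡ e′
  ...     | refl = A , e , ∷-injectiveʳ e′

  end-F : ∀ {y g w} → (y , g) ∈ bs → w ∈ ends g → ∀ {z} → z ∈ X⁻ → E w z → dg w GL + 1 ≤ k
  end-F {w = w} c∈ w∈ z∈ wz = ≤-trans (≤-trans (≤-trans (≤-reflexive (+-comm (dg w GL) 1)) (+-monoˡ-≤ (dg w GL) (dg-∈ wz z∈)))
      (m≤m+n _ (dg w R′))) (≤-reflexive (sym (deg-end c∈ w∈)))

  module AtLast (α : List Blk) {x l r : V} {m : List V} (eq : bs ≡ α ++ (x , bg l m r) ∷ []) where

    b : Blk
    b = x , bg l m r
    Q : List V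
    Q = toL (bg l m r)
    b∈ : b ∈ bs
    b∈ = subst (b ∈_) (sym eq) (∈-mid α)
    α⊆ : ∀ {c} → c ∈ α → c ∈ bs
    α⊆ {c} c∈ = subst (c ∈_) (sym eq) (∈-++⁺ˡ c∈)

    module _ (γ₁ : List Blk) {xi li ri : V} {mi : List V} {γ₂ : List Blk} (eα : α ≡ γ₁ ++ (xi , bg li mi ri) ∷ γ₂) where

      private
        Qi tail : List V
        Qi = toL (bg li mi ri)
        tail = flat γ₂ ++ x ∷ Q
        bi∈ : (xi , bg li mi ri) ∈ bs
        bi∈ = α⊆ (subst ((xi , bg li mi ri) ∈_) (sym eα) (∈-mid γ₁))
        C≡ : C ≡ flat γ₁ ++ xi ∷ Qi ++ tail
        C≡ = sym flat≡ ∙ cong flat (eq ∙ cong (_++ b ∷ []) eα ∙ ++-assoc γ₁ ((xi , bg li mi ri) ∷ γ₂) (b ∷ [])) ∙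
          flat-++ γ₁ ((xi , bg li mi ri) ∷ γ₂ ++ b ∷ []) ∙ cong (λ zs → flat γ₁ ++ xi ∷ Qi ++ zs)
              (flat-++ γ₂ (b ∷ []) ∙ cong (λ zs → flat γ₂ ++ x ∷ zs) (++-identityʳ Q))
        Xx : X x
        Xx = proj₁ (ok b∈)
        Xxi : X xi
        Xxi = proj₁ (ok bi∈)

      -- Insert v: l … r li … ri … x v xi … w₀.
      r≁li : ¬ E r li
      r≁li rl with segC
      ... | z , s , zw with no-longer (v ∷ []) [] (close (join qk rl
          (join mid (E-sym (X⇒v Xx)) (join [ v ] (X⇒v Xxi) (rev E-sym (prefix (flat γ₁) s′))))) (univ l (end≢w₀ b∈ (here refl)))) sm unv
        where
        s′ : Seg E w₀ z (flat γ₁ ++ xi ∷ Qi ++ tail)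
        s′ = subst (Seg E w₀ z) C≡ s
        s″ : Seg E li z (Qi ++ flat γ₂ ++ x ∷ Q)
        s″ = suffix (flat γ₁ ++ xi ∷ []) (subst (Seg E w₀ z) (sym (++-assoc (flat γ₁) (xi ∷ []) (Qi ++ tail))) s′)
        mid : Seg E li x ((Qi ++ flat γ₂) ++ x ∷ [])
        mid = prefix (Qi ++ flat γ₂) (subst (Seg E li z) (sym (++-assoc Qi (flat γ₂) (x ∷ Q))) s″)
        zr : z ≡ r
        zr = last-eq ((Qi ++ flat γ₂) ++ x ∷ l ∷ m) (subst (Seg E li z)
            (sym (++-assoc Qi (flat γ₂) (x ∷ Q)) ∙ sym (++-assoc (Qi ++ flat γ₂) (x ∷ l ∷ m) (r ∷ []))) s″)
        qk : Seg E l r Q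
        qk = subst (λ y → Seg E l y Q) zr (suffix ((Qi ++ flat γ₂) ++ x ∷ [])
            (subst (Seg E li z) (sym (++-assoc Qi (flat γ₂) (x ∷ Q)) ∙ sym (++-assoc (Qi ++ flat γ₂) (x ∷ []) Q)) s″))
        unv : Uniq (C ++ v ∷ [])
        unv = unCU
        sm : ∀ f → S f (Q ++ ((Qi ++ flat γ₂) ++ x ∷ []) ++ v ∷ reverse (flat γ₁ ++ xi ∷ [])) + 0 ≡ S f C + (f v + 0)
        sm f = expand Q Qi (flat γ₂) (flat γ₁) ∙ cong (λ n → n + (f v + 0)) (sym (cong (S f) C≡))
          where
          expand : ∀ Q Qi H G → S f (Q ++ ((Qi ++ H) ++ x ∷ []) ++ v ∷ reverse (G ++ xi ∷ [])) + 0 ≡ S f (G ++ xi ∷ Qi ++ H ++ x ∷ Q) + (f v + 0)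
          expand Q Qi H G rewrite S-++ f Q (((Qi ++ H) ++ x ∷ []) ++ v ∷ reverse (G ++ xi ∷ [])) | S-++ f ((Qi ++ H) ++ x ∷ [])
              (v ∷ reverse (G ++ xi ∷ [])) | S-++ f (Qi ++ H) (x ∷ []) | S-++ f Qi H
            | S-rev f (G ++ xi ∷ []) | S-++ f G (xi ∷ []) | S-++ f G (xi ∷ Qi ++ H ++ x ∷ Q) | S-++ f Qi (H ++ x ∷ Q) | S-++ f H (x ∷ Q)
            = lem (S f Q) (S f Qi) (S f H) (S f G) (f x) (f xi) (f v)
            where
            lem : ∀ q i h g x y v → q + (i + h + (x + 0) + (v + (g + (y + 0)))) + 0 ≡ g + (y + (i + (h + (x + q)))) + (v + 0)
            lem = solve-∀
      ...   | ()

      -- Reversing the tail that starts at `ri` puts `ri` last, behind a vertex `h` of X. Then all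
      -- neighbours of `ri` are adjacent to `v`, yet `c` is a neighbour of `ri` inside a gap.
      r≁before : ∀ pre {c} → Qi ≡ pre ++ c ∷ ri ∷ [] → ¬ E r c
      r≁before pre {c} e rc with flat-head γ₂ x Q
      ... | h , rest , eh , h∈ with from-w₀ γ₁ xi (pre ++ c ∷ []) (ri ∷ tail) C≡′
        where
        C≡′ : C ≡ (flat γ₁ ++ xi ∷ pre ++ c ∷ []) ++ ri ∷ tail
        C≡′ = C≡ ∙ cong (λ zs → flat γ₁ ++ xi ∷ zs ++ tail) e ∙ cong (λ zs → flat γ₁ ++ xi ∷ zs)
            (++-assoc pre (c ∷ ri ∷ []) tail ∙ sym (++-assoc pre (c ∷ []) (ri ∷ tail))) ∙ sym (++-assoc (flat γ₁) (xi ∷ pre ++ c ∷ []) (ri ∷ tail))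
      ...   | A , eA , eP = proj₂ (ok bi∈) c∈ (v⇒X (after-flip {B′ = ri ∷ flat γ₂ ++ x ∷ l ∷ m} eP
          (sym eA ∙ sym (++-assoc (flat γ₁) (xi ∷ pre) (c ∷ []))) eB (E-sym rc)
                ((w₀ ∷ A) ++ reverse rest) shape (X⇒v Xh) ric))
        where
        c∈ : c ∈ Qi
        c∈ = subst (c ∈_) (sym e) (∈-mid pre)
        Xh : X h
        Xh = Xhead Xx (λ {y} m → α⊆ (subst (y ∈_) (sym eα) (∈-++⁺ʳ γ₁ (there m)))) h∈
        eB : ri ∷ tail ≡ (ri ∷ flat γ₂ ++ x ∷ l ∷ m) ++ r ∷ []
        eB = cong (ri ∷_) (sym (++-assoc (flat γ₂) (x ∷ l ∷ m) (r ∷ [])))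
        shape : w₀ ∷ A ++ reverse (ri ∷ tail) ≡ ((w₀ ∷ A) ++ reverse rest) ++ h ∷ ri ∷ []
        shape = cong ((w₀ ∷ A) ++_) (unfold-reverse ri tail ∙ cong (λ zs → reverse zs ++ ri ∷ []) eh ∙ cong (_++ ri ∷ [])
            (unfold-reverse h rest) ∙ ++-assoc (reverse rest) (h ∷ []) (ri ∷ [])) ∙
          sym (++-assoc (w₀ ∷ A) (reverse rest) (h ∷ ri ∷ []))
        ric : E ri c
        ric with segC
        ... | z , s , _ = E-sym (edge (flat γ₁ ++ xi ∷ pre)
            (subst (Seg E w₀ z) (C≡ ∙ cong (λ zs → flat γ₁ ++ xi ∷ zs ++ tail) e ∙ cong (λ zs → flat γ₁ ++ xi ∷ zs)
            (++-assoc pre (c ∷ ri ∷ []) tail) ∙ sym (++-assoc (flat γ₁) (xi ∷ pre) (c ∷ ri ∷ tail))) s))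

      -- The first vertex and the last two of the gap are excluded; in a gap of two vertices these
      -- overlap, and the truncated bound is 0.
      far-gap : dg r Qi ≤ # Qi ∸ 3
      far-gap with snoc mi
        where
        snoc : ∀ (zs : List V) → zs ≡ [] ⊎ ∃₂ λ ys c → zs ≡ ys ++ c ∷ []
        snoc [] = inj₁ refl
        snoc (z ∷ zs) with snoc zs
        ... | inj₁ refl            = inj₂ ([] , z , refl)
        ... | inj₂ (ys , c , refl) = inj₂ (z ∷ ys , c , refl)
      ... | inj₁ refl = ≤-reflexive (cong₂ _+_ (¬T⇒b2n r≁li) (cong (_+ 0) (¬T⇒b2n r≁ri)))
        where
        r≁ri : ¬ E r ri
        r≁ri e with Pair.right-far α eq γ₁ eα (li ∷ []) ri [] refl e
        ... | ()
      ... | inj₂ (ys , c , refl) = ≤-trans (≤-reflexive dg≡) (≤-trans (dg≤# r ys) (≤-reflexive (sym size≡)))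
        where
        e₀ : (ys ++ c ∷ []) ++ ri ∷ [] ≡ ys ++ c ∷ ri ∷ []
        e₀ = ++-assoc ys (c ∷ []) (ri ∷ [])
        r≁ri : ¬ E r ri
        r≁ri e with Pair.right-far α eq γ₁ eα (li ∷ ys ++ c ∷ []) ri [] refl e
        ... | ()
        dg≡ : dg r (li ∷ (ys ++ c ∷ []) ++ ri ∷ []) ≡ dg r ys
        dg≡ = cong₂ _+_ (¬T⇒b2n r≁li) (cong (dg r) e₀ ∙ S-++ (λ u → b2n (a r u)) ys (c ∷ ri ∷ [])) ∙
          cong₂ (λ p q → dg r ys + (p + (q + 0))) (¬T⇒b2n (r≁before (li ∷ ys) (cong (li ∷_) e₀))) (¬T⇒b2n r≁ri) ∙ +-identityʳ _
        size≡ : # (li ∷ (ys ++ c ∷ []) ++ ri ∷ []) ∸ 3 ≡ # ys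
        size≡ = cong (λ n → suc n ∸ 3) (cong # e₀ ∙ S-++ (λ _ → 1) ys (c ∷ ri ∷ [])) ∙ m+n∸n≡m (# ys) 2

    far-r : ∀ {c} → c ∈ α → dg r (toL (proj₂ c)) ≤ size c ∸ 3
    far-r {xi , sg y} c∈ = ≤-pred (≤-trans (+-monoˡ-≤ 1 (m≤n+m (dg r (y ∷ [])) (dg l (y ∷ [])))) (pair α eq c∈) ▷ +-comm 1 _)
      where
      _▷_ : ∀ {m n o} → m ≤ n → o ≡ m → o ≤ n
      h ▷ refl = h
    far-r {xi , bg li mi ri} c∈ with ∈-∃++ c∈
    ... | γ₁ , γ₂ , eα = far-gap γ₁ eα

    O : Opened x l m r ([] ++ α)
    O = opened α eq

    E-xl : E x l
    E-xl = R⇒E (Opened.xl O)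

    x∈X⁻ : x ∈ X⁻
    x∈X⁻ = go α eq
      where
      last∈ : ∀ α (cs : List Blk) → cs ≡ α ++ b ∷ [] → x ∈ heads cs
      last∈ []      cs e = subst (λ zs → x ∈ heads zs) (sym e) (here refl)
      last∈ (c ∷ α) cs e = subst (λ zs → x ∈ heads zs) (sym e) (there (last∈ α _ refl))
      go : ∀ α → bs ≡ α ++ b ∷ [] → x ∈ X⁻
      go [] e = ⊥-elim (n≮n 1 (≤-trans (≤-trans (s≤s (s≤s z≤n)) (s≤s 3≤k)) (≤-reflexive (sym (#bs ∙ cong suc #X⁻≡k) ∙ cong # e))))
      go (c ∷ α) e = last∈ α bs′ (∷-injectiveʳ e)

    A : ℕ
    A = S (λ c → size c ∸ 3) α

    -- `l` is adjacent to `x` in X, so it has at most k - 1 neighbours in gaps; `r` has at most size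
    -- - 1 in its own gap and the truncated size - 3 in any other.
    last-F : Fb b + 2 ≤ k + size b + A
    last-F = linear (Fb b + 2) (k + size b + A) 0
      (+-mono-≤ (end-F b∈ (here refl) x∈X⁻ (E-sym E-xl)) (+-mono-≤ (own Q (there (∈-++⁺ʳ m (here refl)))) (S-mono α (λ c c∈ → far-r c∈))))
      (cong (λ n → dg l GL + (n + 0) + 2 + (k + (size b + A)) + 0) (dg-GL r ∙ S-split (λ c → dg r (toL (proj₂ c))) α eq) ∙
        lem (dg l GL) (dg r Q) (S (λ c → dg r (toL (proj₂ c))) α) k (size b) A)
      where
      lem : ∀ d q s k z A → d + (q + s + 0) + 2 + (k + (z + A)) + 0 ≡ k + z + A + (d + 1 + (suc q + s))
      lem = solve-∀

    F-split : k * (t + 2) ≤ Fb b + S Fb α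
    F-split = ≤-trans F-total (≤-reflexive (S-split Fb α eq))

    Fα : S Fb α ≤ S bound α
    Fα = S-mono α (λ c c∈ → F≤bound (α⊆ c∈))

    bound-split : t * suc k + suc k ≡ 1 * suc k + # (m ++ r ∷ []) + S bound α
    bound-split = cong (λ e → t * e + e) (sym excess≡) ∙ sym S-bound ∙ S-split bound α eq ∙ cong (λ e → 1 * e + # (m ++ r ∷ []) + S bound α) excess≡

    spare≤ : spare ≤ A
    spare≤ = last-arith k t (# (m ++ r ∷ [])) (Fb b) (S Fb α) (S bound α) A spare F-split Fα last-F bound-split spare+t

    spare-split : spare ≡ (size b ∸ 2) + S (λ c → size c ∸ 2) α
    spare-split = S-split (λ c → size c ∸ 2) α eq

    ∸3≤∸2 : ∀ n → n ∸ 3 ≤ n ∸ 2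
    ∸3≤∸2 n = ∸-monoʳ-≤ n (n≤1+n 2)

    -- `spare` sums the truncated size - 2 over all gaps, `A` only size - 3 over all but the last;
    -- `spare≤` therefore forces every term to vanish.
    no-spare : spare ≡ 0
    no-spare with size b ∸ 2 in eb | S (λ c → size c ∸ 2) α in es
    ... | suc n | _ = ⊥-elim (n≮n A (≤-trans (s≤s (S-mono α (λ c _ → ∸3≤∸2 (size c))))
        (≤-trans (≤-trans (m≤n+m _ n) (≤-reflexive (lem n (S (λ c → size c ∸ 2) α))))
        (≤-trans (≤-reflexive (cong (_+ S (λ c → size c ∸ 2) α) (sym eb) ∙ sym spare-split)) spare≤))))
      where
      lem : ∀ n s → n + suc s ≡ suc n + s
      lem = solve-∀
    ... | zero | zero = spare-split ∙ cong₂ _+_ eb es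
    ... | zero | suc n with S-pos (λ c → size c ∸ 2) α (subst (1 ≤_) (sym es) (s≤s z≤n))
    ...   | c , c∈ , h = ⊥-elim (n≮n A (≤-trans (S-mono-< α (λ c → ∸3≤∸2 (size c)) c∈ (strict (size c) h))
        (≤-trans (m≤n+m _ (size b ∸ 2)) (≤-trans (≤-reflexive (sym spare-split)) spare≤))))
      where
      strict : ∀ n → 1 ≤ n ∸ 2 → n ∸ 3 < n ∸ 2
      strict (suc (suc (suc n))) _ = ≤-refl

    t≡ : t ≡ suc k
    t≡ = cong (_+ t) (sym no-spare) ∙ spare+t

    tiny : ∀ {c} → c ∈ bs → size c ∸ 2 ≡ 0
    tiny {c} c∈ = ≤-antisym (≤-trans (S-∈ (λ c → size c ∸ 2) c∈) (≤-reflexive no-spare)) z≤n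

    all-big : ∀ {c} → c ∈ bs → isBig (proj₂ c) ≡ 1
    all-big {y , bg _ _ _} c∈ = refl
    all-big {y , sg z}     c∈ = ⊥-elim (n≮n t (≤-trans (S-mono-< bs (λ c → le (proj₂ c)) c∈ ≤-refl) (≤-reflexive (#bs ∙ cong suc #X⁻≡k ∙ sym t≡))))
      where
      le : ∀ (g : Gap V) → isBig g ≤ 1
      le (sg _)     = z≤n
      le (bg _ _ _) = ≤-refl

    A≡0 : A ≡ 0
    A≡0 = S-0 α (λ c c∈ → ≤-antisym (≤-trans (∸3≤∸2 (size c)) (≤-reflexive (tiny (α⊆ c∈)))) z≤n)

module FirstBig (Γ : Ctx) (P : List (Fin (Ctx.N Γ))) (ext : Extremal.Ext Γ (Ctx.w₀ Γ ∷ P))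
                (v : Fin (Ctx.N Γ)) (isoᵥ : Extremal.Iso Γ (Ctx.w₀ Γ ∷ P) v) where
  open Extremal Γ
  open OnCycle Γ P ext using (segC)
  open Tight Γ P ext v isoᵥ
  open Flips Γ P ext
  open LastBig Γ P ext v isoᵥ using (module AtLast; end-F)

  module _ {l₀ r₀ : V} {m₀ : List V} (eq₀ : bs ≡ (w₀ , bg l₀ m₀ r₀) ∷ bs′)
           (tiny : ∀ {c} → c ∈ bs → size c ∸ 2 ≡ 0) (all-big : ∀ {c} → c ∈ bs → isBig (proj₂ c) ≡ 1) where

    private
      Q₀ : List V
      Q₀ = toL (bg l₀ m₀ r₀)
      b₀∈ : (w₀ , bg l₀ m₀ r₀) ∈ bs
      b₀∈ = subst ((w₀ , bg l₀ m₀ r₀) ∈_) (sym eq₀) (here refl)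

    -- Rotating by the chord from `l₀` to `ri` puts `li` last, behind `xi` in X; but `li` is
    -- adjacent to `ri`, which lies in a gap.
    l₀≁ri : ∀ γ₁ {xi li ri γ₂} → bs′ ≡ γ₁ ++ (xi , bg li [] ri) ∷ γ₂ → ¬ E l₀ ri
    l₀≁ri γ₁ {xi} {li} {ri} {γ₂} e lr = proj₂ (ok bi∈) (there (here refl)) (v⇒X
        (EndVertex.end-closed Γ (reverse (ri ∷ flat γ₂) ++ l₀ ∷ A) (flip-head P≡ (E-sym lr)) v (Iso-≈ (flip-head-≈ (l₀ ∷ A) (ri ∷ flat γ₂) P≡) isoᵥ)
          (w₀ ∷ reverse (ri ∷ flat γ₂) ++ l₀ ∷ (m₀ ++ r₀ ∷ []) ++ flat γ₁) shape (X⇒v (proj₁ (ok bi∈))) lri))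
      where
      A : List V
      A = (m₀ ++ r₀ ∷ []) ++ flat γ₁ ++ xi ∷ li ∷ []
      bi∈ : (xi , bg li [] ri) ∈ bs
      bi∈ = subst ((xi , bg li [] ri) ∈_) (sym eq₀) (there (subst ((xi , bg li [] ri) ∈_) (sym e) (∈-mid γ₁)))
      C≡ : C ≡ w₀ ∷ Q₀ ++ flat γ₁ ++ xi ∷ li ∷ ri ∷ flat γ₂
      C≡ = sym flat≡ ∙ cong flat eq₀ ∙ cong (λ zs → w₀ ∷ Q₀ ++ zs) (cong flat e ∙ flat-++ γ₁ ((xi , bg li [] ri) ∷ γ₂))
      P≡ : P ≡ (l₀ ∷ A) ++ ri ∷ flat γ₂
      P≡ = ∷-injectiveʳ C≡ ∙ cong (l₀ ∷_) (sym (++-assoc (m₀ ++ r₀ ∷ []) (flat γ₁ ++ xi ∷ li ∷ []) (ri ∷ flat γ₂) ∙ cong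
          ((m₀ ++ r₀ ∷ []) ++_) (++-assoc (flat γ₁) (xi ∷ li ∷ []) (ri ∷ flat γ₂))))
      shape : w₀ ∷ reverse (ri ∷ flat γ₂) ++ l₀ ∷ A ≡ (w₀ ∷ reverse (ri ∷ flat γ₂) ++ l₀ ∷ (m₀ ++ r₀ ∷ []) ++ flat γ₁) ++ xi ∷ li ∷ []
      shape = sym (cong (w₀ ∷_) (++-assoc (reverse (ri ∷ flat γ₂)) (l₀ ∷ (m₀ ++ r₀ ∷ []) ++ flat γ₁) (xi ∷ li ∷ []) ∙ cong
          (λ zs → reverse (ri ∷ flat γ₂) ++ l₀ ∷ zs) (++-assoc (m₀ ++ r₀ ∷ []) (flat γ₁) (xi ∷ li ∷ []))))
      lri : E li ri
      lri with segC
      ... | z , s , _ = edge (w₀ ∷ Q₀ ++ flat γ₁ ++ xi ∷ [])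
          (subst (Seg E w₀ z) (C≡ ∙ cong (w₀ ∷_) (sym (++-assoc Q₀ (flat γ₁ ++ xi ∷ []) (li ∷ ri ∷ flat γ₂) ∙ cong (Q₀ ++_)
          (++-assoc (flat γ₁) (xi ∷ []) (li ∷ ri ∷ flat γ₂))))) s)

    others-none : ∀ {c} → c ∈ bs′ → dg l₀ (toL (proj₂ c)) ≡ 0
    others-none {xi , g} c∈ = by-shape g c∈ (all-big c∈′) (tiny c∈′)
      where
      c∈′ : (xi , g) ∈ bs
      c∈′ = subst ((xi , g) ∈_) (sym eq₀) (there c∈)
      by-shape : ∀ g → (xi , g) ∈ bs′ → isBig g ≡ 1 → # (toL g) ∸ 2 ≡ 0 → dg l₀ (toL g) ≡ 0
      by-shape (bg li (c ∷ m) ri) c∈ _ h with cong (λ n → n ∸ 0) (sym (S-++ (λ _ → 1) m (ri ∷ []))) ∙ h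
      ... | h′ with +-comm 1 (# m) ∙ h′
      ...   | ()
      by-shape (bg li [] ri) c∈ _ _ with ∈-∃++ c∈
      ... | γ₁ , γ₂ , e = cong₂ _+_ (¬T⇒b2n l≁li) (cong (_+ 0) (¬T⇒b2n (l₀≁ri γ₁ e)))
        where
        l≁li : ¬ E l₀ li
        l≁li ll with Pair.left-far [] eq₀ γ₁ (++-identityʳ bs′ ∙ e) [] li (ri ∷ []) refl ll
        ... | ()

    -- `r₀` is followed by a vertex of X, so it has at most k - 1 neighbours in gaps; `l₀` has gap
    -- neighbours only in its own gap.
    first-F : ∀ {c cs} → bs′ ≡ c ∷ cs → Fb (w₀ , bg l₀ m₀ r₀) + 2 ≤ k + # Q₀
    first-F {c} {cs} e = linear (Fb (w₀ , bg l₀ m₀ r₀) + 2) (k + # Q₀) 0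
        (+-mono-≤ (end-F b₀∈ (there (here refl)) c∈X⁻ r₀c) (own Q₀ (here refl)))
        (cong (λ n → n + (dg r₀ GL + 0) + 2 + (k + # Q₀) + 0) dg-l₀ ∙ lem (dg l₀ Q₀) (dg r₀ GL) k (# Q₀))
      where
      lem : ∀ d r k z → d + (r + 0) + 2 + (k + z) + 0 ≡ k + z + (r + 1 + suc d)
      lem = solve-∀
      c∈X⁻ : proj₁ c ∈ X⁻
      c∈X⁻ = subst (λ zs → proj₁ c ∈ heads zs) (sym e) (here refl)
      dg-l₀ : dg l₀ GL ≡ dg l₀ Q₀
      dg-l₀ = dg-GL l₀ ∙ S-split (λ c → dg l₀ (toL (proj₂ c))) [] eq₀ ∙ cong (dg l₀ Q₀ +_)
          (S-0 (bs′ ++ []) (λ c c∈ → others-none (subst (c ∈_) (++-identityʳ bs′) c∈))) ∙ +-identityʳ _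
      r₀c : E r₀ (proj₁ c)
      r₀c with segC
      ... | z , s , _ = edge (w₀ ∷ l₀ ∷ m₀) (subst (Seg E w₀ z)
          (sym flat≡ ∙ cong flat eq₀ ∙ cong (λ zs → w₀ ∷ Q₀ ++ flat zs) e ∙ cong (λ zs → w₀ ∷ l₀ ∷ zs) (++-assoc m₀ (r₀ ∷ []) (flat (c ∷ cs)))) s)

  -- A big last gap makes every gap consist of exactly two vertices. The first gap is then big as
  -- well, and the savings of both exceed the slack.
  last-big : ∀ α {x l r m} → bs ≡ α ++ (x , bg l m r) ∷ [] → ⊥
  last-big α {x} {l} {r} {m} eq = start α refl
    where
    open AtLast α eq
    from-first : ∀ {α′} → α ≡ (w₀ , g₀) ∷ α′ → bs′ ≡ α′ ++ b ∷ [] → ∀ g → g₀ ≡ g → isBig g ≡ 1 → ⊥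
    from-first {α′} eα e (bg l₀ m₀ r₀) eg _ =
      both-arith k t (# (m ++ r ∷ [])) (# (m₀ ++ r₀ ∷ [])) (Fb b) (Fb b₀) (S Fb α′) (S bound α′)
        (subst (λ n → k * (t + 2) ≤ Fb b + n) (cong (S Fb) eα′) F-split)
        (S-mono α′ (λ c c∈ → F≤bound (α⊆ (subst (c ∈_) (sym eα′) (there c∈)))))
        (≤-trans last-F (≤-reflexive (cong (k + size b +_) A≡0 ∙ +-identityʳ _)))
        (first-F eq₀ tiny all-big (proj₂ (proj₂ (nonempty α′ e))))
        (bound-split ∙ cong (λ n → 1 * suc k + # (m ++ r ∷ []) + n)
            (cong (S bound) eα′ ∙ cong (λ e → 1 * e + # (m₀ ++ r₀ ∷ []) + S bound α′) excess≡))
        t≡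
      where
      b₀ : Blk
      b₀ = w₀ , bg l₀ m₀ r₀
      eα′ : α ≡ b₀ ∷ α′
      eα′ = eα ∙ cong (λ g → (w₀ , g) ∷ α′) eg
      eq₀ : bs ≡ b₀ ∷ bs′
      eq₀ = cong (λ g → (w₀ , g) ∷ bs′) eg
      nonempty : ∀ β → bs′ ≡ β ++ b ∷ [] → ∃₂ λ c cs → bs′ ≡ c ∷ cs
      nonempty []      e′ = _ , _ , e′
      nonempty (_ ∷ _) e′ = _ , _ , e′
    start : ∀ α₀ → α ≡ α₀ → ⊥
    start [] e = ⊥-elim (n≮n 1 (≤-trans (≤-trans (s≤s (s≤s z≤n)) (s≤s 3≤k))
        (≤-reflexive (sym (#bs ∙ cong suc #X⁻≡k) ∙ cong # (eq ∙ cong (_++ b ∷ []) e)))))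
    start (c ∷ α′) e with eq ∙ cong (_++ b ∷ []) e
    ... | e′ with ∷-injectiveˡ e′
    ...   | refl = from-first e (∷-injectiveʳ e′) g₀ refl (all-big (here refl))

snoc-view : ∀ {A : Set} x (xs : List A) → ∃₂ λ ys y → x ∷ xs ≡ ys ++ y ∷ []
snoc-view x []        = [] , x , refl
snoc-view x (z ∷ xs) with snoc-view z xs
... | ys , y , e = x ∷ ys , y , cong (x ∷_) e

module EndsBig (Γ : Ctx) (P : List (Fin (Ctx.N Γ))) (ext : Extremal.Ext Γ (Ctx.w₀ Γ ∷ P))
               (v : Fin (Ctx.N Γ)) (isoᵥ : Extremal.Iso Γ (Ctx.w₀ Γ ∷ P) v) where
  open Extremal Γ
  open Tight Γ P ext v isoᵥ

  -- Phrased by the last two vertices of the cycle, so that it applies to a rotated cycle before its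
  -- gaps are known.
  ends-big : ∀ Z {s l} → C ≡ (Z ++ s ∷ []) ++ l ∷ [] → ¬ E v s → ⊥
  ends-big Z {s} {l} eC ¬vs = by-last (snoc-view (w₀ , g₀) bs′)
    where
    by-last : (∃₂ λ α b → bs ≡ α ++ b ∷ []) → ⊥
    by-last (α , (x , bg _ _ _) , e) = FirstBig.last-big Γ P ext v isoᵥ α e
    by-last (α , (x , sg y) , e) = ¬vs (subst (E v) x≡s (X⇒v (proj₁ (ok (subst ((x , sg y) ∈_) (sym e) (∈-mid α))))))
      where
      tail : C ≡ (flat α ++ x ∷ []) ++ y ∷ []
      tail = sym flat≡ ∙ cong flat e ∙ flat-++ α ((x , sg y) ∷ []) ∙ sym (++-assoc (flat α) (x ∷ []) (y ∷ []))
      x≡s : x ≡ s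
      x≡s = proj₂ (∷ʳ-injective (flat α) Z (proj₁ (∷ʳ-injective (flat α ++ x ∷ []) (Z ++ s ∷ []) (sym tail ∙ eC))))

module NoIsolated (Γ : Ctx) (P : List (Fin (Ctx.N Γ))) (ext : Extremal.Ext Γ (Ctx.w₀ Γ ∷ P))
                  (v : Fin (Ctx.N Γ)) (isoᵥ : Extremal.Iso Γ (Ctx.w₀ Γ ∷ P) v) where
  open Extremal Γ
  open Tight Γ P ext v isoᵥ
  open Flips Γ P ext
  open LastBig Γ P ext v isoᵥ using (from-w₀)

  private
    -- For t = 0 the slack t + 1 - k would be negative.
    some-big : 1 ≤ t
    some-big = by-t t refl
      where
      by-t : ∀ t′ → t ≡ t′ → 1 ≤ t
      by-t (suc _) e = subst (1 ≤_) (sym e) (s≤s z≤n)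
      by-t zero    e = ⊥-elim (impossible 1 (+-mono-≤ (subst (λ n → k * (n + 2) ≤ suc k) e
          (≤-trans F-total (≤-trans (S-mono bs (λ b b∈ → F≤bound b∈)) (≤-reflexive total)))) 3≤k) (lem k))
        where
        total : S bound bs ≡ suc k
        total = S-bound ∙ cong (λ n → n * excess + excess) e ∙ excess≡
        lem : ∀ k → k * (0 + 2) + 3 ≡ suc k + k + suc 1
        lem = solve-∀

    -- The flip makes the gap i the last one, so that it suffices to treat cycles ending in a big gap.
    last-single : ∀ γ₁ {xi li mi ri γ₂ x y} → bs ≡ (γ₁ ++ (xi , bg li mi ri) ∷ γ₂) ++ (x , sg y) ∷ [] → ⊥
    last-single γ₁ {xi} {li} {mi} {ri} {γ₂} {x} {y} eq with from-w₀ γ₁ xi [] B C≡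
      where
      B : List V
      B = toL (bg li mi ri) ++ flat γ₂ ++ x ∷ y ∷ []
      C≡ : C ≡ (flat γ₁ ++ xi ∷ []) ++ B
      C≡ = sym flat≡ ∙ cong flat (eq ∙ ++-assoc γ₁ ((xi , bg li mi ri) ∷ γ₂) ((x , sg y) ∷ [])) ∙
        flat-++ γ₁ ((xi , bg li mi ri) ∷ γ₂ ++ (x , sg y) ∷ []) ∙ cong (λ zs → flat γ₁ ++ xi ∷ toL (bg li mi ri) ++ zs)
            (flat-++ γ₂ ((x , sg y) ∷ [])) ∙ sym (++-assoc (flat γ₁) (xi ∷ []) B)
    ... | A , eA , eP = flipped second
      where
      Qi B : List V
      Qi = toL (bg li mi ri)
      B = Qi ++ flat γ₂ ++ x ∷ y ∷ []
      bi∈ : (xi , bg li mi ri) ∈ bs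
      bi∈ = subst ((xi , bg li mi ri) ∈_) (sym eq) (∈-++⁺ˡ (∈-mid γ₁))
      y∈ : (x , sg y) ∈ bs
      y∈ = subst ((x , sg y) ∈_) (sym eq) (∈-++⁺ʳ (γ₁ ++ (xi , bg li mi ri) ∷ γ₂) (here refl))
      second : ∃₂ λ s rest → B ≡ li ∷ s ∷ rest × s ∈ Qi
      second = go mi
        where
        go : ∀ mi → ∃₂ λ s rest → toL (bg li mi ri) ++ flat γ₂ ++ x ∷ y ∷ [] ≡ li ∷ s ∷ rest × s ∈ toL (bg li mi ri)
        go []      = ri , _ , refl , there (here refl)
        go (c ∷ m) = c , _ , refl , there (here refl)
      flipped : (∃₂ λ s rest → B ≡ li ∷ s ∷ rest × s ∈ Qi) → ⊥
      flipped (s , rest , eB , s∈) = EndsBig.ends-big Γ (A ++ reverse B)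
        (flip-tail A (flat γ₁) B (Qi ++ flat γ₂ ++ x ∷ []) eP (sym eA)
          (cong (Qi ++_) (sym (++-assoc (flat γ₂) (x ∷ []) (y ∷ []))) ∙ sym (++-assoc Qi (flat γ₂ ++ x ∷ []) (y ∷ [])))
          -- The chord for the rotation exists because the vertex of a one-vertex gap is adjacent to
          -- all of X.
          (E-sym (single-all y∈ (proj₁ (ok bi∈)))))
        v (Iso-≈ (flip-tail-≈ A B eP) isoᵥ) (w₀ ∷ A ++ reverse rest)
        (cong (λ zs → w₀ ∷ A ++ reverse zs) eB ∙ cong ((w₀ ∷ A) ++_) (unfold-reverse li (s ∷ rest) ∙ cong (_++ li ∷ []) (unfold-reverse s rest)) ∙
          sym (++-assoc (w₀ ∷ A) (reverse rest ++ s ∷ []) (li ∷ [])) ∙ cong (_++ li ∷ []) (sym (++-assoc (w₀ ∷ A) (reverse rest) (s ∷ []))))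
        (λ vs → proj₂ (ok bi∈) s∈ (v⇒X vs))

  no-isolated : ⊥
  no-isolated = ends-with (snoc-view (w₀ , g₀) bs′)
    where
    ends-with : (∃₂ λ α b → bs ≡ α ++ b ∷ []) → ⊥
    ends-with (α , (x , bg _ _ _) , e) = FirstBig.last-big Γ P ext v isoᵥ α e
    ends-with (α , (x , sg y) , e) with S-pos (λ b → isBig (proj₂ b)) bs some-big
    ... | (xi , bg li mi ri) , c∈ , _ with ∈-++⁻ α (subst ((xi , bg li mi ri) ∈_) e c∈)
    ...   | inj₂ (here ())
    ...   | inj₂ (there ())
    ...   | inj₁ c∈α with ∈-∃++ c∈α
    ...     | γ₁ , γ₂ , eα = last-single γ₁ (e ∙ cong (_++ (x , sg y) ∷ []) eα)

module NoExtremal (Γ : Ctx) where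
  open Extremal Γ

  no-extremal : ∀ {C} → Ext C → ⊥
  no-extremal ext₀ with standard ext₀
  ... | P , ext , _ = NoOutsidePath.no-outside-edge Γ P ext onward
    where
    onward : ∀ {u} → u ∉ (w₀ ∷ P) → ∃ λ w → w ∉ (w₀ ∷ P) × E u w
    onward {u} u∉ with any? (λ w → ¬? (w ∈? (w₀ ∷ P)) ×-dec T? (a u w))
    ... | yes r   = r
    ... | no none = ⊥-elim (NoIsolated.no-isolated Γ P ext u (u∉ , inside))
      where
      inside : ∀ w → E u w → w ∈ w₀ ∷ P
      inside w e with w ∈? (w₀ ∷ P)
      ... | yes m = m
      ... | no w∉ = ⊥-elim (none (w , w∉ , e))

-- From spanning cycles to Hamiltonian paths

module _ {n : ℕ} (G : Graph n) where

  HamList : List (Fin n) → Set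
  HamList xs = (∀ v → cnt v xs ≤ 1) × (∀ u v → Nx xs u v → Adj G u v)

  private
    search : ∀ m {Q : List (Fin n) → Set} → (∀ xs → Dec (Q xs)) → Dec (∃ λ xs → length xs ≡ m × Q xs)
    search zero Q? with Q? []
    ... | yes q = yes ([] , refl , q)
    ... | no ¬q = no λ { ([] , _ , q) → ¬q q }
    search (suc m) Q? with any? (λ x → search m (λ xs → Q? (x ∷ xs)))
    ... | yes (x , xs , e , q) = yes (x ∷ xs , cong suc e , q)
    ... | no none = no λ { (x ∷ xs , e , q) → none (x , xs , suc-injective e , q) }

    -- Exhaustive search decides the conclusion, so the argument by contradiction is constructive.
    HamList? : Dec (∃ λ xs → length xs ≡ n × HamList xs)
    HamList? = search n (λ xs → all? (λ v → cnt v xs ≤? 1) ×-dec all? (λ u → all? (λ v → Nx? xs u v →-dec T? (adj G u v))))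

    lookup-next : ∀ (xs : List (Fin n)) i j → toℕ j ≡ suc (toℕ i) → Nx xs (lookup xs i) (lookup xs j)
    lookup-next (x ∷ y ∷ xs) zero    (suc zero) _ = here
    lookup-next (x ∷ xs)     (suc i) (suc j)    e = there (lookup-next xs i j (suc-injective e))

    lookup-inj : ∀ (xs : List (Fin n)) → Uniq xs → ∀ i j → lookup xs i ≡ lookup xs j → i ≡ j
    lookup-inj (x ∷ xs) u zero    zero    e = refl
    lookup-inj (x ∷ xs) u zero    (suc j) e = ⊥-elim (Uniq-head u (subst (_∈ xs) (sym e) (∈-lookup j)))
    lookup-inj (x ∷ xs) u (suc i) zero    e = ⊥-elim (Uniq-head u (subst (_∈ xs) e (∈-lookup i)))
    lookup-inj (x ∷ xs) u (suc i) (suc j) e = cong suc (lookup-inj xs (Uniq-++ʳ (x ∷ []) u) i j e)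

    toPath : (∃ λ xs → length xs ≡ n × HamList xs) → HamiltonianPath G
    toPath (xs , e , u , lk) = (λ i → lookup xs (cast (sym e) i))
      , (λ {i} {j} q → toℕ-injective (sym (toℕ-cast (sym e) i) ∙ cong toℕ (lookup-inj xs (uniq u) _ _ q) ∙ toℕ-cast (sym e) j))
      , λ i h → lk _ _ (lookup-next xs _ _ (toℕ-cast (sym e) (fromℕ< h) ∙ toℕ-fromℕ< h ∙
          cong suc (sym (toℕ-cast (sym e) (fromℕ< (<-trans (n<1+n i) h)) ∙ toℕ-fromℕ< (<-trans (n<1+n i) h)))))

  module _ {k : ℕ} (reg : Regular k G) (conn : Connected G) (n≤ : n ≤ 3 * k + 3) where

    private
      V⁺ : Set
      V⁺ = Fin (suc n)

      a⁺ : V⁺ → V⁺ → Bool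
      a⁺ zero    zero    = false
      a⁺ zero    (suc v) = true
      a⁺ (suc u) zero    = true
      a⁺ (suc u) (suc v) = adj G u v

      a⁺-sym : ∀ u v → a⁺ u v ≡ a⁺ v u
      a⁺-sym zero    zero    = refl
      a⁺-sym zero    (suc v) = refl
      a⁺-sym (suc u) zero    = refl
      a⁺-sym (suc u) (suc v) = Graph.sym G u v

      a⁺-irr : ∀ v → a⁺ v v ≡ false
      a⁺-irr zero    = refl
      a⁺-irr (suc v) = irref G v

      univ⁺ : ∀ v → v ≢ zero → T (a⁺ zero v)
      univ⁺ zero    h = h refl
      univ⁺ (suc v) h = _

      deg⁺ : ∀ v → v ≢ zero → S (λ u → b2n (a⁺ v u)) (allFin (suc n)) ≡ suc k
      deg⁺ zero    h = ⊥-elim (h refl)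
      deg⁺ (suc v) h = S-allFin-suc (λ u → b2n (a⁺ (suc v) u)) ∙ cong suc (sym as-sum ∙ reg v)
        where
        as-sum : degree G v ≡ S (λ u → b2n (adj G v u)) (allFin n)
        as-sum = length≡# (filter (λ u → T? (adj G v u)) (allFin n)) ∙ S-filter (λ _ → 1) (λ u → T? (adj G v u)) (allFin n) ∙ S-cong
            (allFin n) (λ u _ → +-identityʳ _)

      escape : ∀ (C : List V⁺) {t z} → Walk G t z → suc t ∈ C → suc z ∉ C → ∃₂ λ t z → t ∈ C × t ≢ zero × z ∉ C × T (a⁺ t z)
      escape C Walk.here t∈ z∉ = ⊥-elim (z∉ t∈)
      escape C {t} (step {v = v} e w) t∈ z∉ with suc v ∈? C
      ... | yes v∈ = escape C w v∈ z∉
      ... | no v∉  = suc t , suc v , t∈ , (λ ()) , v∉ , e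

      attach⁺ : ∀ (C : List V⁺) t z → t ∈ C → t ≢ zero → z ∉ C → z ≢ zero → ∃₂ λ t z → t ∈ C × t ≢ zero × z ∉ C × T (a⁺ t z)
      attach⁺ C zero    z       t∈ t≢ z∉ z≢ = ⊥-elim (t≢ refl)
      attach⁺ C (suc t) zero    t∈ t≢ z∉ z≢ = ⊥-elim (z≢ refl)
      attach⁺ C (suc t) (suc z) t∈ t≢ z∉ z≢ = escape C (proj₂ conn t z) t∈ z∉

      E⁺ : V⁺ → V⁺ → Set
      E⁺ u v = T (a⁺ u v)

      unsuc : ∀ (Q : List V⁺) → zero ∉ Q → ∃ λ xs → Q ≡ map suc xs
      unsuc []          _ = [] , refl
      unsuc (zero ∷ Q)  h = ⊥-elim (h (here refl))
      unsuc (suc v ∷ Q) h with unsuc Q (h ∘ there)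
      ... | xs , e = v ∷ xs , cong (suc v ∷_) e

      Nx-map : ∀ {xs : List (Fin n)} {u v} → Nx xs u v → Nx (map suc xs) (suc u) (suc v)
      Nx-map here      = here
      Nx-map (there m) = there (Nx-map m)

      δ-suc : ∀ (u v : Fin n) → δ (suc u) (suc v) ≡ δ u v
      δ-suc u v with u ≟ v
      ... | yes _ = refl
      ... | no _  = refl

      -- A cycle through all n + 1 vertices contains the added vertex; opened there, it lists the
      -- vertices of the graph.
      spanning : ∀ C → Cyc E⁺ C → Uniq C → suc n ≤ # C → ∃ λ xs → length xs ≡ n × HamList xs
      spanning C c u le with zero ∈? C
      ... | no z∉ = ⊥-elim (n≮n (suc n) (≤-trans (s≤s le) (#-Uniq-≤ (Uniq-∷ z∉ u))))
      ... | yes z∈ with ∈-∃++ z∈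
      ...   | α , β , refl with unclose (rotate α c) | unsuc (β ++ α) (Uniq-head u′)
        where
        u′ : Uniq (zero ∷ β ++ α)
        u′ = ≈-Uniq (swap-≈ α (zero ∷ β)) u
      ...     | b , s , _ | xs , e = xs , length≡# xs ∙ sym (S-map (λ _ → 1) suc xs) ∙ cong # (sym e) ∙ #Q , once′ , linked
        where
        u′ : Uniq (zero ∷ β ++ α)
        u′ = ≈-Uniq (swap-≈ α (zero ∷ β)) u
        #Q : # (β ++ α) ≡ n
        #Q = suc-injective (≤-antisym (#-Uniq-≤ u′) (≤-trans le (≤-reflexive (sums (swap-≈ α (zero ∷ β)) (λ _ → 1)))))
        once′ : ∀ v → cnt v xs ≤ 1
        once′ v = ≤-trans (≤-reflexive (S-cong xs (λ w _ → sym (δ-suc v w)) ∙ sym (S-map (δ (suc v)) suc xs) ∙ cong (cnt (suc v)) (sym e)))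
            (once (Uniq-++ʳ (zero ∷ []) u′) (suc v))
        linked : ∀ u v → Nx xs u v → Adj G u v
        linked u v m with Nx-split (subst (λ zs → Nx zs (suc u) (suc v)) (sym e) (Nx-map m))
        ... | ys , zs , e′ = edge (zero ∷ ys) (subst (λ ws → Seg E⁺ zero b (zero ∷ ws)) e′ s)

    hamiltonian-path : HamiltonianPath G
    hamiltonian-path with HamList?
    ... | yes h = toPath h
    -- Two adjacent vertices already count as a cycle here, so there is always one to start from.
    ... | no ¬h = ⊥-elim (Extremal.extremal Γ (λ C → NoExtremal.no-extremal Γ) (zero ∷ suc v₀ ∷ []) (_ ∷ (_ ∷ [ zero ]))
        (Uniq-∷ (λ { (here ()) }) (Uniq-∷ (λ ()) Uniq-[])))
      where
      v₀ : Fin n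
      v₀ = fromℕ< (proj₁ conn)
      Γ : Ctx
      Γ = record
        { N = suc n ; a = a⁺ ; a-sym = a⁺-sym ; a-irr = a⁺-irr ; w₀ = zero ; univ = univ⁺ ; k = k ; deg = deg⁺
        ; small = ≤-trans (s≤s n≤) (≤-reflexive (sym (+-suc (3 * k) 3)))
        ; attach = attach⁺
        ; nonspanning = λ C c u → ≰⇒> (λ le → ¬h (spanning C c u le)) }

-- A cut vertex with three components

dgr : ∀ {n} → Graph n → Fin n → ℕ
dgr {n} G v = S (λ u → b2n (adj G v u)) (allFin n)

degree≡ : ∀ {n} (G : Graph n) v → degree G v ≡ dgr G v
degree≡ {n} G v = length≡# (filter (λ u → T? (adj G v u)) (allFin n)) ∙ S-filter (λ _ → 1) (λ u → T? (adj G v u)) (allFin n) ∙ S-cong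
    (allFin n) (λ u _ → +-identityʳ _)

S-↑ : ∀ m {n} (f : Fin (m + n) → ℕ) → S f (allFin (m + n)) ≡ S (λ i → f (i ↑ˡ n)) (allFin m) + S (λ j → f (m ↑ʳ j)) (allFin n)
S-↑ zero    f = refl
S-↑ (suc m) {n} f = S-allFin-suc f ∙ cong (f zero +_) (S-↑ m (f ∘ suc)) ∙ sym (+-assoc (f zero) _ _) ∙ cong
    (_+ S (λ j → f (suc m ↑ʳ j)) (allFin n)) (sym (S-allFin-suc (λ i → f (i ↑ˡ n))))

data Split (m : ℕ) {n : ℕ} : Fin (m + n) → Set where
  left  : ∀ i → Split m (i ↑ˡ n)
  right : ∀ j → Split m (m ↑ʳ j)

split : ∀ m {n} (v : Fin (m + n)) → Split m v
split m {n} v with splitAt m v in eq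
... | inj₁ i = subst (Split m) (splitAt⁻¹-↑ˡ {m} {n} {v} eq) (left i)
... | inj₂ j = subst (Split m) (splitAt⁻¹-↑ʳ {m} {n} {v} eq) (right j)

-- The marked vertices are those to be joined to the cut vertex.
record Marked (n : ℕ) : Set where
  field
    gr   : Graph n
    mark : Fin n → Bool
open Marked

#marks : ∀ {n} → Marked n → ℕ
#marks {n} M = S (λ v → b2n (mark M v)) (allFin n)

module _ {m n : ℕ} (A : Marked m) (B : Marked n) where

  private
    sumAdj : Fin m ⊎ Fin n → Fin m ⊎ Fin n → Bool
    sumAdj (inj₁ i) (inj₁ j) = adj (gr A) i j
    sumAdj (inj₂ i) (inj₂ j) = adj (gr B) i j
    sumAdj _        _        = false

    sumMark : Fin m ⊎ Fin n → Bool
    sumMark (inj₁ i) = mark A i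
    sumMark (inj₂ j) = mark B j

    sumSym : ∀ u v → sumAdj u v ≡ sumAdj v u
    sumSym (inj₁ i) (inj₁ j) = Graph.sym (gr A) i j
    sumSym (inj₁ i) (inj₂ j) = refl
    sumSym (inj₂ i) (inj₁ j) = refl
    sumSym (inj₂ i) (inj₂ j) = Graph.sym (gr B) i j

    sumIrr : ∀ v → sumAdj v v ≡ false
    sumIrr (inj₁ i) = irref (gr A) i
    sumIrr (inj₂ j) = irref (gr B) j

  infixr 5 _⊕_
  _⊕_ : Marked (m + n)
  _⊕_ = record
    { gr = record { adj = λ u v → sumAdj (splitAt m u) (splitAt m v) ; sym = λ u v → sumSym (splitAt m u) (splitAt m v) ; irref = λ v →
        sumIrr (splitAt m v) }
    ; mark = λ v → sumMark (splitAt m v) }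

  adj-ll : ∀ i j → adj (gr _⊕_) (i ↑ˡ n) (j ↑ˡ n) ≡ adj (gr A) i j
  adj-ll i j = cong₂ sumAdj (splitAt-↑ˡ m i n) (splitAt-↑ˡ m j n)

  adj-lr : ∀ i j → adj (gr _⊕_) (i ↑ˡ n) (m ↑ʳ j) ≡ false
  adj-lr i j = cong₂ sumAdj (splitAt-↑ˡ m i n) (splitAt-↑ʳ m n j)

  adj-rl : ∀ i j → adj (gr _⊕_) (m ↑ʳ i) (j ↑ˡ n) ≡ false
  adj-rl i j = cong₂ sumAdj (splitAt-↑ʳ m n i) (splitAt-↑ˡ m j n)

  adj-rr : ∀ i j → adj (gr _⊕_) (m ↑ʳ i) (m ↑ʳ j) ≡ adj (gr B) i j
  adj-rr i j = cong₂ sumAdj (splitAt-↑ʳ m n i) (splitAt-↑ʳ m n j)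

  mark-l : ∀ i → mark _⊕_ (i ↑ˡ n) ≡ mark A i
  mark-l i = cong sumMark (splitAt-↑ˡ m i n)

  mark-r : ∀ j → mark _⊕_ (m ↑ʳ j) ≡ mark B j
  mark-r j = cong sumMark (splitAt-↑ʳ m n j)

  dgr-l : ∀ i → dgr (gr _⊕_) (i ↑ˡ n) ≡ dgr (gr A) i
  dgr-l i = S-↑ m (λ u → b2n (adj (gr _⊕_) (i ↑ˡ n) u)) ∙ cong₂ _+_ (S-cong (allFin m) (λ j _ → cong b2n (adj-ll i j)))
      (S-0 (allFin n) (λ j _ → cong b2n (adj-lr i j))) ∙ +-identityʳ _

  dgr-r : ∀ i → dgr (gr _⊕_) (m ↑ʳ i) ≡ dgr (gr B) i
  dgr-r i = S-↑ m (λ u → b2n (adj (gr _⊕_) (m ↑ʳ i) u)) ∙ cong₂ _+_ (S-0 (allFin m) (λ j _ → cong b2n (adj-rl i j)))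
      (S-cong (allFin n) (λ j _ → cong b2n (adj-rr i j)))

  #marks-⊕ : #marks _⊕_ ≡ #marks A + #marks B
  #marks-⊕ = S-↑ m (λ u → b2n (mark _⊕_ u)) ∙ cong₂ _+_ (S-cong (allFin m) (λ j _ → cong b2n (mark-l j)))
      (S-cong (allFin n) (λ j _ → cong b2n (mark-r j)))

  ⊕-degrees : ∀ (φ : Bool → ℕ) → (∀ i → dgr (gr A) i ≡ φ (mark A i)) → (∀ j → dgr (gr B) j ≡ φ (mark B j)) → ∀ v → dgr (gr _⊕_) v ≡ φ (mark _⊕_ v)
  ⊕-degrees φ hA hB v with split m v
  ... | left i  = dgr-l i ∙ hA i ∙ cong φ (sym (mark-l i))
  ... | right j = dgr-r j ∙ hB j ∙ cong φ (sym (mark-r j))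

-- Every component contains a marked vertex, which makes the graph connected once the cut vertex is
-- added.
Reach : ∀ {n} → Marked n → Set
Reach M = ∀ v → ∃ λ u → Walk (gr M) v u × T (mark M u)

mapWalk : ∀ {m n} {G : Graph m} {H : Graph n} (f : Fin m → Fin n) → (∀ {u v} → Adj G u v → Adj H (f u) (f v)) → ∀ {u v} → Walk G u v → Walk
    H (f u) (f v)
mapWalk f h Walk.here  = Walk.here
mapWalk f h (step e w) = step (h e) (mapWalk f h w)

⊕-reach : ∀ {m n} (A : Marked m) (B : Marked n) → Reach A → Reach B → Reach (A ⊕ B)
⊕-reach {m} {n} A B rA rB v with split m v
... | left i with rA i
...   | u , w , t = u ↑ˡ n , mapWalk (_↑ˡ n) (λ {i} {j} → subst T (sym (adj-ll A B i j))) w , subst T (sym (mark-l A B u)) t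
⊕-reach {m} {n} A B rA rB v | right j with rB j
... | u , w , t = m ↑ʳ u , mapWalk (m ↑ʳ_) (λ {i} {j} → subst T (sym (adj-rr A B i j))) w , subst T (sym (mark-r A B u)) t

private
  eqb : ∀ {n} → Fin n → Fin n → Bool
  eqb u v = does (u ≟ v)

  eqb-sym : ∀ {n} (u v : Fin n) → eqb u v ≡ eqb v u
  eqb-sym u v with u ≟ v | v ≟ u
  ... | yes _ | yes _ = refl
  ... | no _  | no _  = refl
  ... | yes e | no ¬e = ⊥-elim (¬e (sym e))
  ... | no ¬e | yes e = ⊥-elim (¬e (sym e))

-- The complement with the marks unchanged: the components are dense, and their missing edges are
-- easier to describe.
co : ∀ {n} → Marked n → Marked n
co M = record
  { gr = record
    { adj   = λ u v → not (eqb u v) ∧ not (adj (gr M) u v)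
    ; sym   = λ u v → cong₂ (λ x y → not x ∧ not y) (eqb-sym u v) (Graph.sym (gr M) u v)
    ; irref = λ v → irr v }
  ; mark = mark M }
  where
  irr : ∀ v → not (eqb v v) ∧ not (adj (gr M) v v) ≡ false
  irr v with v ≟ v
  ... | yes _ = refl
  ... | no ¬e = ⊥-elim (¬e refl)

co-adj : ∀ {n} (M : Marked n) {u v} → u ≢ v → adj (gr M) u v ≡ false → Adj (gr (co M)) u v
co-adj M {u} {v} u≢v h with u ≟ v
... | yes e = ⊥-elim (u≢v e)
... | no _ rewrite h = _

co-dgr : ∀ {n} (M : Marked n) v → dgr (gr (co M)) v + (dgr (gr M) v + 1) ≡ n
co-dgr {n} M v = cong (λ m → dgr (gr (co M)) v + (dgr (gr M) v + m)) (sym (cnt-allFin v)) ∙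
  cong (dgr (gr (co M)) v +_) (sym (S-+ (λ u → b2n (adj (gr M) v u)) (δ v) (allFin n))) ∙
    sym (S-+ (λ u → b2n (adj (gr (co M)) v u)) (λ u → b2n (adj (gr M) v u) + δ v u) (allFin n)) ∙ S-cong (allFin n) (λ u _ → one u) ∙ #-allFin n
  where
  one : ∀ u → b2n (adj (gr (co M)) v u) + (b2n (adj (gr M) v u) + δ v u) ≡ 1
  one u with v ≟ u
  ... | yes refl rewrite irref (gr M) v = refl
  ... | no _ with adj (gr M) v u
  ...   | true  = refl
  ...   | false = refl

module _ {n : ℕ} (M : Marked n) where

  private
    coneAdj : Fin (suc n) → Fin (suc n) → Bool
    coneAdj zero    zero    = false
    coneAdj zero    (suc v) = mark M v
    coneAdj (suc u) zero    = mark M u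
    coneAdj (suc u) (suc v) = adj (gr M) u v

    coneSym : ∀ u v → coneAdj u v ≡ coneAdj v u
    coneSym zero    zero    = refl
    coneSym zero    (suc v) = refl
    coneSym (suc u) zero    = refl
    coneSym (suc u) (suc v) = Graph.sym (gr M) u v

    coneIrr : ∀ v → coneAdj v v ≡ false
    coneIrr zero    = refl
    coneIrr (suc v) = irref (gr M) v

  cone : Graph (suc n)
  cone = record { adj = coneAdj ; sym = coneSym ; irref = coneIrr }

  cone-regular : ∀ {k} → #marks M ≡ k → (∀ v → b2n (mark M v) + dgr (gr M) v ≡ k) → Regular k cone
  cone-regular h₀ h zero    = degree≡ cone zero ∙ S-allFin-suc (λ u → b2n (coneAdj zero u)) ∙ h₀
  cone-regular h₀ h (suc v) = degree≡ cone (suc v) ∙ S-allFin-suc (λ u → b2n (coneAdj (suc v) u)) ∙ h v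

  private
    walk-++ : ∀ {u v w} → Walk cone u v → Walk cone v w → Walk cone u w
    walk-++ Walk.here  w′ = w′
    walk-++ (step e w) w′ = step e (walk-++ w w′)

    walk-rev : ∀ {u v} → Walk cone u v → Walk cone v u
    walk-rev Walk.here = Walk.here
    walk-rev (step {u} {v} e w) = walk-++ (walk-rev w) (step (subst T (coneSym u v) e) Walk.here)

  cone-connected : Reach M → Connected cone
  cone-connected r = s≤s z≤n , λ u v → walk-++ (home u) (walk-rev (home v))
    where
    home : ∀ u → Walk cone u zero
    home zero = Walk.here
    home (suc v) with r v
    ... | u , w , t = walk-++ (mapWalk suc (λ e → e) w) (step t Walk.here)

  module _ (lab : Fin n → ℕ) (lab-adj : ∀ {u v} → Adj (gr M) u v → lab u ≡ lab v) where

    private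
      lab⁺ : Fin (suc n) → ℕ
      lab⁺ zero    = 0
      lab⁺ (suc v) = lab v

      lab⁺-adj : ∀ {u v} → u ≢ zero → v ≢ zero → Adj cone u v → lab⁺ u ≡ lab⁺ v
      lab⁺-adj {zero}  {v}     u≢ v≢ e = ⊥-elim (u≢ refl)
      lab⁺-adj {suc u} {zero}  u≢ v≢ e = ⊥-elim (v≢ refl)
      lab⁺-adj {suc u} {suc v} u≢ v≢ e = lab-adj e

    surjective : ∀ {n} (p : Fin n → Fin n) → Injective _≡_ _≡_ p → ∀ y → ∃ λ i → p i ≡ y
    surjective {n} p inj y with any? (λ i → p i ≟ y)
    ... | yes r   = r
    ... | no none = ⊥-elim (n≮n n (injective⇒≤ {f = g} g-inj))
      where
      g : Fin (suc n) → Fin n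
      g zero    = y
      g (suc i) = p i
      g-inj : Injective _≡_ _≡_ g
      g-inj {zero}  {zero}  e = refl
      g-inj {zero}  {suc j} e = ⊥-elim (none (j , sym e))
      g-inj {suc i} {zero}  e = ⊥-elim (none (i , e))
      g-inj {suc i} {suc j} e = cong suc (inj e)

    -- A Hamiltonian path meets the cut vertex once, so it carries at most two labels.
    two-labels : HamiltonianPath cone → ∃₂ λ c d → ∀ v → lab v ≡ c ⊎ lab v ≡ d
    two-labels (p , inj , adjp) with surjective p inj zero
    ... | s , ps = lab⁺ (p zero) , after , each
      where
      σ : ℕ
      σ = toℕ s
      q : ∀ i → .(i < suc n) → Fin (suc n)
      q i h = p (fromℕ< h)
      q≢ : ∀ i (h : i < suc n) → i ≢ σ → q i h ≢ zero
      q≢ i h ne e = ne (sym (toℕ-fromℕ< h) ∙ cong toℕ (inj (e ∙ sym ps)))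
      next : ∀ i (h : suc i < suc n) → i ≢ σ → suc i ≢ σ → lab⁺ (q (suc i) h) ≡ lab⁺ (q i (<-trans (n<1+n i) h))
      next i h n₁ n₂ = sym (lab⁺-adj (q≢ i (<-trans (n<1+n i) h) n₁) (q≢ (suc i) h n₂) (adjp i h))
      before : ∀ i (h : i < suc n) → i < σ → lab⁺ (q i h) ≡ lab⁺ (p zero)
      before zero    h _  = refl
      before (suc i) h lt = next i h (λ e → n≮n i (<-trans (n<1+n i) (subst (suc i <_) (sym e) lt))) (λ e → n≮n σ (subst (_< σ) e lt)) ∙
          before i (<-trans (n<1+n i) h) (<-trans (n<1+n i) lt)
      after : ℕ
      after with suc σ <? suc n
      ... | yes h = lab⁺ (q (suc σ) h)
      -- A default value for a path that ends in the cut vertex, where nothing comes after it.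
      ... | no _  = 0
      after≡ : ∀ (h : suc σ < suc n) → after ≡ lab⁺ (q (suc σ) h)
      after≡ h with suc σ <? suc n
      ... | yes h′ = refl
      ... | no ¬h  = ⊥-elim (¬h h)
      behind : ∀ i (h : i < suc n) → σ < i → lab⁺ (q i h) ≡ after
      behind (suc i) h (s≤s le) with m≤n⇒m<n∨m≡n le
      ... | inj₂ refl = sym (after≡ h)
      ... | inj₁ lt   = next i h (λ e → n≮n i (subst (_< i) (sym e) lt)) (λ e → n≮n σ (<-trans lt (subst (i <_) e (n<1+n i)))) ∙ behind i
          (<-trans (n<1+n i) h) lt
      each : ∀ v → lab v ≡ lab⁺ (p zero) ⊎ lab v ≡ after
      each v with surjective p inj (suc v)
      ... | j , pj with <-cmp (toℕ j) σ
      ...   | tri< lt _ _ = inj₁ (sym here′ ∙ before (toℕ j) (toℕ<n j) lt)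
        where
        here′ : lab⁺ (q (toℕ j) (toℕ<n j)) ≡ lab v
        here′ = cong (λ i → lab⁺ (p i)) (fromℕ<-toℕ j (toℕ<n j)) ∙ cong lab⁺ pj
      ...   | tri> _ _ gt = inj₂ (sym here′ ∙ behind (toℕ j) (toℕ<n j) gt)
        where
        here′ : lab⁺ (q (toℕ j) (toℕ<n j)) ≡ lab v
        here′ = cong (λ i → lab⁺ (p i)) (fromℕ<-toℕ j (toℕ<n j)) ∙ cong lab⁺ pj
      ...   | tri≈ _ e _ with sym pj ∙ cong p (toℕ-injective e) ∙ ps
      ...     | ()

    no-path : ∀ u v w → lab u ≢ lab v → lab u ≢ lab w → lab v ≢ lab w → ¬ HamiltonianPath cone
    no-path u v w uv uw vw hp with two-labels hp
    ... | c , d , h with h u | h v | h w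
    ... | inj₁ x | inj₁ y | _      = uv (x ∙ sym y)
    ... | inj₁ x | inj₂ y | inj₁ z = uw (x ∙ sym z)
    ... | inj₁ x | inj₂ y | inj₂ z = vw (y ∙ sym z)
    ... | inj₂ x | inj₁ y | inj₁ z = vw (y ∙ sym z)
    ... | inj₂ x | inj₁ y | inj₂ z = uw (x ∙ sym z)
    ... | inj₂ x | inj₂ y | _      = uv (x ∙ sym y)

open Marked

Completes : ∀ {n} → ℕ → Marked n → Set
Completes k M = ∀ v → b2n (mark M v) + dgr (gr M) v ≡ k

⊕-completes : ∀ {m n k} (A : Marked m) (B : Marked n) → Completes k A → Completes k B → Completes k (A ⊕ B)
⊕-completes {m} A B hA hB v with split m v
... | left i  = cong₂ (λ b d → b2n b + d) (mark-l A B i) (dgr-l A B i) ∙ hA i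
... | right j = cong₂ (λ b d → b2n b + d) (mark-r A B j) (dgr-r A B j) ∙ hB j

-- A certificate of at least ℓ components: a labelling constant along edges that attains 0, ..., ℓ -
-- 1.
record Labelling {n : ℕ} (M : Marked n) (ℓ : ℕ) : Set where
  field
    lab     : Fin n → ℕ
    lab-adj : ∀ {u v} → Adj (gr M) u v → lab u ≡ lab v
    witness : Fin ℓ → Fin n
    shows   : ∀ i → lab (witness i) ≡ toℕ i
open Labelling

one-label : ∀ {n} (M : Marked (suc n)) → Labelling M 1
one-label M = record { lab = λ _ → 0 ; lab-adj = λ _ → refl ; witness = λ _ → zero ; shows = λ { zero → refl } }

⊕-label : ∀ {m n ℓ} (A : Marked (suc m)) {B : Marked n} → Labelling B ℓ → Labelling (A ⊕ B) (suc ℓ)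
⊕-label {m} {n} {ℓ} A {B} L = record { lab = λ v → lb (splitAt (suc m) v) ; lab-adj = λ {u} {v} → adj-ok u v ; witness = wit ; shows = sh }
  where
  lb : Fin (suc m) ⊎ Fin n → ℕ
  lb (inj₁ _) = 0
  lb (inj₂ j) = suc (lab L j)
  adj-ok : ∀ u v → Adj (gr (A ⊕ B)) u v → lb (splitAt (suc m) u) ≡ lb (splitAt (suc m) v)
  adj-ok u v e with split (suc m) u | split (suc m) v
  ... | left i  | left j  = cong lb (splitAt-↑ˡ (suc m) i n) ∙ sym (cong lb (splitAt-↑ˡ (suc m) j n))
  ... | left i  | right j = ⊥-elim (subst T (adj-lr A B i j) e)
  ... | right i | left j  = ⊥-elim (subst T (adj-rl A B i j) e)
  ... | right i | right j = cong lb (splitAt-↑ʳ (suc m) n i) ∙ cong suc (lab-adj L (subst T (adj-rr A B i j) e)) ∙ sym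
      (cong lb (splitAt-↑ʳ (suc m) n j))
  wit : Fin (suc ℓ) → Fin (suc m + n)
  wit zero    = zero
  wit (suc i) = suc m ↑ʳ witness L i
  sh : ∀ i → lb (splitAt (suc m) (wit i)) ≡ toℕ i
  sh zero    = refl
  sh (suc i) = cong lb (splitAt-↑ʳ (suc m) n (witness L i)) ∙ cong suc (shows L i)

cone-without-path : ∀ {n k} (M : Marked n) → #marks M ≡ k → Completes k M → Reach M → Labelling M 3 →
  ∀ N → N ≡ suc n → Σ (Graph N) λ G → Regular k G × Connected G × ¬ HamiltonianPath G
cone-without-path M h₀ h r L N refl = cone M , cone-regular M h₀ h , cone-connected M r
  , no-path M (lab L) (lab-adj L) (witness L zero) (witness L (suc zero)) (witness L (suc (suc zero))) (apart λ ()) (apart λ ()) (apart λ ())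
  where
  apart : ∀ {i j} → toℕ i ≢ toℕ j → lab L (witness L i) ≢ lab L (witness L j)
  apart {i} {j} ne e = ne (sym (shows L i) ∙ e ∙ shows L j)

-- The components of the examples

blank : ∀ r → Marked r
blank r = record { gr = record { adj = λ _ _ → false ; sym = λ _ _ → refl ; irref = λ _ → refl } ; mark = λ _ → false }

private
  star : ∀ {n} → Fin (suc n) → Fin (suc n) → Bool
  star zero    (suc _) = true
  star (suc _) zero    = true
  star _       _       = false

  star-sym : ∀ {n} (u v : Fin (suc n)) → star u v ≡ star v u
  star-sym zero    zero    = refl
  star-sym zero    (suc _) = refl
  star-sym (suc _) zero    = refl
  star-sym (suc _) (suc _) = refl

  star-irr : ∀ {n} (v : Fin (suc n)) → star v v ≡ false
  star-irr zero    = refl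
  star-irr (suc _) = refl

edge₂ : Bool → Marked 2
edge₂ b = record { gr = record { adj = star ; sym = star-sym ; irref = star-irr } ; mark = λ _ → b }

path₃ : Marked 3
path₃ = record { gr = record { adj = star ; sym = star-sym ; irref = star-irr } ; mark = λ { zero → true ; (suc _) → false } }

pairs : ∀ m → Bool → Marked (m * 2)
pairs zero    b = blank 0
pairs (suc m) b = edge₂ b ⊕ pairs m b

pairs-mark : ∀ m b i → mark (pairs m b) i ≡ b
pairs-mark (suc m) b v with split 2 v
... | left i  = mark-l (edge₂ b) (pairs m b) i
... | right j = mark-r (edge₂ b) (pairs m b) j ∙ pairs-mark m b j

pairs-dgr : ∀ m b i → dgr (gr (pairs m b)) i ≡ 1
pairs-dgr (suc m) b v with split 2 v
... | left zero       = dgr-l (edge₂ b) (pairs m b) zero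
... | left (suc zero) = dgr-l (edge₂ b) (pairs m b) (suc zero)
... | right j         = dgr-r (edge₂ b) (pairs m b) j ∙ pairs-dgr m b j

#marks-pairs : ∀ m → #marks (pairs m true) ≡ m * 2
#marks-pairs m = S-cong (allFin (m * 2)) (λ i _ → cong b2n (pairs-mark m true i)) ∙ #-allFin (m * 2)

-- A complete graph, on k + 1 vertices in the examples, less a matching of m edges. The 2m matched
-- vertices are marked: the cut vertex replaces the neighbour they lost.
dense : ∀ m r → Marked (m * 2 + r)
dense m r = co (pairs m true ⊕ blank r)

dense-completes : ∀ m r {k} → m * 2 + r ≡ suc k → Completes k (dense m r)
dense-completes m r {k} e v = suc-injective (lem (b2n (mark D v)) (dgr (gr D) v) ∙ cong (λ d → dgr (gr D) v + (d + 1)) (sym codeg) ∙ co-dgr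
    (pairs m true ⊕ blank r) v ∙ e)
  where
  D : Marked (m * 2 + r)
  D = dense m r
  codeg : dgr (gr (pairs m true ⊕ blank r)) v ≡ b2n (mark D v)
  codeg = ⊕-degrees (pairs m true) (blank r) b2n (λ i → pairs-dgr m true i ∙ cong b2n (sym (pairs-mark m true i)))
      (λ j → S-0 (allFin r) (λ _ _ → refl)) v
  lem : ∀ b d → suc (b + d) ≡ d + (b + 1)
  lem = solve-∀

#marks-dense : ∀ m r → #marks (dense m r) ≡ m * 2
#marks-dense m r = #marks-⊕ (pairs m true) (blank r) ∙ cong₂ _+_ (#marks-pairs m) (S-0 (allFin r) (λ _ _ → refl)) ∙ +-identityʳ _

dense-reach : ∀ m r → Reach (dense (suc m) r)
dense-reach m r v with split (suc m * 2) v
... | left i  = _ , Walk.here , subst T (sym (mark-l (pairs (suc m) true) (blank r) i ∙ pairs-mark (suc m) true i)) _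
... | right j = zero , step {v = zero} (co-adj M {suc m * 2 ↑ʳ j} {zero} (λ ()) (adj-rl (pairs (suc m) true) (blank r) j zero)) Walk.here ,
    subst T (sym (mark-l (pairs (suc m) true) (blank r) zero ∙ pairs-mark (suc m) true zero)) _
  where
  M : Marked (suc m * 2 + r)
  M = pairs (suc m) true ⊕ blank r

-- For odd k one component has k + 2 vertices; only the centre of path₃ is joined to the cut vertex.
dense₃ : ∀ m → Marked (3 + m * 2)
dense₃ m = co (path₃ ⊕ pairs m false)

-- Among k + 2 vertices the centre misses two others and every further vertex misses one; only the
-- centre is in need of the cut vertex.
dense₃-completes : ∀ m {k} → 3 + m * 2 ≡ suc (suc k) → Completes k (dense₃ m)
dense₃-completes m {k} e v = suc-injective (suc-injective
    (lem (b2n (mark D v)) (dgr (gr D) v) ∙ cong (λ d → dgr (gr D) v + (d + 1)) (sym codeg) ∙ co-dgr (path₃ ⊕ pairs m false) v ∙ e))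
  where
  D : Marked (3 + m * 2)
  D = dense₃ m
  codeg : dgr (gr (path₃ ⊕ pairs m false)) v ≡ suc (b2n (mark D v))
  codeg = ⊕-degrees path₃ (pairs m false) (λ b → suc (b2n b)) (λ { zero → refl ; (suc zero) → refl ; (suc (suc zero)) → refl })
      (λ j → pairs-dgr m false j ∙ cong (λ b → suc (b2n b)) (sym (pairs-mark m false j))) v
  lem : ∀ b d → suc (suc (b + d)) ≡ d + (suc b + 1)
  lem = solve-∀

#marks-dense₃ : ∀ m → #marks (dense₃ m) ≡ 1
#marks-dense₃ m = #marks-⊕ path₃ (pairs m false) ∙ cong (1 +_) (S-0 (allFin (m * 2)) (λ i _ → cong b2n (pairs-mark m false i)))

dense₃-reach : ∀ m → Reach (dense₃ (suc m))
dense₃-reach m v = zero , walk v , _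
  where
  M : Marked (3 + suc m * 2)
  M = path₃ ⊕ pairs (suc m) false
  walk : ∀ v → Walk (gr (dense₃ (suc m))) v zero
  walk zero = Walk.here
  -- In the complement a leaf of the path is not adjacent to its centre; the detour uses a vertex of
  -- the first pair.
  walk (suc zero) = step {v = suc (suc (suc zero))} _ (step _ Walk.here)
  walk (suc (suc zero)) = step {v = suc (suc (suc zero))} _ (step _ Walk.here)
  walk (suc (suc (suc v))) = step {v = zero} (co-adj M {suc (suc (suc v))} {zero} (λ ()) (adj-rl path₃ (pairs (suc m) false) v zero)) Walk.here

parity : ∀ k → (∃ λ q → k ≡ q * 2) ⊎ (∃ λ q → k ≡ 1 + q * 2)
parity zero = inj₁ (0 , refl)
parity (suc k) with parity k
... | inj₁ (q , e) = inj₂ (q , cong suc e)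
... | inj₂ (q , e) = inj₁ (suc q , cong suc e)

-- Three components of k + 1 vertices and the cut vertex make 3k + 4. Two of them have the least
-- number 2 of marked vertices; the third has the other k - 4, which is at least 2 for k ≥ 6.
even-example : ∀ k → 2 ∣ k → 6 ≤ k → Σ (Graph (3 * k + 4)) λ G → Regular k G × Connected G × ¬ HamiltonianPath G
even-example k (divides q refl) 6≤k = with-q q (*-cancelʳ-≤ 3 q 2 6≤k)
  where
  with-q : ∀ q → 3 ≤ q → Σ (Graph (3 * (q * 2) + 4)) λ G → Regular (q * 2) G × Connected G × ¬ HamiltonianPath G
  with-q (suc (suc (suc i))) (s≤s (s≤s (s≤s z≤n))) = cone-without-path (A ⊕ (A ⊕ B)) marks
      (⊕-completes A (A ⊕ B) cA (⊕-completes A B cA cB)) (⊕-reach A (A ⊕ B) rA (⊕-reach A B rA rB)) (⊕-label A (⊕-label A (one-label B))) _ (count i)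
    where
    A : Marked (1 * 2 + (5 + i * 2))
    A = dense 1 (5 + i * 2)
    B : Marked (suc i * 2 + 5)
    B = dense (suc i) 5
    cA : Completes (6 + i * 2) A
    cA = dense-completes 1 (5 + i * 2) refl
    cB : Completes (6 + i * 2) B
    cB = dense-completes (suc i) 5 (cong (2 +_) (+-comm (i * 2) 5))
    rA : Reach A
    rA = dense-reach 0 (5 + i * 2)
    rB : Reach B
    rB = dense-reach i 5
    marks : #marks (A ⊕ (A ⊕ B)) ≡ 6 + i * 2
    marks = #marks-⊕ A (A ⊕ B) ∙ cong₂ _+_ (#marks-dense 1 (5 + i * 2))
        (#marks-⊕ A B ∙ cong₂ _+_ (#marks-dense 1 (5 + i * 2)) (#marks-dense (suc i) 5))
    count : ∀ i → 3 * (6 + i * 2) + 4 ≡ suc (1 * 2 + (5 + i * 2) + (1 * 2 + (5 + i * 2) + (suc i * 2 + 5)))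
    count = solve-∀

-- Since `dense` has an even number of marked vertices, an odd k calls for `dense₃` with its single
-- one: 2 + (k - 3) + 1 = k. Its additional vertex turns 3k + 4 into 3k + 5.
odd-example : ∀ k → ¬ (2 ∣ k) → 5 ≤ k → Σ (Graph (3 * k + 5)) λ G → Regular k G × Connected G × ¬ HamiltonianPath G
odd-example k ¬2∣k 5≤k with parity k
... | inj₁ (q , e) = ⊥-elim (¬2∣k (divides q e))
... | inj₂ (q , refl) = with-q q (*-cancelʳ-≤ 2 q 2 (≤-pred 5≤k))
  where
  with-q : ∀ q → 2 ≤ q → Σ (Graph (3 * (1 + q * 2) + 5)) λ G → Regular (1 + q * 2) G × Connected G × ¬ HamiltonianPath G
  with-q (suc (suc i)) (s≤s (s≤s z≤n)) = cone-without-path (A ⊕ (B ⊕ D)) marks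
      (⊕-completes A (B ⊕ D) cA (⊕-completes B D cB cD)) (⊕-reach A (B ⊕ D) rA (⊕-reach B D rB rD)) (⊕-label A (⊕-label B (one-label D))) _ (count i)
    where
    A : Marked (1 * 2 + (4 + i * 2))
    A = dense 1 (4 + i * 2)
    B : Marked (suc i * 2 + 4)
    B = dense (suc i) 4
    D : Marked (3 + (2 + i) * 2)
    D = dense₃ (2 + i)
    cA : Completes (5 + i * 2) A
    cA = dense-completes 1 (4 + i * 2) refl
    cB : Completes (5 + i * 2) B
    cB = dense-completes (suc i) 4 (cong (2 +_) (+-comm (i * 2) 4))
    cD : Completes (5 + i * 2) D
    cD = dense₃-completes (2 + i) refl
    rA : Reach A
    rA = dense-reach 0 (4 + i * 2)
    rB : Reach B
    rB = dense-reach i 4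
    rD : Reach D
    rD = dense₃-reach (1 + i)
    marks : #marks (A ⊕ (B ⊕ D)) ≡ 5 + i * 2
    marks = #marks-⊕ A (B ⊕ D) ∙ cong₂ _+_ (#marks-dense 1 (4 + i * 2))
        (#marks-⊕ B D ∙ cong₂ _+_ (#marks-dense (suc i) 4) (#marks-dense₃ (2 + i))) ∙ lem i
      where
      lem : ∀ i → 2 + (suc i * 2 + 1) ≡ 5 + i * 2
      lem = solve-∀
    count : ∀ i → 3 * (5 + i * 2) + 5 ≡ suc (1 * 2 + (4 + i * 2) + (suc i * 2 + 4 + (3 + (2 + i) * 2)))
    count = solve-∀

theorem2p3 : ((k n : ℕ) (G : Graph n) → Regular k G → Connected G → n ≤ 3 * k + 3 →
    HamiltonianPath G)
    × ((k : ℕ) → 2 ∣ k → 6 ≤ k →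
    Σ (Graph (3 * k + 4)) λ G → Regular k G × Connected G × ¬ HamiltonianPath G)
    × ((k : ℕ) → ¬ (2 ∣ k) → 5 ≤ k →
    Σ (Graph (3 * k + 5)) λ G → Regular k G × Connected G × ¬ HamiltonianPath G)
theorem2p3 = (λ k n G reg conn n≤ → hamiltonian-path G reg conn n≤) , even-example , odd-example
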